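{- Let $r \geq 3$ and $s \geq 3$ be integers and let $F$ be a graph with chromatic number $\chi(F) = r+1$. Then, as $m \to \infty$, \[ \mathrm{mex}_{K_s}(m, F) = \mathrm{mex}_{K_s}(m, K_{r+1}) + o(m^{s/2}). \]
   Context: All graphs are finite and simple. For graphs $T$ and $F$, $\mathrm{mex}_T(m,F)$ is the maximum number of copies of $T$ in an $F$-free graph (a graph containing no subgraph isomorphic to $F$) with exactly $m$ edges, where no restriction is placed on the number of vertices. For $T = K_s$ this counts $s$-cliques. -}

module Defs where

open import Data.Nat using (ℕ; zero; suc; _≤_; _+_; _≟_)
open import Data.Bool using (Bool; true; false; _∧_; _∨_; not; if_then_else_)
open import Data.Fin using (Fin; toℕ)
open import Data.Fin.Properties using () renaming (_≟_ to _≟ᶠ_)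
open import Data.Vec using (Vec; []; _∷_; lookup)
open import Data.List using (List; []; _∷_; map; _++_; allFin)
open import Data.Bool.ListAction using (and)
open import Data.Product using (Σ; ∃; _×_; _,_)
open import Relation.Nullary using (¬_; yes; no)
open import Data.Empty using (⊥-elim)
open import Relation.Nullary.Decidable using (⌊_⌋)
open import Relation.Binary.PropositionalEquality using (_≡_; _≢_; refl) renaming (sym to ≡-sym)
open import Function.Definitions using (Injective)

record Graph : Set where
  field
    V     : ℕ
    adj   : Fin V → Fin V → Bool
    sym   : ∀ i j → adj i j ≡ adj j i
    irrefl : ∀ i → adj i i ≡ false
open Graph public

allSubsets : (n : ℕ) → List (Vec Bool n)
allSubsets zero = [] ∷ []
allSubsets (suc n) = map (false ∷_) (allSubsets n) ++ map (true ∷_) (allSubsets n)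

card : ∀ {n} → Vec Bool n → ℕ
card [] = 0
card (true ∷ v) = suc (card v)
card (false ∷ v) = card v

isClique : (G : Graph) → Vec Bool (V G) → Bool
isClique G p =
  and (map (λ i → and (map (λ j →
        not (lookup p i ∧ lookup p j) ∨ ⌊ i ≟ᶠ j ⌋ ∨ adj G i j)
      (allFin (V G)))) (allFin (V G)))

countB : {A : Set} → (A → Bool) → List A → ℕ
countB f [] = 0
countB f (x ∷ xs) = if f x then suc (countB f xs) else countB f xs

cliqueCount : ℕ → Graph → ℕ
cliqueCount s G =
  countB (λ p → ⌊ card p ≟ s ⌋ ∧ isClique G p) (allSubsets (V G))

edgeCount : Graph → ℕ
edgeCount G = cliqueCount 2 G

_⊆ᴳ_ : Graph → Graph → Set
F ⊆ᴳ G = Σ (Fin (V F) → Fin (V G)) λ f →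
           Injective _≡_ _≡_ f × (∀ i j → adj F i j ≡ true → adj G (f i) (f j) ≡ true)

_Free_ : Graph → Graph → Set
G Free F = ¬ (F ⊆ᴳ G)

Colorable : Graph → ℕ → Set
Colorable G k = Σ (Fin (V G) → Fin k) λ c → ∀ i j → adj G i j ≡ true → c i ≢ c j

ChromaticNumberIs : Graph → ℕ → Set
ChromaticNumberIs G zero = V G ≡ 0
ChromaticNumberIs G (suc k) = Colorable G (suc k) × ¬ Colorable G k

K : ℕ → Graph
K n = record { V = n ; adj = λ i j → not ⌊ i ≟ᶠ j ⌋ ; sym = symK ; irrefl = irrK }
  where
    symK : ∀ (i j : Fin n) → not ⌊ i ≟ᶠ j ⌋ ≡ not ⌊ j ≟ᶠ i ⌋
    symK i j with i ≟ᶠ j | j ≟ᶠ i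
    ... | yes _ | yes _ = refl
    ... | no _  | no _  = refl
    ... | yes e | no n′ = ⊥-elim (n′ (≡-sym e))
    ... | no n′ | yes e = ⊥-elim (n′ (≡-sym e))
    irrK : ∀ (i : Fin n) → not ⌊ i ≟ᶠ i ⌋ ≡ false
    irrK i with i ≟ᶠ i
    ... | yes _ = refl
    ... | no n′ = ⊥-elim (n′ refl)

IsMex : ℕ → ℕ → Graph → ℕ → Set
IsMex s m F v =
  (Σ Graph λ G → G Free F × edgeCount G ≡ m × cliqueCount s G ≡ v)
  × (∀ (G : Graph) → G Free F → edgeCount G ≡ m → cliqueCount s G ≤ v)

{-# OPTIONS --safe #-}
module Submission where

-- Write H s for the number of homomorphisms from K s, extended to vertex weights, and c s = r (r - 1) ⋯ (r - s + 1).
--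
-- Zykov symmetrisation turns any weighting of a K (r + 1)-free graph into one supported on a clique without
-- changing H 2 or decreasing H s, and on a clique Newton's inequalities give (H s)² (c 2)^s ≤ (c s)² (H 2)^s.
-- A random sample of t vertices of a graph with few (r + 1)-cliques is usually K (r + 1)-free; averaging the
-- inequality over samples shows that it holds for such a graph up to an error that vanishes as t grows.
--
-- In an F-free graph with m edges, the s-cliques meeting a vertex of degree less than ε √m are negligible, and the
-- remaining O(√m / ε) vertices span few (r + 1)-cliques, since otherwise they would span a blow-up of K (r + 1) that
-- contains F.  So the inequality bounds the clique counts of both extremal graphs from above.  The complete r-partite
-- graph with equal parts, padded with disjoint edges, contains neither F nor K (r + 1) and matches that bound.

open import Defs hiding (sym)
open import Data.Bool using (Bool; true; false; _∧_; _∨_; not; if_then_else_)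
open import Data.Bool.ListAction using (and)
open import Data.Bool.Properties using (∧-zeroʳ; ⇔→≡)
open import Data.Empty using (⊥-elim)
open import Data.Fin as Fin using (Fin; zero; suc; _↑ˡ_; _↑ʳ_; inject₁; quotient)
import Data.Fin.Properties as Fin
open import Data.List using (List; []; _∷_; map; _++_; length; concatMap; allFin)
open import Data.List.Membership.Propositional using (_∈_)
open import Data.List.Membership.Propositional.Properties using (∈-allFin)
open import Data.List.Properties using (length-map; length-tabulate; map-++; map-cong; map-tabulate; map-∘)
open import Data.List.Relation.Binary.Permutation.Propositional as Perm using (_↭_)
import Data.List.Relation.Binary.Permutation.Propositional.Properties as PermP
open import Data.List.Relation.Unary.All using (All; []; _∷_)
open import Data.List.Relation.Unary.AllPairs using (AllPairs; []; _∷_)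
open import Data.List.Relation.Unary.Any using (here; there)
open import Data.Nat as ℕ hiding (_≟_)
open import Data.Nat.DivMod using (m%n<n; m/n*n≤m; m/n≤m; m≡m%n+[m/n]*n; m≥n⇒m/n>0)
open import Data.Nat.Properties hiding (_≟_)
open import Data.Nat.Tactic.RingSolver using (solve-∀)
open import Data.Product using (Σ; ∃; _×_; _,_; proj₁; proj₂)
open import Data.Sum using (_⊎_; inj₁; inj₂)
open import Data.Unit using (⊤; tt)
open import Data.Vec using (Vec; []; _∷_; lookup; toList; _[_]≔_)
open import Data.Vec.Properties using (lookup∘update′)
open import Function.Bundles using (mk⇔)
open import Relation.Binary.PropositionalEquality
open import Relation.Nullary using (¬_; yes; no)
open import Relation.Nullary.Decidable using (⌊_⌋)

-- Neither extremal number is computed. For `v` either of them, `N * (s ! * v)` is pinned to the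
-- same window of width `C * x ^ s`, where `x` is the integer square root of 2m / c 2. As `C` is
-- independent of `N`, a large `N` makes the window negligible.
--
-- Everything stays in ℕ: odd s would bring in half-integral powers, hence the squared inequality,
-- and denominators are cleared throughout. Weights serve the symmetrisation: merging two
-- non-adjacent vertices while keeping H 2 would need fractional clones in an unweighted graph.
--
-- The obstacle in the averaging is that (H s)² is bounded by the s-th power of H 2, so the s-th
-- moment of the edges in a sample is needed and not only the mean. Exchanging one of t sampled
-- vertices changes H 2 by at most 2t, against a mean of order t², so the moment is that of the mean
-- up to a shift of order t. This shift is measured against n², with n the number of vertices, and
-- is harmless only if n² is comparable with the number of edges; discarding the vertices of small
-- degree ensures this.

-- Finite sums over lists.

∑ : {A : Set} → List A → (A → ℕ) → ℕ
∑ []       f = 0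
∑ (x ∷ xs) f = f x + ∑ xs f

module _ {A : Set} where

  ∑-cong : (xs : List A) {f g : A → ℕ} → (∀ x → f x ≡ g x) → ∑ xs f ≡ ∑ xs g
  ∑-cong []       e = refl
  ∑-cong (x ∷ xs) e = cong₂ _+_ (e x) (∑-cong xs e)

  ∑-mono : (xs : List A) {f g : A → ℕ} → (∀ x → f x ≤ g x) → ∑ xs f ≤ ∑ xs g
  ∑-mono []       e = z≤n
  ∑-mono (x ∷ xs) e = +-mono-≤ (e x) (∑-mono xs e)

  ∑-+ : (xs : List A) {f g : A → ℕ} → ∑ xs (λ x → f x + g x) ≡ ∑ xs f + ∑ xs g
  ∑-+ [] = refl
  ∑-+ (x ∷ xs) {f} {g} rewrite ∑-+ xs {f} {g} = lem (f x) (g x) (∑ xs f) (∑ xs g)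
    where lem : ∀ a b c d → a + b + (c + d) ≡ a + c + (b + d)
          lem = solve-∀

  ∑-*ˡ : (xs : List A) (c : ℕ) {f : A → ℕ} → ∑ xs (λ x → c * f x) ≡ c * ∑ xs f
  ∑-*ˡ [] c = sym (*-zeroʳ c)
  ∑-*ˡ (x ∷ xs) c {f} rewrite ∑-*ˡ xs c {f} = sym (*-distribˡ-+ c (f x) (∑ xs f))

  ∑-*ʳ : (xs : List A) (c : ℕ) {f : A → ℕ} → ∑ xs (λ x → f x * c) ≡ ∑ xs f * c
  ∑-*ʳ [] c = refl
  ∑-*ʳ (x ∷ xs) c {f} rewrite ∑-*ʳ xs c {f} = sym (*-distribʳ-+ c (f x) (∑ xs f))

  ∑-const : (xs : List A) (c : ℕ) → ∑ xs (λ _ → c) ≡ length xs * c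
  ∑-const []       c = refl
  ∑-const (x ∷ xs) c = cong (c +_) (∑-const xs c)

  ∑-zero : (xs : List A) {f : A → ℕ} → (∀ x → f x ≡ 0) → ∑ xs f ≡ 0
  ∑-zero xs e = trans (∑-cong xs e) (trans (∑-const xs 0) (*-zeroʳ (length xs)))

  ∑-bound : (xs : List A) {f : A → ℕ} {c : ℕ} → (∀ x → f x ≤ c) → ∑ xs f ≤ length xs * c
  ∑-bound xs {c = c} e = ≤-trans (∑-mono xs e) (≤-reflexive (∑-const xs c))

  ∑-++ : (xs ys : List A) {f : A → ℕ} → ∑ (xs ++ ys) f ≡ ∑ xs f + ∑ ys f
  ∑-++ []       ys = refl
  ∑-++ (x ∷ xs) ys {f} = trans (cong (f x +_) (∑-++ xs ys)) (sym (+-assoc (f x) _ _))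

  ∑-↭ : {xs ys : List A} {f : A → ℕ} → xs ↭ ys → ∑ xs f ≡ ∑ ys f
  ∑-↭ Perm.refl = refl
  ∑-↭ {f = f} (Perm.prep x p) = cong (f x +_) (∑-↭ p)
  ∑-↭ {f = f} (Perm.swap {xs} x y p) rewrite ∑-↭ {f = f} p = lem (f x) (f y) _
    where lem : ∀ a b c → a + (b + c) ≡ b + (a + c)
          lem = solve-∀
  ∑-↭ (Perm.trans p q) = trans (∑-↭ p) (∑-↭ q)

  ∑-map : {B : Set} (g : B → A) (xs : List B) {f : A → ℕ} → ∑ (map g xs) f ≡ ∑ xs (λ x → f (g x))
  ∑-map g []       = refl
  ∑-map g (x ∷ xs) {f} = cong (f (g x) +_) (∑-map g xs)

  ∑-concatMap : {B : Set} (g : B → List A) (xs : List B) {f : A → ℕ} →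
                ∑ (concatMap g xs) f ≡ ∑ xs (λ x → ∑ (g x) f)
  ∑-concatMap g []       = refl
  ∑-concatMap g (x ∷ xs) {f} = trans (∑-++ (g x) _) (cong (∑ (g x) f +_) (∑-concatMap g xs))

∑-swap : {A B : Set} (xs : List A) (ys : List B) {f : A → B → ℕ} →
         ∑ xs (λ x → ∑ ys (f x)) ≡ ∑ ys (λ y → ∑ xs (λ x → f x y))
∑-swap []       ys     = sym (∑-zero ys λ _ → refl)
∑-swap (x ∷ xs) ys {f} = trans (cong (∑ ys (f x) +_) (∑-swap xs ys)) (sym (∑-+ ys))

-- Falling factorials.

-- The number of injections from an s-set to a t-set, by the recursion matching H-∷ below.
ff : ℕ → ℕ → ℕ
ff t       zero    = 1
ff zero    (suc s) = 0
ff (suc t) (suc s) = ff t (suc s) + suc s * ff t s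

ff-suc-suc : ∀ t s → ff (suc t) (suc s) ≡ suc t * ff t s
ff-suc-suc zero    zero    = refl
ff-suc-suc zero    (suc s) = *-zeroʳ (suc (suc s))
ff-suc-suc (suc t) zero    rewrite ff-suc-suc t zero = lem t
  where lem : ∀ t → suc t * 1 + 1 ≡ suc (suc t) * 1
        lem = solve-∀
ff-suc-suc (suc t) (suc s) = begin
  ff (suc t) (2 + s) + (2 + s) * ff (suc t) (suc s)
    ≡⟨ cong (_+ (2 + s) * ff (suc t) (suc s)) (ff-suc-suc t (suc s)) ⟩
  suc t * ff t (suc s) + (2 + s) * ff (suc t) (suc s)
    ≡⟨ lem (suc t) (ff t (suc s)) (suc s) (ff (suc t) (suc s)) ⟩
  suc t * ff t (suc s) + suc s * ff (suc t) (suc s) + ff (suc t) (suc s)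
    ≡⟨ cong (λ z → suc t * ff t (suc s) + suc s * z + ff (suc t) (suc s)) (ff-suc-suc t s) ⟩
  suc t * ff t (suc s) + suc s * (suc t * ff t s) + ff (suc t) (suc s)
    ≡⟨ lem′ (suc t) (ff t (suc s)) (suc s) (ff t s) ⟩
  suc (suc t) * (ff t (suc s) + suc s * ff t s) ∎
  where
  open ≡-Reasoning
  lem : ∀ a b c d → a * b + (1 + c) * d ≡ a * b + c * d + d
  lem = solve-∀
  lem′ : ∀ a b c d → a * b + c * (a * d) + (b + c * d) ≡ (1 + a) * (b + c * d)
  lem′ = solve-∀

-- The last factor is split off here, the first one in `ff-suc-suc`. Truncated subtraction is
-- correct: for `s ≥ t` both sides are 0.
ff-suc : ∀ t s → ff t (suc s) ≡ (t ∸ s) * ff t s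
ff-suc zero    zero    = refl
ff-suc zero    (suc s) = refl
ff-suc (suc t) zero    = trans (ff-suc-suc t zero) refl
ff-suc (suc t) (suc s) = begin
  ff (suc t) (2 + s)               ≡⟨ ff-suc-suc t (suc s) ⟩
  suc t * ff t (suc s)             ≡⟨ cong (suc t *_) (ff-suc t s) ⟩
  suc t * ((t ∸ s) * ff t s)       ≡⟨ lem (suc t) (t ∸ s) (ff t s) ⟩
  (t ∸ s) * (suc t * ff t s)       ≡⟨ cong ((t ∸ s) *_) (sym (ff-suc-suc t s)) ⟩
  (t ∸ s) * ff (suc t) (suc s)     ∎
  where
  open ≡-Reasoning
  lem : ∀ a b c → a * (b * c) ≡ b * (a * c)
  lem = solve-∀

ff≤^ : ∀ t s → ff t s ≤ t ^ s
ff≤^ t zero    = ≤-refl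
ff≤^ t (suc s) = ≤-trans (≤-reflexive (ff-suc t s)) (*-mono-≤ (m∸n≤m t s) (ff≤^ t s))

^≤ff : ∀ t s → t ^ s ≤ ff (t + s) s
^≤ff t zero    = ≤-refl
^≤ff t (suc s) = begin
  t * t ^ s                  ≤⟨ *-mono-≤ (≤-trans (m≤m+n t s) (n≤1+n _)) (^≤ff t s) ⟩
  suc (t + s) * ff (t + s) s ≡⟨ sym (ff-suc-suc (t + s) s) ⟩
  ff (suc (t + s)) (suc s)   ≡⟨ cong (λ z → ff z (suc s)) (sym (+-suc t s)) ⟩
  ff (t + suc s) (suc s)     ∎
  where open ≤-Reasoning

-- Weighted clique sums.

-- A vertex may occur several times. As `A v v` will be 0, its copies are pairwise non-adjacent,
-- like clones; samples with repetition and multipartite graphs are therefore lists of the same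
-- kind.
WList : Set → Set
WList X = List (X × ℕ)

weigh : {X : Set} → (X → ℕ) → List X → WList X
weigh z = map (λ v → v , z v)

unit : {X : Set} → List X → WList X
unit = weigh (λ _ → 1)

module Cliques {X : Set} (A : X → X → ℕ) where

  -- Non-neighbours of `v` get weight 0 and stay in the list, so that restrictions commute on the
  -- nose and lengths do not change.
  restrict : X → WList X → WList X
  restrict v = map (λ e → proj₁ e , A v (proj₁ e) * proj₂ e)

  -- H s l is the sum, over ordered s-cliques, of the products of the weights of their vertices.
  H : ℕ → WList X → ℕ
  H zero    l = 1
  H (suc s) l = ∑ l (λ e → proj₂ e * H s (restrict (proj₁ e) l))

  scale : ℕ → WList X → WList X
  scale c = map (λ e → proj₁ e , c * proj₂ e)

  restrict-weigh : ∀ u z xs → restrict u (weigh z xs) ≡ weigh (λ v → A u v * z v) xs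
  restrict-weigh u z xs = sym (map-∘ xs)

  H-weigh-suc : ∀ s z xs → H (suc s) (weigh z xs) ≡ ∑ xs (λ v → z v * H s (weigh (λ u → A v u * z u) xs))
  H-weigh-suc s z xs = trans (∑-map _ xs) (∑-cong xs λ v → cong (λ l → z v * H s l) (restrict-weigh v z xs))

H-map : {X Y : Set} (A : X → X → ℕ) (g : Y → X) (s : ℕ) (z : X → ℕ) (xs : List Y) →
  Cliques.H A s (weigh z (map g xs)) ≡ Cliques.H (λ u v → A (g u) (g v)) s (weigh (λ v → z (g v)) xs)
H-map A g zero    z xs = refl
H-map A g (suc s) z xs = trans (Cliques.H-weigh-suc A s z (map g xs)) (trans (∑-map g xs)
  (trans (∑-cong xs λ v → cong (z (g v) *_) (H-map A g s (λ u → A (g v) u * z u) xs))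
    (sym (Cliques.H-weigh-suc (λ u v → A (g u) (g v)) s (λ v → z (g v)) xs))))

module CliqueProperties {X : Set} (A : X → X → ℕ)
  (A-sym : ∀ u v → A u v ≡ A v u) (A-irr : ∀ v → A v v ≡ 0) (A≤1 : ∀ u v → A u v ≤ 1) where

  open Cliques A public

  restrict-comm : ∀ u v l → restrict u (restrict v l) ≡ restrict v (restrict u l)
  restrict-comm u v []            = refl
  restrict-comm u v ((w , c) ∷ l) =
    cong₂ _∷_ (cong (w ,_) (lem (A u w) (A v w) c)) (restrict-comm u v l)
    where lem : ∀ a b c → a * (b * c) ≡ b * (a * c)
          lem = solve-∀

  -- Since `A u u` is 0, an ordered clique uses the new entry in at most one of its `suc s`
  -- positions, and by symmetry every position contributes the same. In particular `H` is affine in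
  -- each single weight.
  H-∷ : ∀ s u α l → H (suc s) ((u , α) ∷ l) ≡ H (suc s) l + suc s * α * H s (restrict u l)
  H-∷₀ : ∀ s u α l → α ≡ 0 → H s ((u , α) ∷ l) ≡ H s l

  H-∷₀ zero    u α l e = refl
  H-∷₀ (suc s) u .0 l refl = trans (H-∷ s u 0 l) (lem s (H (suc s) l) (H s (restrict u l)))
    where lem : ∀ s a b → a + (1 + s) * 0 * b ≡ a
          lem = solve-∀

  H-∷ zero    u α l = lem α (∑ l (λ e → proj₂ e * 1))
    where lem : ∀ a b → a * 1 + b ≡ b + 1 * a * 1
          lem = solve-∀
  H-∷ (suc s) u α l = begin
    α * H (suc s) ((u , A u u * α) ∷ restrict u l)
      + ∑ l (λ e → proj₂ e * H (suc s) ((u , A (proj₁ e) u * α) ∷ restrict (proj₁ e) l))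
      -- If `u` comes first, its own copy in the restricted list has weight `A u u * α`, which is 0;
      -- this is where the mutual lemma `H-∷₀` enters.
      ≡⟨ cong₂ (λ a b → α * a + b) (H-∷₀ (suc s) u (A u u * α) (restrict u l) (cong (_* α) (A-irr u)))
          (∑-cong l λ e → cong (proj₂ e *_) (H-∷ s u (A (proj₁ e) u * α) (restrict (proj₁ e) l))) ⟩
    α * H (suc s) (restrict u l)
      + ∑ l (λ e → proj₂ e * (H (suc s) (restrict (proj₁ e) l)
               + suc s * (A (proj₁ e) u * α) * H s (restrict u (restrict (proj₁ e) l))))
      ≡⟨ cong (α * H (suc s) (restrict u l) +_) (trans (∑-cong l eq) (∑-+ l)) ⟩
    α * H (suc s) (restrict u l)
      + (H (2 + s) l + ∑ l (λ e → suc s * α * (A u (proj₁ e) * proj₂ e * H s (restrict (proj₁ e) (restrict u l)))))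
      ≡⟨ cong (λ z → α * H (suc s) (restrict u l) + (H (2 + s) l + z)) (∑-*ˡ l (suc s * α)) ⟩
    α * H (suc s) (restrict u l)
      + (H (2 + s) l + suc s * α * ∑ l (λ e → A u (proj₁ e) * proj₂ e * H s (restrict (proj₁ e) (restrict u l))))
      ≡⟨ cong (λ z → α * H (suc s) (restrict u l) + (H (2 + s) l + suc s * α * z)) (sym (∑-map _ l)) ⟩
    α * H (suc s) (restrict u l) + (H (2 + s) l + suc s * α * H (suc s) (restrict u l))
      ≡⟨ lem α (H (suc s) (restrict u l)) (H (2 + s) l) s ⟩
    H (2 + s) l + (2 + s) * α * H (suc s) (restrict u l) ∎
    where
    open ≡-Reasoning
    lem : ∀ α a b s → α * a + (b + (1 + s) * α * a) ≡ b + (2 + s) * α * a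
    lem = solve-∀
    lem′ : ∀ c h s a α k → c * (h + s * (a * α) * k) ≡ c * h + s * α * (a * c * k)
    lem′ = solve-∀
    eq : ∀ e → proj₂ e * (H (suc s) (restrict (proj₁ e) l)
               + suc s * (A (proj₁ e) u * α) * H s (restrict u (restrict (proj₁ e) l)))
             ≡ proj₂ e * H (suc s) (restrict (proj₁ e) l)
               + suc s * α * (A u (proj₁ e) * proj₂ e * H s (restrict (proj₁ e) (restrict u l)))
    eq (v , c) rewrite restrict-comm u v l | A-sym v u = lem′ c _ (suc s) (A u v) α _

  restrict-↭ : ∀ {v l l′} → l ↭ l′ → restrict v l ↭ restrict v l′
  restrict-↭ Perm.refl = Perm.refl
  restrict-↭ (Perm.prep x p) = Perm.prep _ (restrict-↭ p)
  restrict-↭ (Perm.swap x y p) = Perm.swap _ _ (restrict-↭ p)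
  restrict-↭ (Perm.trans p q) = Perm.trans (restrict-↭ p) (restrict-↭ q)

  H-↭ : ∀ s {l l′} → l ↭ l′ → H s l ≡ H s l′
  H-↭ zero    p = refl
  H-↭ (suc s) {l} p = trans (∑-cong l λ e → cong (proj₂ e *_) (H-↭ s (restrict-↭ p))) (∑-↭ p)

  H-restrict-≤ : ∀ s v l → H s (restrict v l) ≤ H s l
  H-restrict-≤ zero    v l = ≤-refl
  H-restrict-≤ (suc s) v l = begin
    H (suc s) (restrict v l)
      ≡⟨ ∑-map _ l ⟩
    ∑ l (λ e → A v (proj₁ e) * proj₂ e * H s (restrict (proj₁ e) (restrict v l)))
      ≤⟨ ∑-mono l (λ e → *-mono-≤ (≤-trans (*-monoˡ-≤ (proj₂ e) (A≤1 v (proj₁ e))) (≤-reflexive (*-identityˡ _)))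
           (≤-trans (≤-reflexive (cong (H s) (restrict-comm (proj₁ e) v l))) (H-restrict-≤ s v (restrict (proj₁ e) l)))) ⟩
    H (suc s) l ∎
    where open ≤-Reasoning

  H-∷-≥ : ∀ s e l → H s l ≤ H s (e ∷ l)
  H-∷-≥ zero    e l = ≤-refl
  H-∷-≥ (suc s) (u , α) l = ≤-trans (m≤m+n _ _) (≤-reflexive (sym (H-∷ s u α l)))

  H-++-≥ : ∀ s l l′ → H s l′ ≤ H s (l ++ l′)
  H-++-≥ s []      l′ = ≤-refl
  H-++-≥ s (e ∷ l) l′ = ≤-trans (H-++-≥ s l l′) (H-∷-≥ s e (l ++ l′))

  H-vanishes : ∀ s l → H s l ≡ 0 → H (suc s) l ≡ 0
  H-vanishes s l e = ∑-zero l λ x → trans (cong (proj₂ x *_)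
    (n≤0⇒n≡0 (≤-trans (H-restrict-≤ s (proj₁ x) l) (≤-reflexive e)))) (*-zeroʳ (proj₂ x))

  H-vanishes-+ : ∀ d s l → H s l ≡ 0 → H (d + s) l ≡ 0
  H-vanishes-+ zero    s l e = e
  H-vanishes-+ (suc d) s l e = H-vanishes (d + s) l (H-vanishes-+ d s l e)

  restrict-scale : ∀ v c l → restrict v (scale c l) ≡ scale c (restrict v l)
  restrict-scale v c []            = refl
  restrict-scale v c ((w , x) ∷ l) = cong₂ _∷_ (cong (w ,_) (lem (A v w) c x)) (restrict-scale v c l)
    where lem : ∀ a b c → a * (b * c) ≡ b * (a * c)
          lem = solve-∀

  H-scale : ∀ s c l → H s (scale c l) ≡ c ^ s * H s l
  H-scale zero    c l = refl
  H-scale (suc s) c l = begin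
    H (suc s) (scale c l)
      ≡⟨ ∑-map _ l ⟩
    ∑ l (λ e → c * proj₂ e * H s (restrict (proj₁ e) (scale c l)))
      ≡⟨ ∑-cong l (λ e → trans (cong (c * proj₂ e *_)
            (trans (cong (H s) (restrict-scale (proj₁ e) c l)) (H-scale s c (restrict (proj₁ e) l))))
            (lem c (proj₂ e) (c ^ s) _)) ⟩
    ∑ l (λ e → c ^ suc s * (proj₂ e * H s (restrict (proj₁ e) l)))
      ≡⟨ ∑-*ˡ l (c ^ suc s) ⟩
    c ^ suc s * H (suc s) l ∎
    where
    open ≡-Reasoning
    lem : ∀ c x d h → c * x * (d * h) ≡ c * d * (x * h)
    lem = solve-∀

  H≤H₁^ : ∀ s l → H s l ≤ H 1 l ^ s
  H≤H₁^ zero    l = ≤-refl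
  H≤H₁^ (suc s) l = begin
    H (suc s) l
      ≤⟨ ∑-mono l (λ e → *-monoʳ-≤ (proj₂ e) (≤-trans (H-restrict-≤ s (proj₁ e) l) (H≤H₁^ s l))) ⟩
    ∑ l (λ e → proj₂ e * H 1 l ^ s)
      ≡⟨ ∑-*ʳ l (H 1 l ^ s) ⟩
    ∑ l proj₂ * H 1 l ^ s
      ≡⟨ cong (_* H 1 l ^ s) (∑-cong l λ e → sym (*-identityʳ (proj₂ e))) ⟩
    H 1 l * H 1 l ^ s ∎
    where open ≤-Reasoning

-- Arithmetic behind Newton's inequalities.

2ab≤a²+b² : ∀ a b → 2 * a * b ≤ a * a + b * b
2ab≤a²+b² a b with ≤-total a b
... | inj₁ p with m≤n⇒∃[o]m+o≡n p
...   | c , refl = ≤-trans (m≤m+n _ (c * c)) (≤-reflexive (lem a c))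
  where lem : ∀ a c → 2 * a * (a + c) + c * c ≡ a * a + (a + c) * (a + c)
        lem = solve-∀
2ab≤a²+b² a b | inj₂ p with m≤n⇒∃[o]m+o≡n p
...   | c , refl = ≤-trans (m≤m+n _ (c * c)) (≤-reflexive (lem b c))
  where lem : ∀ b c → 2 * (b + c) * b + c * c ≡ (b + c) * (b + c) + b * b
        lem = solve-∀

^-*-distrib : ∀ a b n → (a * b) ^ n ≡ a ^ n * b ^ n
^-*-distrib a b zero    = refl
^-*-distrib a b (suc n) rewrite ^-*-distrib a b n = lem a b (a ^ n) (b ^ n)
  where lem : ∀ a b c d → a * b * (c * d) ≡ a * c * (b * d)
        lem = solve-∀

cancel : ∀ c {a b} → 0 < c → c * a ≤ c * b → a ≤ b
cancel (suc c) _ p = *-cancelˡ-≤ (suc c) p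

-- Multiply two consecutive Newton inequalities and cancel `y * z * (1 + d)`. The last two
-- hypotheses settle the cases in which this factor vanishes. The factor `j` stays because for
-- `j = 0` there is no fourth term `w`.
newton-cross : ∀ j d x y z w → x * z * (1 + d) ≤ y * y * d → j * (y * w * (2 + d)) ≤ j * (z * z * (1 + d)) →
               (z ≡ 0 → y ≡ 0) → (y ≡ 0 → x ≡ 0) → j * (x * w * (2 + d)) ≤ j * (y * z * d)
newton-cross j d x zero z w p q f g rewrite g refl = ≤-trans (≤-reflexive (*-zeroʳ j)) z≤n
newton-cross j d x (suc y) zero w p q f g with f refl
... | ()
newton-cross j d x y@(suc _) z@(suc _) w p q f g = cancel (y * z * (1 + d)) (s≤s z≤n) (begin
  y * z * (1 + d) * (j * (x * w * (2 + d)))   ≡⟨ lem x y z w j d ⟩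
  x * z * (1 + d) * (j * (y * w * (2 + d)))   ≤⟨ *-mono-≤ p q ⟩
  y * y * d * (j * (z * z * (1 + d)))         ≡⟨ lem′ y z j d ⟩
  y * z * (1 + d) * (j * (y * z * d))         ∎)
  where
  open ≤-Reasoning
  lem : ∀ x y z w j d → y * z * (1 + d) * (j * (x * w * (2 + d))) ≡ x * z * (1 + d) * (j * (y * w * (2 + d)))
  lem = solve-∀
  lem′ : ∀ y z j d → y * y * d * (j * (z * z * (1 + d))) ≡ y * z * (1 + d) * (j * (y * z * d))
  lem′ = solve-∀

-- Multiplied by 1 + d, the two sides differ by the square (y − t (1 + d) z)².
newton-step : ∀ j d t x y z w → x * z * (1 + d) ≤ y * y * d → j * (y * w * (2 + d)) ≤ j * (z * z * (1 + d)) →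
  (z ≡ 0 → y ≡ 0) → (y ≡ 0 → x ≡ 0) →
  (x + (2 + j) * t * y) * (z + j * t * w) * (2 + d) ≤ (y + (1 + j) * t * z) * (y + (1 + j) * t * z) * (1 + d)
newton-step j d t x y z w p q f g = cancel (1 + d) (s≤s z≤n) (+-cancelʳ-≤ (2 * y * (t * (1 + d) * z)) _ _ (begin
  (1 + d) * ((x + (2 + j) * t * y) * (z + j * t * w) * (2 + d)) + 2 * y * (t * (1 + d) * z)
    ≤⟨ +-monoʳ-≤ ((1 + d) * ((x + (2 + j) * t * y) * (z + j * t * w) * (2 + d))) (2ab≤a²+b² y (t * (1 + d) * z)) ⟩
  (1 + d) * ((x + (2 + j) * t * y) * (z + j * t * w) * (2 + d)) + (y * y + t * (1 + d) * z * (t * (1 + d) * z))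
    ≡⟨ lem j d t x y z w ⟩
  (2 + d) * (x * z * (1 + d)) + (2 + j) * (1 + d) * t * t * (j * (y * w * (2 + d))) + t * (1 + d) * (j * (x * w * (2 + d)))
    + (t * (1 + d) * (2 + d) * (2 + j) * (y * z) + (y * y + t * (1 + d) * z * (t * (1 + d) * z)))
    ≤⟨ +-monoˡ-≤ _ (+-mono-≤ (+-mono-≤ (*-monoʳ-≤ (2 + d) p) (*-monoʳ-≤ ((2 + j) * (1 + d) * t * t) q))
         (*-monoʳ-≤ (t * (1 + d)) (newton-cross j d x y z w p q f g))) ⟩
  (2 + d) * (y * y * d) + (2 + j) * (1 + d) * t * t * (j * (z * z * (1 + d))) + t * (1 + d) * (j * (y * z * d))
    + (t * (1 + d) * (2 + d) * (2 + j) * (y * z) + (y * y + t * (1 + d) * z * (t * (1 + d) * z)))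
    ≡⟨ lem′ j d t y z ⟩
  (1 + d) * ((y + (1 + j) * t * z) * (y + (1 + j) * t * z) * (1 + d)) + 2 * y * (t * (1 + d) * z) ∎))
  where
  open ≤-Reasoning
  lem : ∀ j d t x y z w →
    (1 + d) * ((x + (2 + j) * t * y) * (z + j * t * w) * (2 + d)) + (y * y + t * (1 + d) * z * (t * (1 + d) * z)) ≡
    (2 + d) * (x * z * (1 + d)) + (2 + j) * (1 + d) * t * t * (j * (y * w * (2 + d))) + t * (1 + d) * (j * (x * w * (2 + d)))
    + (t * (1 + d) * (2 + d) * (2 + j) * (y * z) + (y * y + t * (1 + d) * z * (t * (1 + d) * z)))
  lem = solve-∀
  lem′ : ∀ j d t y z →
    (2 + d) * (y * y * d) + (2 + j) * (1 + d) * t * t * (j * (z * z * (1 + d))) + t * (1 + d) * (j * (y * z * d))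
    + (t * (1 + d) * (2 + d) * (2 + j) * (y * z) + (y * y + t * (1 + d) * z * (t * (1 + d) * z))) ≡
    (1 + d) * ((y + (1 + j) * t * z) * (y + (1 + j) * t * z) * (1 + d)) + 2 * y * (t * (1 + d) * z)
  lem′ = solve-∀

-- Newton gives x/y ≤ (d / (1 + d)) (y/z); squaring it turns a bound (1 + d)² h/c on (y/z)² into d²
-- h/c on (x/y)².
ratio-step : ∀ d c h x y z → x * z * (1 + d) ≤ y * y * d → y * y * c ≤ (1 + d) * (1 + d) * (z * z) * h →
             (z ≡ 0 → x ≡ 0) → x * x * c ≤ d * d * (y * y) * h
ratio-step d c h x y zero p q f rewrite f refl = z≤n
ratio-step d c h x y z@(suc _) p q f = cancel (z * z * ((1 + d) * (1 + d))) (s≤s z≤n) (begin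
  z * z * ((1 + d) * (1 + d)) * (x * x * c)          ≡⟨ lem z d x c ⟩
  x * z * (1 + d) * (x * z * (1 + d)) * c            ≤⟨ *-monoˡ-≤ c (*-mono-≤ p p) ⟩
  y * y * d * (y * y * d) * c                        ≡⟨ lem′ y d c ⟩
  d * d * (y * y) * (y * y * c)                      ≤⟨ *-monoʳ-≤ (d * d * (y * y)) q ⟩
  d * d * (y * y) * ((1 + d) * (1 + d) * (z * z) * h) ≡⟨ lem″ d y z h ⟩
  z * z * ((1 + d) * (1 + d)) * (d * d * (y * y) * h) ∎)
  where
  open ≤-Reasoning
  lem : ∀ z d x c → z * z * ((1 + d) * (1 + d)) * (x * x * c) ≡ x * z * (1 + d) * (x * z * (1 + d)) * c
  lem = solve-∀
  lem′ : ∀ y d c → y * y * d * (y * y * d) * c ≡ d * d * (y * y) * (y * y * c)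
  lem′ = solve-∀
  lem″ : ∀ d y z h → d * d * (y * y) * ((1 + d) * (1 + d) * (z * z) * h) ≡ z * z * ((1 + d) * (1 + d)) * (d * d * (y * y) * h)
  lem″ = solve-∀

-- Newton's and Maclaurin's inequalities on a clique.

module TuránInequality {X : Set} (A : X → X → ℕ)
  (A-sym : ∀ u v → A u v ≡ A v u) (A-irr : ∀ v → A v v ≡ 0) (A≤1 : ∀ u v → A u v ≤ 1) where

  open CliqueProperties A A-sym A-irr A≤1 public

  Adjacent : X × ℕ → X × ℕ → Set
  Adjacent e f = A (proj₁ e) (proj₁ f) ≡ 1

  restrict-adjacent : ∀ e l → All (Adjacent e) l → restrict (proj₁ e) l ≡ l
  restrict-adjacent e []            []       = refl
  restrict-adjacent e ((v , c) ∷ l) (p ∷ ps) =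
    cong₂ _∷_ (cong (v ,_) (trans (cong (_* c) p) (*-identityˡ c))) (restrict-adjacent e l ps)

  H-∷-adjacent : ∀ k u t l → All (Adjacent (u , t)) l → H (suc k) ((u , t) ∷ l) ≡ H (suc k) l + suc k * t * H k l
  H-∷-adjacent k u t l p =
    trans (H-∷ k u t l) (cong (λ z → H (suc k) l + suc k * t * H k z) (restrict-adjacent (u , t) l p))

  -- On a clique, `H k` is k! times the elementary symmetric polynomial of the weights, and the
  -- factorials turn Newton's constant into d / (1 + d). The vanishing hypothesis says that at most
  -- `1 + j + d` weights are positive. The induction removes entries: a positive weight lowers `d`
  -- by one, a zero weight leaves it alone.
  newton : ∀ j d l → AllPairs Adjacent l → H (2 + j + d) l ≡ 0 →
           H (2 + j) l * H j l * (1 + d) ≤ H (1 + j) l * H (1 + j) l * d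
  newton j d       []            ps        e = z≤n
  newton j zero    l             ps        e
    rewrite +-identityʳ j | e = z≤n
  newton j (suc d) ((u , zero) ∷ l) (p ∷ ps) e
    rewrite H-∷₀ (2 + j) u 0 l refl | H-∷₀ (1 + j) u 0 l refl | H-∷₀ j u 0 l refl =
    newton j (suc d) l ps (trans (sym (H-∷₀ (2 + j + suc d) u 0 l refl)) e)
  newton j (suc d) ((u , t@(suc _)) ∷ l) (p ∷ ps) e =
    subst₂ (λ x y → x * H j ((u , t) ∷ l) * (2 + d) ≤ y * y * (1 + d))
      (sym (H-∷-adjacent (1 + j) u t l p)) (sym (H-∷-adjacent j u t l p)) (step j e₀)
    where
    e₀ : H (1 + (j + suc d)) l ≡ 0
    e₀ with m*n≡0⇒m≡0∨n≡0 (suc (1 + (j + suc d)) * t)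
              (m+n≡0⇒n≡0 (H (2 + j + suc d) l) (trans (sym (H-∷-adjacent (1 + (j + suc d)) u t l p)) e))
    ... | inj₂ q = q
    step : ∀ j → H (1 + (j + suc d)) l ≡ 0 →
      (H (2 + j) l + (2 + j) * t * H (1 + j) l) * H j ((u , t) ∷ l) * (2 + d) ≤
      (H (1 + j) l + (1 + j) * t * H j l) * (H (1 + j) l + (1 + j) * t * H j l) * (1 + d)
    -- There is no `H` of index -1; 0 takes its place, always with the factor `j = 0`.
    step zero e₀ = newton-step 0 d t (H 2 l) (H 1 l) 1 0
      (newton 0 d l ps e₀) z≤n (λ ()) (H-vanishes 1 l)
    step (suc j) e₀ = subst
      (λ z → (H (3 + j) l + (3 + j) * t * H (2 + j) l) * z * (2 + d) ≤
        (H (2 + j) l + (2 + j) * t * H (1 + j) l) * (H (2 + j) l + (2 + j) * t * H (1 + j) l) * (1 + d))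
      (sym (H-∷-adjacent j u t l p))
      (newton-step (suc j) d t (H (3 + j) l) (H (2 + j) l) (H (1 + j) l) (H j l)
        (newton (suc j) d l ps (trans (cong (λ z → H (2 + z) l) (sym (+-suc j d))) e₀))
        (*-monoʳ-≤ (suc j) (newton j (suc d) l ps e₀)) (H-vanishes (1 + j) l) (H-vanishes (2 + j) l))

  H-vanishes-≥ : ∀ s t l → s ≤ t → H s l ≡ 0 → H t l ≡ 0
  H-vanishes-≥ s t l s≤t e = subst (λ z → H z l ≡ 0) (m∸n+n≡m s≤t) (H-vanishes-+ (t ∸ s) s l e)

  module _ (r : ℕ) where

    -- Squared form of H (k + 2) / H (k + 1) ≤ (r - 1 - k) √(H 2 / c 2), with equality for r equal
    -- weights. Newton's inequality at 0 starts the induction and each further one lowers the factor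
    -- by one.
    ratio : ∀ k l → AllPairs Adjacent l → H (suc r) l ≡ 0 →
            H (2 + k) l * H (2 + k) l * ff r 2 ≤ (r ∸ (1 + k)) * (r ∸ (1 + k)) * (H (1 + k) l * H (1 + k) l) * H 2 l
    ratio k l ps e with ≤-<-connex r (1 + k)
    ... | inj₁ r≤k rewrite H-vanishes-≥ (suc r) (2 + k) l (s≤s r≤k) e = z≤n
    ... | inj₂ k<r with m≤n⇒∃[o]m+o≡n (<⇒≤ k<r)
    ratio zero l ps e | inj₂ k<r | D , refl = begin
      H 2 l * H 2 l * ff (1 + D) 2
        ≡⟨ cong (H 2 l * H 2 l *_) (trans (ff-suc (1 + D) 1) (cong (D *_) (ff-suc-suc D 0))) ⟩
      H 2 l * H 2 l * (D * ((1 + D) * 1))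
        ≡⟨ lem (H 2 l) D ⟩
      H 2 l * D * (H 2 l * 1 * (1 + D))
        ≤⟨ *-monoʳ-≤ (H 2 l * D) (newton 0 D l ps e) ⟩
      H 2 l * D * (H 1 l * H 1 l * D)
        ≡⟨ lem′ (H 2 l) D (H 1 l) ⟩
      D * D * (H 1 l * H 1 l) * H 2 l ∎
      where
      open ≤-Reasoning
      lem : ∀ h d → h * h * (d * ((1 + d) * 1)) ≡ h * d * (h * 1 * (1 + d))
      lem = solve-∀
      lem′ : ∀ h d x → h * d * (x * x * d) ≡ d * d * (x * x) * h
      lem′ = solve-∀
    ratio (suc k) l ps e | inj₂ k<r | D , refl rewrite m+n∸m≡n k D =
      ratio-step D (ff r 2) (H 2 l) (H (3 + k) l) (H (2 + k) l) (H (1 + k) l)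
        (newton (suc k) D l ps e)
        (subst (λ z → H (2 + k) l * H (2 + k) l * ff r 2 ≤ z * z * (H (1 + k) l * H (1 + k) l) * H 2 l)
          (trans (cong (_∸ k) (sym (+-suc k D))) (m+n∸m≡n k (suc D))) (ratio k l ps e))
        (λ z → H-vanishes (2 + k) l (H-vanishes (1 + k) l z))

    Bounded : ℕ → WList X → Set
    Bounded s l = ff r 2 ^ s * (H s l * H s l) ≤ ff r s * ff r s * H 2 l ^ s

    -- The ratios are multiplied together: their factors assemble `ff r s` by `ff-suc`, and each
    -- contributes one more `H 2`. For `k = 0` the two sides are equal.
    maclaurin : ∀ k l → AllPairs Adjacent l → H (suc r) l ≡ 0 → Bounded (2 + k) l
    maclaurin zero l ps e = ≤-reflexive (lem (ff r 2) (H 2 l))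
      where lem : ∀ c h → c * (c * 1) * (h * h) ≡ c * c * (h * (h * 1))
            lem = solve-∀
    maclaurin (suc k) l ps e = begin
      C * C ^ (2 + k) * (H (3 + k) l * H (3 + k) l)
        ≡⟨ lem C (C ^ (2 + k)) (H (3 + k) l) ⟩
      C ^ (2 + k) * (H (3 + k) l * H (3 + k) l * C)
        ≤⟨ *-monoʳ-≤ (C ^ (2 + k)) (ratio (suc k) l ps e) ⟩
      C ^ (2 + k) * (D * D * (H (2 + k) l * H (2 + k) l) * H 2 l)
        ≡⟨ lem′ (C ^ (2 + k)) D (H (2 + k) l) (H 2 l) ⟩
      D * D * H 2 l * (C ^ (2 + k) * (H (2 + k) l * H (2 + k) l))
        ≤⟨ *-monoʳ-≤ (D * D * H 2 l) (maclaurin k l ps e) ⟩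
      D * D * H 2 l * (ff r (2 + k) * ff r (2 + k) * H 2 l ^ (2 + k))
        ≡⟨ lem″ D (H 2 l) (ff r (2 + k)) (H 2 l ^ (2 + k)) ⟩
      D * ff r (2 + k) * (D * ff r (2 + k)) * (H 2 l * H 2 l ^ (2 + k))
        ≡⟨ cong (λ z → z * z * (H 2 l * H 2 l ^ (2 + k))) (sym (ff-suc r (2 + k))) ⟩
      ff r (3 + k) * ff r (3 + k) * H 2 l ^ (3 + k) ∎
      where
      open ≤-Reasoning
      C = ff r 2
      D = r ∸ (2 + k)
      lem : ∀ c d h → c * d * (h * h) ≡ d * (h * h * c)
      lem = solve-∀
      lem′ : ∀ c d h g → c * (d * d * (h * h) * g) ≡ d * d * g * (c * (h * h))
      lem′ = solve-∀
      lem″ : ∀ d g f h → d * d * g * (f * f * h) ≡ d * f * (d * f) * (g * h)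
      lem″ = solve-∀

  -- Zykov symmetrisation of weights.

  adjacent? : ∀ e f → A (proj₁ e) (proj₁ f) ≡ 0 ⊎ Adjacent e f
  adjacent? e f with A (proj₁ e) (proj₁ f) | A≤1 (proj₁ e) (proj₁ f)
  ... | 0 | _ = inj₁ refl
  ... | 1 | _ = inj₂ refl
  ... | suc (suc _) | s≤s ()

  findNonNeighbour : ∀ e l → All (Adjacent e) l ⊎ ∃ λ f → ∃ λ l′ → l ↭ f ∷ l′ × A (proj₁ e) (proj₁ f) ≡ 0
  findNonNeighbour e [] = inj₁ []
  findNonNeighbour e (f ∷ l) with adjacent? e f
  ... | inj₁ q = inj₂ (f , l , Perm.refl , q)
  ... | inj₂ q with findNonNeighbour e l
  ...   | inj₁ ps = inj₁ (q ∷ ps)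
  ...   | inj₂ (g , l′ , p , q′) = inj₂ (g , f ∷ l′ , Perm.trans (Perm.prep f p) (Perm.swap f g Perm.refl) , q′)

  findNonEdge : ∀ l → AllPairs Adjacent l ⊎
    ∃ λ e → ∃ λ f → ∃ λ l′ → l ↭ e ∷ f ∷ l′ × A (proj₁ e) (proj₁ f) ≡ 0
  findNonEdge [] = inj₁ []
  findNonEdge (e ∷ l) with findNonNeighbour e l
  ... | inj₂ (f , l′ , p , q) = inj₂ (e , f , l′ , Perm.prep e p , q)
  ... | inj₁ ps with findNonEdge l
  ...   | inj₁ pss = inj₁ (ps ∷ pss)
  ...   | inj₂ (f , g , l′ , p , q) = inj₂ (f , g , e ∷ l′ ,
          Perm.trans (Perm.prep e p) (Perm.trans (Perm.swap e f Perm.refl) (Perm.prep f (Perm.swap e g Perm.refl))) , q)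

  H-nonadjacent : ∀ k u α v β l → A u v ≡ 0 →
    H (suc k) ((u , α) ∷ (v , β) ∷ l) ≡ H (suc k) l + suc k * β * H k (restrict v l) + suc k * α * H k (restrict u l)
  H-nonadjacent k u α v β l q = trans (H-∷ k u α ((v , β) ∷ l))
    (cong₂ (λ x y → x + suc k * α * y) (H-∷ k v β l) (H-∷₀ k v _ (restrict u l) (cong (_* β) q)))

  H-merged : ∀ k u α c l → H (suc k) ((u , α) ∷ scale c l) ≡ c ^ suc k * H (suc k) l + suc k * α * (c ^ k * H k (restrict u l))
  H-merged k u α c l = trans (H-∷ k u α (scale c l)) (cong₂ (λ x y → x + suc k * α * y) (H-scale (suc k) c l)
    (trans (cong (H k) (restrict-scale u c l)) (H-scale k c (restrict u l))))

  -- Needed because `merge` multiplies all weights by `H 1 (restrict u l)`, which would destroy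
  -- everything if it were 0. In that case `u` lies in no clique with two or more vertices and can
  -- simply be dropped.
  isolated : ∀ u α v β l → A u v ≡ 0 → H 1 (restrict u l) ≡ 0 →
    ∀ k → 0 < k → H (suc k) ((u , α) ∷ (v , β) ∷ l) ≡ H (suc k) ((v , β) ∷ l)
  isolated u α v β l q e k 0<k = begin
    H (suc k) ((u , α) ∷ (v , β) ∷ l)
      ≡⟨ H-nonadjacent k u α v β l q ⟩
    H (suc k) l + suc k * β * H k (restrict v l) + suc k * α * H k (restrict u l)
      ≡⟨ cong₂ (λ x y → x + suc k * α * y) (sym (H-∷ k v β l)) (H-vanishes-≥ 1 k (restrict u l) 0<k e) ⟩
    H (suc k) ((v , β) ∷ l) + suc k * α * 0
      ≡⟨ trans (cong (H (suc k) ((v , β) ∷ l) +_) (*-zeroʳ (suc k * α))) (+-identityʳ _) ⟩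
    H (suc k) ((v , β) ∷ l) ∎
    where open ≡-Reasoning

  module _ (r s : ℕ) where

    private t = 2 + s

    Bounded-≈ : ∀ l l′ → H t l ≡ H t l′ → H 2 l ≡ H 2 l′ → Bounded r t l → Bounded r t l′
    Bounded-≈ l l′ e e′ b rewrite e | e′ = b

    -- Zykov symmetrisation: both H 2 and H t are affine in (α , β) when u and v are not adjacent, so moving
    -- all the weight to the vertex with the better ratio H (t - 1) / H 1 keeps H 2 and does not decrease H t.
    -- All weights are multiplied by a = H 1 (restrict u l) to stay in ℕ.
    merge : ∀ u α v β l → A u v ≡ 0 → 0 < α → 0 < H 1 (restrict u l) →
      H 1 (restrict u l) * H (1 + s) (restrict v l) ≤ H 1 (restrict v l) * H (1 + s) (restrict u l) →
      (∀ l′ → length l′ ≤ suc (length l) → H (suc r) l′ ≡ 0 → Bounded r t l′) →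
      H (suc r) ((u , α) ∷ (v , β) ∷ l) ≡ 0 → Bounded r t ((u , α) ∷ (v , β) ∷ l)
    merge u α v β l q 0<α 0<a better ih e = cancel (a ^ t * a ^ t) pos (begin
      a ^ t * a ^ t * (ff r 2 ^ t * (h * h))
        ≡⟨ lem₁ (a ^ t) (ff r 2 ^ t) h ⟩
      ff r 2 ^ t * (a ^ t * h * (a ^ t * h))
        ≤⟨ *-monoʳ-≤ (ff r 2 ^ t) (*-mono-≤ Ht Ht) ⟩
      ff r 2 ^ t * (H t l′ * H t l′)
        ≤⟨ ih l′ (≤-reflexive (cong suc (length-map _ l))) Hr ⟩
      ff r t * ff r t * H 2 l′ ^ t
        ≡⟨ cong (λ z → ff r t * ff r t * z) (trans (cong (_^ t) H2) (trans (^-*-distrib (a * a) (H 2 L) t)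
             (cong (_* H 2 L ^ t) (^-*-distrib a a t)))) ⟩
      ff r t * ff r t * (a ^ t * a ^ t * H 2 L ^ t)
        ≡⟨ lem₂ (ff r t) (a ^ t) (H 2 L ^ t) ⟩
      a ^ t * a ^ t * (ff r t * ff r t * H 2 L ^ t) ∎)
      where
      open ≤-Reasoning
      a = H 1 (restrict u l)
      b = H 1 (restrict v l)
      L = (u , α) ∷ (v , β) ∷ l
      -- Keeping H 2 forces the new weight of `u` to be α + β b/a; multiplying all weights by `a`
      -- clears the denominator.
      l′ = (u , a * α + b * β) ∷ scale a l
      h = H t L
      pos : 0 < a ^ t * a ^ t
      pos = *-mono-< (m^n>0 a {{>-nonZero 0<a}} t) (m^n>0 a {{>-nonZero 0<a}} t)
      lem₁ : ∀ x c h → x * x * (c * (h * h)) ≡ c * (x * h * (x * h))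
      lem₁ = solve-∀
      lem₂ : ∀ f x h → f * f * (x * x * h) ≡ x * x * (f * f * h)
      lem₂ = solve-∀
      H2 : H 2 l′ ≡ a * a * H 2 L
      H2 = trans (H-merged 1 u _ a l) (trans (eq a b α β (H 2 l)) (cong (a * a *_) (sym (H-nonadjacent 1 u α v β l q))))
        where eq : ∀ a b α β h → a * (a * 1) * h + 2 * (a * α + b * β) * (a * 1 * a) ≡ a * a * (h + 2 * β * b + 2 * α * a)
              eq = solve-∀
      Ht : a ^ t * H t L ≤ H t l′
      Ht = begin
        a ^ t * H t L
          ≡⟨ cong (a ^ t *_) (H-nonadjacent (1 + s) u α v β l q) ⟩
        a * a ^ suc s * (H t l + t * β * H (1 + s) (restrict v l) + t * α * H (1 + s) (restrict u l))
          ≡⟨ eq a (a ^ suc s) (H t l) t β (H (1 + s) (restrict v l)) α (H (1 + s) (restrict u l)) ⟩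
        a * a ^ suc s * (H t l + t * α * H (1 + s) (restrict u l)) + a ^ suc s * (t * β) * (a * H (1 + s) (restrict v l))
          ≤⟨ +-monoʳ-≤ _ (*-monoʳ-≤ (a ^ suc s * (t * β)) better) ⟩
        a * a ^ suc s * (H t l + t * α * H (1 + s) (restrict u l)) + a ^ suc s * (t * β) * (b * H (1 + s) (restrict u l))
          ≡⟨ eq′ a b (a ^ suc s) (H t l) t β α (H (1 + s) (restrict u l)) ⟩
        a ^ t * H t l + t * (a * α + b * β) * (a ^ suc s * H (1 + s) (restrict u l))
          ≡⟨ sym (H-merged (1 + s) u _ a l) ⟩
        H t l′ ∎
        where
        eq : ∀ a x h t β hv α hu → a * x * (h + t * β * hv + t * α * hu) ≡ a * x * (h + t * α * hu) + x * (t * β) * (a * hv)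
        eq = solve-∀
        eq′ : ∀ a b x h t β α hu → a * x * (h + t * α * hu) + x * (t * β) * (b * hu) ≡ a * x * h + t * (a * α + b * β) * (x * hu)
        eq′ = solve-∀
      e′ : H (suc r) l + suc r * β * H r (restrict v l) + suc r * α * H r (restrict u l) ≡ 0
      e′ = trans (sym (H-nonadjacent r u α v β l q)) e
      Hl : H (suc r) l ≡ 0
      Hl = m+n≡0⇒m≡0 _ (m+n≡0⇒m≡0 _ e′)
      -- Because α is positive, the absence of (r + 1)-cliques already shows that the neighbourhood
      -- of `u` has no r-clique, so additional weight on `u` creates none.
      Hu : H r (restrict u l) ≡ 0
      Hu with m*n≡0⇒m≡0∨n≡0 (suc r * α) (m+n≡0⇒n≡0 (H (suc r) l + suc r * β * H r (restrict v l)) e′)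
      ... | inj₂ z = z
      ... | inj₁ z with m*n≡0⇒m≡0∨n≡0 (suc r) z
      ...   | inj₂ α≡0 = ⊥-elim (<⇒≢ 0<α (sym α≡0))
      Hr : H (suc r) l′ ≡ 0
      Hr rewrite H-merged r u (a * α + b * β) a l | Hl | Hu = eq (a ^ suc r) (suc r * (a * α + b * β)) (a ^ r)
        where eq : ∀ x y z → x * 0 + y * (z * 0) ≡ 0
              eq = solve-∀

    -- Degenerate pairs, with a zero weight or a vertex without neighbours of positive weight, lose
    -- that entry. Otherwise the vertex with the larger ratio H (t - 1) / H 1 survives the merge.
    -- Either way the list gets shorter.
    reduce : ∀ f g l → A (proj₁ f) (proj₁ g) ≡ 0 →
      (∀ l′ → length l′ ≤ suc (length l) → H (suc r) l′ ≡ 0 → Bounded r t l′) →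
      H (suc r) (f ∷ g ∷ l) ≡ 0 → Bounded r t (f ∷ g ∷ l)
    reduce (u , α) (v , β) l q ih e with ≤-<-connex α 0 | ≤-<-connex β 0
    ... | inj₁ α≤0 | _ =
      Bounded-≈ ((v , β) ∷ l) ((u , α) ∷ (v , β) ∷ l) (sym (drop t)) (sym (drop 2)) (ih ((v , β) ∷ l) ≤-refl (trans (sym (drop (suc r))) e))
      where drop : ∀ k → H k ((u , α) ∷ (v , β) ∷ l) ≡ H k ((v , β) ∷ l)
            drop k = H-∷₀ k u α _ (n≤0⇒n≡0 α≤0)
    ... | inj₂ _ | inj₁ β≤0 =
      Bounded-≈ ((u , α) ∷ l) ((u , α) ∷ (v , β) ∷ l) (sym (drop t)) (sym (drop 2)) (ih ((u , α) ∷ l) ≤-refl (trans (sym (drop (suc r))) e))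
      where drop : ∀ k → H k ((u , α) ∷ (v , β) ∷ l) ≡ H k ((u , α) ∷ l)
            drop k = trans (H-↭ k (Perm.swap (u , α) (v , β) (Perm.refl {xs = l}))) (H-∷₀ k v β _ (n≤0⇒n≡0 β≤0))
    ... | inj₂ 0<α | inj₂ 0<β with ≤-<-connex r 0 | ≤-<-connex (H 1 (restrict u l)) 0 | ≤-<-connex (H 1 (restrict v l)) 0
    -- For r = 0 the left side contains the factor `ff 0 2`, which is 0. Below, `isolated` is
    -- applied at `k = r` and needs r to be positive.
    ...   | inj₁ r≤0 | _ | _ rewrite n≤0⇒n≡0 r≤0 = z≤n
    ...   | inj₂ 0<r | inj₁ a≤0 | _ =
      Bounded-≈ ((v , β) ∷ l) ((u , α) ∷ (v , β) ∷ l) (sym (iso (1 + s) (s≤s z≤n))) (sym (iso 1 (s≤s z≤n))) (ih ((v , β) ∷ l) ≤-refl (trans (sym (iso r 0<r)) e))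
      where iso = isolated u α v β l q (n≤0⇒n≡0 a≤0)
    ...   | inj₂ 0<r | inj₂ 0<a | inj₁ b≤0 =
      Bounded-≈ ((u , α) ∷ l) ((u , α) ∷ (v , β) ∷ l) (sym (iso (1 + s) (s≤s z≤n))) (sym (iso 1 (s≤s z≤n))) (ih ((u , α) ∷ l) ≤-refl (trans (sym (iso r 0<r)) e))
      where iso : ∀ k → 0 < k → H (suc k) ((u , α) ∷ (v , β) ∷ l) ≡ H (suc k) ((u , α) ∷ l)
            iso k 0<k = trans (H-↭ (suc k) (Perm.swap (u , α) (v , β) (Perm.refl {xs = l})))
              (isolated v β u α l (trans (A-sym v u) q) (n≤0⇒n≡0 b≤0) k 0<k)
    ...   | inj₂ 0<r | inj₂ 0<a | inj₂ 0<b
      with ≤-total (H 1 (restrict u l) * H (1 + s) (restrict v l)) (H 1 (restrict v l) * H (1 + s) (restrict u l))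
    ...     | inj₁ p = merge u α v β l q 0<α 0<a p ih e
    ...     | inj₂ p = Bounded-≈ ((v , β) ∷ (u , α) ∷ l) ((u , α) ∷ (v , β) ∷ l) (H-↭ t sw) (H-↭ 2 sw)
      (merge v β u α l (trans (A-sym v u) q) 0<β 0<b p ih (trans (H-↭ (suc r) sw) e))
      where
      sw : (v , β) ∷ (u , α) ∷ l ↭ (u , α) ∷ (v , β) ∷ l
      sw = Perm.swap (v , β) (u , α) Perm.refl
    -- Induction on a bound for the length: as long as some pair is non-adjacent, `reduce` shortens
    -- the list; a list without such a pair is a clique, where `maclaurin` applies.
    turán-≤ : ∀ n l → length l ≤ n → H (suc r) l ≡ 0 → Bounded r t l
    turán-≤ n l len e with findNonEdge l
    ... | inj₁ ps = maclaurin r s l ps e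
    turán-≤ zero l len e | inj₂ (f , g , l′ , p , q) with ≤-trans (≤-reflexive (sym (PermP.↭-length p))) len
    ... | ()
    turán-≤ (suc n) l len e | inj₂ (f , g , l′ , p , q) =
      Bounded-≈ (f ∷ g ∷ l′) l (sym (H-↭ t p)) (sym (H-↭ 2 p))
        (reduce f g l′ q (λ l″ len′ → turán-≤ n l″ (≤-trans len′ (s≤s⁻¹ (≤-trans (≤-reflexive (sym (PermP.↭-length p))) len))))
          (trans (sym (H-↭ (suc r) p)) e))

-- Chebyshev's sum inequality and power means.

-- This is (aᵖ - bᵖ)(a - b) ≥ 0 without subtraction.
rearrangement : ∀ p a b → a ^ p * b + b ^ p * a ≤ a ^ suc p + b ^ suc p
rearrangement p a b with ≤-total a b
... | inj₁ a≤b with m≤n⇒∃[o]m+o≡n a≤b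
...   | c , refl = begin
  a ^ p * (a + c) + (a + c) ^ p * a         ≡⟨ lem a c (a ^ p) ((a + c) ^ p) ⟩
  a * a ^ p + a ^ p * c + (a + c) ^ p * a   ≤⟨ +-monoˡ-≤ ((a + c) ^ p * a) (+-monoʳ-≤ (a * a ^ p) (*-monoˡ-≤ c (^-monoˡ-≤ p a≤b))) ⟩
  a * a ^ p + (a + c) ^ p * c + (a + c) ^ p * a ≡⟨ lem′ a c (a ^ p) ((a + c) ^ p) ⟩
  a ^ suc p + (a + c) ^ suc p ∎
  where
  open ≤-Reasoning
  lem : ∀ a c x y → x * (a + c) + y * a ≡ a * x + x * c + y * a
  lem = solve-∀
  lem′ : ∀ a c x y → a * x + y * c + y * a ≡ a * x + (a + c) * y
  lem′ = solve-∀
rearrangement p a b | inj₂ b≤a with m≤n⇒∃[o]m+o≡n b≤a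
...   | c , refl = begin
  (b + c) ^ p * b + b ^ p * (b + c)         ≡⟨ lem b c (b ^ p) ((b + c) ^ p) ⟩
  b * b ^ p + b ^ p * c + (b + c) ^ p * b   ≤⟨ +-monoˡ-≤ ((b + c) ^ p * b) (+-monoʳ-≤ (b * b ^ p) (*-monoˡ-≤ c (^-monoˡ-≤ p b≤a))) ⟩
  b * b ^ p + (b + c) ^ p * c + (b + c) ^ p * b ≡⟨ lem′ b c (b ^ p) ((b + c) ^ p) ⟩
  (b + c) ^ suc p + b ^ suc p ∎
  where
  open ≤-Reasoning
  lem : ∀ a c x y → y * a + x * (a + c) ≡ a * x + x * c + y * a
  lem = solve-∀
  lem′ : ∀ a c x y → a * x + y * c + y * a ≡ (a + c) * y + a * x
  lem′ = solve-∀

∑-*-∑ : {A B : Set} (xs : List A) (ys : List B) {f : A → ℕ} {g : B → ℕ} →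
        ∑ xs f * ∑ ys g ≡ ∑ xs (λ x → ∑ ys (λ y → f x * g y))
∑-*-∑ xs ys {f} {g} = trans (sym (∑-*ʳ xs (∑ ys g))) (∑-cong xs λ x → sym (∑-*ˡ ys (f x)))

-- Chebyshev's sum inequality with weights `h`: doubled and written over pairs (x, y), it follows
-- term by term from `rearrangement`.
chebyshev : {A : Set} (xs : List A) (p : ℕ) (h f : A → ℕ) →
  ∑ xs (λ x → h x * f x ^ p) * ∑ xs (λ x → h x * f x) ≤ ∑ xs h * ∑ xs (λ x → h x * f x ^ suc p)
chebyshev xs p h f = *-cancelˡ-≤ 2 (begin
  2 * (P * Q)
    ≡⟨ two P Q ⟩
  P * Q + Q * P
    ≡⟨ cong₂ _+_ (∑-*-∑ xs xs) (∑-*-∑ xs xs) ⟩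
  ∑ xs (λ x → ∑ xs (λ y → h x * f x ^ p * (h y * f y))) + ∑ xs (λ x → ∑ xs (λ y → h x * f x * (h y * f y ^ p)))
    ≡⟨ sym (∑-+ xs) ⟩
  ∑ xs (λ x → ∑ xs (λ y → h x * f x ^ p * (h y * f y)) + ∑ xs (λ y → h x * f x * (h y * f y ^ p)))
    ≤⟨ ∑-mono xs (λ x → ≤-trans (≤-reflexive (sym (∑-+ xs))) (≤-trans (∑-mono xs (pointwise x)) (≤-reflexive (∑-+ xs)))) ⟩
  ∑ xs (λ x → ∑ xs (λ y → h x * (h y * f y ^ suc p)) + ∑ xs (λ y → h x * f x ^ suc p * h y))
    ≡⟨ ∑-+ xs ⟩
  ∑ xs (λ x → ∑ xs (λ y → h x * (h y * f y ^ suc p))) + ∑ xs (λ x → ∑ xs (λ y → h x * f x ^ suc p * h y))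
    ≡⟨ sym (cong₂ _+_ (∑-*-∑ xs xs) (∑-*-∑ xs xs)) ⟩
  T * R + R * T
    ≡⟨ sym (two T R) ⟩
  2 * (T * R) ∎)
  where
  open ≤-Reasoning
  P = ∑ xs (λ x → h x * f x ^ p)
  Q = ∑ xs (λ x → h x * f x)
  T = ∑ xs h
  R = ∑ xs (λ x → h x * f x ^ suc p)
  two : ∀ a b → 2 * (a * b) ≡ a * b + b * a
  two = solve-∀
  lem : ∀ a b x y u v → a * u * (b * y) + a * x * (b * v) ≡ a * b * (u * y + v * x)
  lem = solve-∀
  lem′ : ∀ a b u v → a * b * (u + v) ≡ a * (b * v) + a * u * b
  lem′ = solve-∀
  pointwise : ∀ x y → h x * f x ^ p * (h y * f y) + h x * f x * (h y * f y ^ p) ≤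
                      h x * (h y * f y ^ suc p) + h x * f x ^ suc p * h y
  pointwise x y = begin
    h x * f x ^ p * (h y * f y) + h x * f x * (h y * f y ^ p)
      ≡⟨ lem (h x) (h y) (f x) (f y) (f x ^ p) (f y ^ p) ⟩
    h x * h y * (f x ^ p * f y + f y ^ p * f x)
      ≤⟨ *-monoʳ-≤ (h x * h y) (rearrangement p (f x) (f y)) ⟩
    h x * h y * (f x ^ suc p + f y ^ suc p)
      ≡⟨ lem′ (h x) (h y) (f x ^ suc p) (f y ^ suc p) ⟩
    h x * (h y * f y ^ suc p) + h x * f x ^ suc p * h y ∎

-- Jensen's inequality for the power `suc p`, with the total weight cleared from the denominators;
-- each application of `chebyshev` raises the exponent by one.
power-mean : {A : Set} (xs : List A) (p : ℕ) (h f : A → ℕ) →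
  ∑ xs (λ x → h x * f x) ^ suc p ≤ ∑ xs h ^ p * ∑ xs (λ x → h x * f x ^ suc p)
power-mean xs zero h f = ≤-reflexive (trans (*-identityʳ _) (trans
  (∑-cong xs (λ x → cong (h x *_) (sym (*-identityʳ (f x))))) (sym (*-identityˡ _))))
power-mean xs (suc p) h f = begin
  Q * Q ^ suc p        ≤⟨ *-monoʳ-≤ Q (power-mean xs p h f) ⟩
  Q * (T ^ p * R)      ≡⟨ lem Q (T ^ p) R ⟩
  T ^ p * (R * Q)      ≤⟨ *-monoʳ-≤ (T ^ p) (chebyshev xs (suc p) h f) ⟩
  T ^ p * (T * S)      ≡⟨ lem′ (T ^ p) T S ⟩
  T * T ^ p * S ∎
  where
  open ≤-Reasoning
  Q = ∑ xs (λ x → h x * f x)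
  T = ∑ xs h
  R = ∑ xs (λ x → h x * f x ^ suc p)
  S = ∑ xs (λ x → h x * f x ^ (2 + p))
  lem : ∀ a b c → a * (b * c) ≡ b * (c * a)
  lem = solve-∀
  lem′ : ∀ a b c → a * (b * c) ≡ b * a * c
  lem′ = solve-∀

cauchy-schwarz : {A : Set} (xs : List A) (f : A → ℕ) → ∑ xs f * ∑ xs f ≤ ∑ xs (λ _ → 1) * ∑ xs (λ x → f x * f x)
cauchy-schwarz xs f = begin
  ∑ xs f * ∑ xs f
    ≡⟨ cong (∑ xs f *_) (sym (*-identityʳ _)) ⟩
  ∑ xs f ^ 2
    ≡⟨ cong (_^ 2) (∑-cong xs λ x → sym (*-identityˡ (f x))) ⟩
  ∑ xs (λ x → 1 * f x) ^ 2
    ≤⟨ power-mean xs 1 (λ _ → 1) f ⟩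
  ∑ xs (λ _ → 1) ^ 1 * ∑ xs (λ x → 1 * f x ^ 2)
    ≡⟨ cong₂ _*_ (*-identityʳ (∑ xs (λ _ → 1))) (∑-cong xs λ x → trans (*-identityˡ _) (cong (f x *_) (*-identityʳ (f x)))) ⟩
  ∑ xs (λ _ → 1) * ∑ xs (λ x → f x * f x) ∎
  where open ≤-Reasoning

-- Random tuples of vertices and their cliques.

module _ {X : Set} where

  tuples : List X → (t : ℕ) → List (Vec X t)
  tuples vs zero    = [] ∷ []
  tuples vs (suc t) = concatMap (λ v → map (v ∷_) (tuples vs t)) vs

  ∑-tuples : ∀ vs t {f} → ∑ (tuples vs (suc t)) f ≡ ∑ vs (λ v → ∑ (tuples vs t) (λ w → f (v ∷ w)))
  ∑-tuples vs t = trans (∑-concatMap _ vs) (∑-cong vs λ v → ∑-map (v ∷_) (tuples vs t))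

  ∑-tuples-const : ∀ vs t c → ∑ (tuples vs t) (λ _ → c) ≡ length vs ^ t * c
  ∑-tuples-const vs zero    c = refl
  ∑-tuples-const vs (suc t) c = trans (∑-tuples vs t) (trans (∑-cong vs λ _ → ∑-tuples-const vs t c)
    (trans (∑-const vs _) (sym (*-assoc (length vs) (length vs ^ t) c))))

  -- Exchanging coordinate `i` of a tuple with an independent vertex is a bijection on such pairs.
  -- Afterwards the old coordinate is independent of the new tuple.
  resample : ∀ vs {t} (i : Fin t) (g : X → Vec X t → ℕ) →
    ∑ (tuples vs t) (λ w → ∑ vs (λ u → g (lookup w i) (w [ i ]≔ u))) ≡ ∑ vs (λ u → ∑ (tuples vs t) (g u))
  resample vs {suc t} zero g = begin
    ∑ (tuples vs (suc t)) (λ w → ∑ vs (λ u → g (lookup w zero) (w [ zero ]≔ u)))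
      ≡⟨ ∑-tuples vs t ⟩
    ∑ vs (λ v → ∑ (tuples vs t) (λ w → ∑ vs (λ u → g v (u ∷ w))))
      ≡⟨ ∑-cong vs (λ v → ∑-swap (tuples vs t) vs) ⟩
    ∑ vs (λ v → ∑ vs (λ u → ∑ (tuples vs t) (λ w → g v (u ∷ w))))
      ≡⟨ ∑-cong vs (λ v → sym (∑-tuples vs t)) ⟩
    ∑ vs (λ u → ∑ (tuples vs (suc t)) (g u)) ∎
    where open ≡-Reasoning
  resample vs {suc t} (suc i) g = begin
    ∑ (tuples vs (suc t)) (λ w → ∑ vs (λ u → g (lookup w (suc i)) (w [ suc i ]≔ u)))
      ≡⟨ ∑-tuples vs t ⟩
    ∑ vs (λ v → ∑ (tuples vs t) (λ w → ∑ vs (λ u → g (lookup w i) (v ∷ (w [ i ]≔ u)))))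
      ≡⟨ ∑-cong vs (λ v → resample vs i (λ u w → g u (v ∷ w))) ⟩
    ∑ vs (λ v → ∑ vs (λ u → ∑ (tuples vs t) (λ w → g u (v ∷ w))))
      ≡⟨ ∑-swap vs vs ⟩
    ∑ vs (λ u → ∑ vs (λ v → ∑ (tuples vs t) (λ w → g u (v ∷ w))))
      ≡⟨ ∑-cong vs (λ u → sym (∑-tuples vs t)) ⟩
    ∑ vs (λ u → ∑ (tuples vs (suc t)) (g u)) ∎
    where open ≡-Reasoning

  update-↭ : ∀ {t} (w : Vec X t) i u → lookup w i ∷ toList (w [ i ]≔ u) ↭ u ∷ toList w
  update-↭ (x ∷ w) zero    u = Perm.swap x u Perm.refl
  update-↭ (x ∷ w) (suc i) u = Perm.trans (Perm.swap _ x Perm.refl)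
    (Perm.trans (Perm.prep x (update-↭ w i u)) (Perm.swap x u Perm.refl))

  ∑-toList : ∀ {t} (w : Vec X t) (f : X → ℕ) → ∑ (toList w) f ≡ ∑ (allFin t) (λ i → f (lookup w i))
  ∑-toList []      f = refl
  ∑-toList {suc t} (x ∷ w) f = cong (f x +_) (trans (∑-toList w f) (trans (sym (∑-map suc (allFin t)))
    (cong (λ l → ∑ l (λ i → f (lookup (x ∷ w) i))) (map-tabulate (λ i → i) suc))))

  length-toList : ∀ {t} (w : Vec X t) → length (toList w) ≡ t
  length-toList []      = refl
  length-toList (x ∷ w) = cong suc (length-toList w)

module UnitWeights {X : Set} (A : X → X → ℕ)
  (A-sym : ∀ u v → A u v ≡ A v u) (A-irr : ∀ v → A v v ≡ 0) (A≤1 : ∀ u v → A u v ≤ 1) where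

  open TuránInequality A A-sym A-irr A≤1 public

  H₁-unit : ∀ xs → H 1 (unit xs) ≡ length xs
  H₁-unit xs = trans (H-weigh-suc 0 _ xs) (trans (∑-const xs 1) (*-identityʳ _))

  -- Ordered pairs are summed, so this is twice the usual number of edges.
  edges : List X → ℕ
  edges xs = H 2 (unit xs)

  edges-∑ : ∀ xs → edges xs ≡ ∑ xs (λ u → ∑ xs (A u))
  edges-∑ xs = trans (H-weigh-suc 1 _ xs) (∑-cong xs λ u → trans (*-identityˡ _)
    (trans (H-weigh-suc 0 _ xs) (∑-cong xs λ v → trans (*-identityʳ _) (*-identityʳ _))))

  H₁-unit-≤ : ∀ u xs → H 1 (restrict u (unit xs)) ≤ length xs
  H₁-unit-≤ u xs = subst (λ l → H 1 l ≤ length xs) (sym (restrict-weigh u _ xs))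
    (≤-trans (≤-reflexive (H-weigh-suc 0 _ xs)) (≤-trans (∑-bound xs (λ v →
      ≤-trans (≤-reflexive (trans (*-identityʳ _) (*-identityʳ _))) (A≤1 u v))) (≤-reflexive (*-identityʳ (length xs)))))

  -- The removed entry has at most t neighbours among the others, and each such edge is counted in
  -- both directions.
  edges-update : ∀ {t} (w : Vec X t) i u → edges (toList w) ≤ edges (toList (w [ i ]≔ u)) + 2 * t
  edges-update {t} w i u = begin
    edges (toList w)
      ≤⟨ H-∷-≥ 2 (u , 1) (unit (toList w)) ⟩
    edges (u ∷ toList w)
      ≡⟨ H-↭ 2 (PermP.map⁺ _ (Perm.↭-sym (update-↭ w i u))) ⟩
    edges (lookup w i ∷ toList (w [ i ]≔ u))
      ≡⟨ H-∷ 1 (lookup w i) 1 (unit (toList (w [ i ]≔ u))) ⟩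
    edges (toList (w [ i ]≔ u)) + 2 * H 1 (restrict (lookup w i) (unit (toList (w [ i ]≔ u))))
      ≤⟨ +-monoʳ-≤ (edges (toList (w [ i ]≔ u))) (*-monoʳ-≤ 2 (≤-trans (H₁-unit-≤ (lookup w i) (toList (w [ i ]≔ u))) (≤-reflexive (length-toList (w [ i ]≔ u))))) ⟩
    edges (toList (w [ i ]≔ u)) + 2 * t ∎
    where open ≤-Reasoning

module Sampling {X : Set} (A : X → X → ℕ)
  (A-sym : ∀ u v → A u v ≡ A v u) (A-irr : ∀ v → A v v ≡ 0) (A≤1 : ∀ u v → A u v ≤ 1) (vs : List X) where

  open UnitWeights A A-sym A-irr A≤1 public

  private n = length vs

  -- Linearity of expectation: there are `ff t s` ways to choose positions for an ordered s-clique,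
  -- and each choice is a uniformly random s-tuple. General weights `z` are required since the
  -- induction restricts to neighbourhoods.
  ∑-H-tuples : ∀ t s z → n ^ s * ∑ (tuples vs t) (λ w → H s (weigh z (toList w))) ≡ ff t s * n ^ t * H s (weigh z vs)
  ∑-H-tuples zero zero z = refl
  ∑-H-tuples zero (suc s) z = *-zeroʳ (n ^ suc s)
  ∑-H-tuples (suc t) zero z = trans (*-identityˡ _) (trans (∑-tuples-const vs (suc t) 1)
    (cong (_* 1) (sym (+-identityʳ (n ^ suc t)))))
  ∑-H-tuples (suc t) (suc s) z = begin
    n ^ suc s * ∑ (tuples vs (suc t)) (λ w → H (suc s) (weigh z (toList w)))
      ≡⟨ cong (n ^ suc s *_) (trans (∑-tuples vs t) (∑-cong vs λ v → trans (∑-cong (tuples vs t) λ w → step v (toList w)) (∑-+ (tuples vs t)))) ⟩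
    n ^ suc s * ∑ vs (λ v → F + ∑ (tuples vs t) (λ w → suc s * z v * H s (weigh (λ u → A v u * z u) (toList w))))
      ≡⟨ cong (n ^ suc s *_) (trans (∑-cong vs λ v → cong (F +_) (∑-*ˡ (tuples vs t) (suc s * z v))) (trans (∑-+ vs) (cong (_+ ∑ vs (λ v → suc s * z v * G v)) (∑-const vs F)))) ⟩
    n ^ suc s * (n * F + ∑ vs (λ v → suc s * z v * G v))
      ≡⟨ lem n (n ^ s) F _ ⟩
    n * (n ^ suc s * F) + n * (n ^ s * ∑ vs (λ v → suc s * z v * G v))
      ≡⟨ cong₂ (λ a b → n * a + n * b) (∑-H-tuples t (suc s) z)
           (trans (sym (∑-*ˡ vs (n ^ s))) (∑-cong vs λ v → trans (lem₁ (n ^ s) (suc s) (z v) (G v))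
             (trans (cong (suc s * z v *_) (∑-H-tuples t s (λ u → A v u * z u)))
               (lem₂ (suc s) (z v) (ff t s) (n ^ t) _)))) ⟩
    n * (ff t (suc s) * n ^ t * h) + n * ∑ vs (λ v → suc s * ff t s * n ^ t * (z v * H s (weigh (λ u → A v u * z u) vs)))
      ≡⟨ cong (λ y → n * (ff t (suc s) * n ^ t * h) + n * y) (trans (∑-*ˡ vs (suc s * ff t s * n ^ t)) (cong (suc s * ff t s * n ^ t *_) (sym (H-weigh-suc s z vs)))) ⟩
    n * (ff t (suc s) * n ^ t * h) + n * (suc s * ff t s * n ^ t * h)
      ≡⟨ lem₃ n (n ^ t) (ff t (suc s)) (suc s * ff t s) h ⟩
    ff (suc t) (suc s) * n ^ suc t * h ∎
    where
    open ≡-Reasoning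
    h = H (suc s) (weigh z vs)
    F = ∑ (tuples vs t) (λ w → H (suc s) (weigh z (toList w)))
    G : X → ℕ
    G v = ∑ (tuples vs t) (λ w → H s (weigh (λ u → A v u * z u) (toList w)))
    step : ∀ v xs → H (suc s) (weigh z (v ∷ xs)) ≡ H (suc s) (weigh z xs) + suc s * z v * H s (weigh (λ u → A v u * z u) xs)
    step v xs = trans (H-∷ s v (z v) (weigh z xs)) (cong (λ l → H (suc s) (weigh z xs) + suc s * z v * H s l) (restrict-weigh v z xs))
    lem : ∀ n p f g → n * p * (n * f + g) ≡ n * (n * p * f) + n * (p * g)
    lem = solve-∀
    lem₁ : ∀ p s z g → p * (s * z * g) ≡ s * z * (p * g)
    lem₁ = solve-∀
    lem₂ : ∀ s z f p h → s * z * (f * p * h) ≡ s * f * p * (z * h)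
    lem₂ = solve-∀
    lem₃ : ∀ n p f g h → n * (f * p * h) + n * (g * p * h) ≡ (f + g) * (n * p) * h
    lem₃ = solve-∀

  -- Resampling coordinates `i` and `k` makes the edge indicator independent of the rest of the
  -- tuple. The price is the passage from `f` to `f″`, which must absorb two changes of a
  -- coordinate.
  decouple : ∀ {t} (i k : Fin t) (f f′ f″ : Vec X t → ℕ) →
    (∀ w i u → f w ≤ f′ (w [ i ]≔ u)) → (∀ w i u → f′ w ≤ f″ (w [ i ]≔ u)) →
    n * n * ∑ (tuples vs t) (λ w → A (lookup w i) (lookup w k) * f w) ≤ edges vs * ∑ (tuples vs t) f″
  decouple {t} i k f f′ f″ p q with i Fin.≟ k
  ... | yes refl = ≤-trans (≤-reflexive (trans (cong (n * n *_) (∑-zero (tuples vs t) λ w → cong (_* f w) (A-irr (lookup w i)))) (*-zeroʳ (n * n)))) z≤n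
  ... | no i≢k = begin
    n * n * ∑ T (λ w → A (lookup w i) (lookup w k) * f w)
      ≡⟨ *-assoc n n _ ⟩
    n * (n * ∑ T (λ w → A (lookup w i) (lookup w k) * f w))
      ≤⟨ *-monoʳ-≤ n (one-step i (λ w u → A u (lookup w k)) (λ w u x → cong (A x) (lookup∘update′ (λ e → i≢k (sym e)) w u)) f f′ p) ⟩
    n * ∑ vs (λ a → ∑ T (λ w → A a (lookup w k) * f′ w))
      ≡⟨ sym (∑-*ˡ vs n) ⟩
    ∑ vs (λ a → n * ∑ T (λ w → A a (lookup w k) * f′ w))
      ≤⟨ ∑-mono vs (λ a → one-step k (λ w u → A a u) (λ w u x → refl) f′ f″ q) ⟩
    ∑ vs (λ a → ∑ vs (λ b → ∑ T (λ w → A a b * f″ w)))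
      ≡⟨ ∑-cong vs (λ a → trans (∑-cong vs (λ b → ∑-*ˡ T (A a b))) (∑-*ʳ vs (∑ T f″))) ⟩
    ∑ vs (λ a → ∑ vs (A a) * ∑ T f″)
      ≡⟨ trans (∑-*ʳ vs (∑ T f″)) (cong (_* ∑ T f″) (sym (edges-∑ vs))) ⟩
    edges vs * ∑ T f″ ∎
    where
    open ≤-Reasoning
    T = tuples vs t
    one-step : (i : Fin t) (B : Vec X t → X → ℕ) → (∀ w u x → B (w [ i ]≔ u) x ≡ B w x) →
      (f f′ : Vec X t → ℕ) → (∀ w i u → f w ≤ f′ (w [ i ]≔ u)) →
      n * ∑ T (λ w → B w (lookup w i) * f w) ≤ ∑ vs (λ a → ∑ T (λ w → B w a * f′ w))
    one-step i B e f f′ p = begin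
      n * ∑ T (λ w → B w (lookup w i) * f w)
        ≡⟨ sym (∑-*ˡ T n) ⟩
      ∑ T (λ w → n * (B w (lookup w i) * f w))
        ≡⟨ ∑-cong T (λ w → sym (∑-const vs _)) ⟩
      ∑ T (λ w → ∑ vs (λ u → B w (lookup w i) * f w))
        ≤⟨ ∑-mono T (λ w → ∑-mono vs (λ u → *-mono-≤ (≤-reflexive (sym (e w u (lookup w i)))) (p w i u))) ⟩
      ∑ T (λ w → ∑ vs (λ u → B (w [ i ]≔ u) (lookup w i) * f′ (w [ i ]≔ u)))
        ≡⟨ resample vs i (λ a w → B w a * f′ w) ⟩
      ∑ vs (λ a → ∑ T (λ w → B w a * f′ w)) ∎

  -- One factor of the power is written as a sum over pairs of coordinates and decoupled. By
  -- `edges-update`, the two resamplings shift the remaining factors by at most `4 * t`; the offset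
  -- `c` accumulates these shifts.
  moment : ∀ t j c → (n * n) ^ j * ∑ (tuples vs t) (λ w → (edges (toList w) + c) ^ j) ≤
                     n ^ t * (t * t * edges vs + (c + 4 * t * j) * (n * n)) ^ j
  moment t zero    c = ≤-reflexive (trans (+-identityʳ _) (∑-tuples-const vs t 1))
  moment t (suc j) c = begin
    N * N ^ j * ∑ T (λ w → (Y w + c) * (Y w + c) ^ j)
      ≡⟨ trans (lem N (N ^ j) _) (cong (N ^ j *_) split) ⟩
    N ^ j * (N * ∑ T (λ w → Y w * (Y w + c) ^ j) + c * N * ∑ T (λ w → (Y w + c) ^ j))
      ≤⟨ *-monoʳ-≤ (N ^ j) (+-mono-≤ bound (*-monoʳ-≤ (c * N) (∑-mono T λ w → ^-monoˡ-≤ j (+-monoʳ-≤ (Y w) (m≤m+n c (4 * t)))))) ⟩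
    N ^ j * (t * t * edges vs * S + c * N * S)
      ≡⟨ lem′ (N ^ j) (t * t * edges vs) S (c * N) ⟩
    (t * t * edges vs + c * N) * (N ^ j * S)
      ≤⟨ *-mono-≤ (+-monoʳ-≤ (t * t * edges vs) (*-monoˡ-≤ N (m≤m+n c (4 * t * suc j)))) (moment t j (c + 4 * t)) ⟩
    (t * t * edges vs + (c + 4 * t * suc j) * N) * (n ^ t * (t * t * edges vs + (c + 4 * t + 4 * t * j) * N) ^ j)
      ≡⟨ cong (λ z → (t * t * edges vs + (c + 4 * t * suc j) * N) * (n ^ t * (t * t * edges vs + z * N) ^ j)) (lem″ c t j) ⟩
    (t * t * edges vs + (c + 4 * t * suc j) * N) * (n ^ t * (t * t * edges vs + (c + 4 * t * suc j) * N) ^ j)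
      ≡⟨ lem‴ (t * t * edges vs + (c + 4 * t * suc j) * N) (n ^ t) _ ⟩
    n ^ t * ((t * t * edges vs + (c + 4 * t * suc j) * N) * (t * t * edges vs + (c + 4 * t * suc j) * N) ^ j) ∎
    where
    open ≤-Reasoning
    N = n * n
    T = tuples vs t
    Y : Vec X t → ℕ
    Y w = edges (toList w)
    S = ∑ T (λ w → (Y w + (c + 4 * t)) ^ j)
    lem : ∀ a b c → a * b * c ≡ b * (a * c)
    lem = solve-∀
    lem′ : ∀ p a s b → p * (a * s + b * s) ≡ (a + b) * (p * s)
    lem′ = solve-∀
    lem″ : ∀ c t j → c + 4 * t + 4 * t * j ≡ c + 4 * t * suc j
    lem″ = solve-∀
    lem‴ : ∀ a b c → a * (b * c) ≡ b * (a * c)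
    lem‴ = solve-∀
    split : N * ∑ T (λ w → (Y w + c) * (Y w + c) ^ j) ≡ N * ∑ T (λ w → Y w * (Y w + c) ^ j) + c * N * ∑ T (λ w → (Y w + c) ^ j)
    split = trans (cong (N *_) (trans (∑-cong T λ w → *-distribʳ-+ ((Y w + c) ^ j) (Y w) c) (trans (∑-+ T) (cong (∑ T (λ w → Y w * (Y w + c) ^ j) +_) (∑-*ˡ T c)))))
      (eq N _ c _)
      where eq : ∀ n a c b → n * (a + c * b) ≡ n * a + c * n * b
            eq = solve-∀
    lipschitz : ∀ d (w : Vec X t) i u → (Y w + d) ^ j ≤ (Y (w [ i ]≔ u) + (d + 2 * t)) ^ j
    lipschitz d w i u = ^-monoˡ-≤ j (≤-trans (+-monoˡ-≤ d (edges-update w i u)) (≤-reflexive (eq (Y (w [ i ]≔ u)) t d)))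
      where eq : ∀ y t d → y + 2 * t + d ≡ y + (d + 2 * t)
            eq = solve-∀
    Y-∑ : ∀ w → Y w ≡ ∑ (allFin t) (λ i → ∑ (allFin t) (λ k → A (lookup w i) (lookup w k)))
    Y-∑ w = trans (edges-∑ (toList w)) (trans (∑-toList w _) (∑-cong (allFin t) λ i → ∑-toList w (A (lookup w i))))
    bound : N * ∑ T (λ w → Y w * (Y w + c) ^ j) ≤ t * t * edges vs * S
    bound = begin
      N * ∑ T (λ w → Y w * (Y w + c) ^ j)
        ≡⟨ cong (N *_) (∑-cong T λ w → trans (cong (_* (Y w + c) ^ j) (Y-∑ w)) (trans (sym (∑-*ʳ (allFin t) ((Y w + c) ^ j)))
             (∑-cong (allFin t) λ i → sym (∑-*ʳ (allFin t) ((Y w + c) ^ j))))) ⟩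
      N * ∑ T (λ w → ∑ (allFin t) (λ i → ∑ (allFin t) (λ k → A (lookup w i) (lookup w k) * (Y w + c) ^ j)))
        ≡⟨ cong (N *_) (trans (∑-swap T (allFin t)) (∑-cong (allFin t) λ i → ∑-swap T (allFin t))) ⟩
      N * ∑ (allFin t) (λ i → ∑ (allFin t) (λ k → ∑ T (λ w → A (lookup w i) (lookup w k) * (Y w + c) ^ j)))
        ≡⟨ trans (sym (∑-*ˡ (allFin t) N)) (∑-cong (allFin t) λ i → sym (∑-*ˡ (allFin t) N)) ⟩
      ∑ (allFin t) (λ i → ∑ (allFin t) (λ k → N * ∑ T (λ w → A (lookup w i) (lookup w k) * (Y w + c) ^ j)))
        ≤⟨ ∑-bound (allFin t) (λ i → ∑-bound (allFin t) (λ k → decouple i k _ _ _ (lipschitz c) (lipschitz (c + 2 * t)))) ⟩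
      length (allFin t) * (length (allFin t) * (edges vs * ∑ T (λ w → (Y w + (c + 2 * t + 2 * t)) ^ j)))
        ≡⟨ cong₂ (λ a b → a * (a * (edges vs * b))) (length-tabulate {n = t} (λ i → i)) (∑-cong T λ w → cong (λ z → (Y w + z) ^ j) (eq c t)) ⟩
      t * (t * (edges vs * S))
        ≡⟨ eq′ t (edges vs) S ⟩
      t * t * edges vs * S ∎
      where
      eq : ∀ c t → c + 2 * t + 2 * t ≡ c + 4 * t
      eq = solve-∀
      eq′ : ∀ t e s → t * (t * (e * s)) ≡ t * t * e * s
      eq′ = solve-∀

module FewCliques {X : Set} (A : X → X → ℕ)
  (A-sym : ∀ u v → A u v ≡ A v u) (A-irr : ∀ v → A v v ≡ 0) (A≤1 : ∀ u v → A u v ≤ 1) (vs : List X) where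

  open Sampling A A-sym A-irr A≤1 vs public

  private n = length vs

  -- The exact mean of `Z` enters through Cauchy-Schwarz and the moment bound controls the main
  -- term. In the error term, the scarcity of (r + 1)-cliques provides the gain of a factor `K`.
  turán-few : ∀ r s t K → 0 < n → K * H (suc r) (unit vs) ≤ n ^ suc r →
    let S = 2 + s; h = H S (unit vs) in
    K * (ff r 2 ^ S * (ff t S * h * (ff t S * h))) ≤
    K * (ff r S * ff r S * (t * t * edges vs + 4 * t * S * (n * n)) ^ S) + (n * n) ^ S * (ff r 2 ^ S * (t ^ S * t ^ S) * ff t (suc r))
  turán-few r s t K 0<n few = cancel (n ^ suc r * (n ^ t * n ^ t)) pos (begin
    Q * (P * P) * (K * (C * (f * h * (f * h))))
      ≡⟨ e₁ Q P K C f h ⟩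
    K * Q * C * (f * P * h * (f * P * h))
      ≡⟨ cong (λ z → K * Q * C * (z * z)) (sym (∑-H-tuples t S (λ _ → 1))) ⟩
    K * Q * C * (n ^ S * ∑ T Z * (n ^ S * ∑ T Z))
      ≡⟨ trans (e₂ K Q C (n ^ S) (∑ T Z)) (cong (λ z → K * Q * C * z * (∑ T Z * ∑ T Z)) (sym (^-*-distrib n n S))) ⟩
    K * Q * C * (n * n) ^ S * (∑ T Z * ∑ T Z)
      ≤⟨ *-monoʳ-≤ (K * Q * C * (n * n) ^ S) (≤-trans (cauchy-schwarz T Z) (≤-reflexive
           (cong (_* ∑ T (λ w → Z w * Z w)) (trans (∑-tuples-const vs t 1) (*-identityʳ P))))) ⟩
    K * Q * C * (n * n) ^ S * (P * ∑ T (λ w → Z w * Z w))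
      ≡⟨ trans (e₃ K Q C ((n * n) ^ S) P (∑ T (λ w → Z w * Z w))) (cong (λ z → K * Q * P * (n * n) ^ S * z) (sym (∑-*ˡ T C))) ⟩
    K * Q * P * (n * n) ^ S * ∑ T (λ w → C * (Z w * Z w))
      ≤⟨ *-monoʳ-≤ (K * Q * P * (n * n) ^ S) (∑-mono T pointwise) ⟩
    K * Q * P * (n * n) ^ S * ∑ T (λ w → D * D * (Y w + 0) ^ S + C * (t ^ S * t ^ S) * H (suc r) (unit (toList w)))
      ≡⟨ cong (K * Q * P * (n * n) ^ S *_) (trans (∑-+ T) (cong₂ _+_ (∑-*ˡ T (D * D)) (∑-*ˡ T (C * (t ^ S * t ^ S))))) ⟩
    K * Q * P * (n * n) ^ S * (D * D * ∑ T (λ w → (Y w + 0) ^ S) + C * (t ^ S * t ^ S) * ∑ T (λ w → H (suc r) (unit (toList w))))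
      ≡⟨ e₄ K Q P ((n * n) ^ S) D C (t ^ S) (∑ T (λ w → (Y w + 0) ^ S)) (∑ T (λ w → H (suc r) (unit (toList w)))) ⟩
    K * Q * P * (D * D) * ((n * n) ^ S * ∑ T (λ w → (Y w + 0) ^ S))
      + P * ((n * n) ^ S * (C * (t ^ S * t ^ S))) * (K * (n ^ suc r * ∑ T (λ w → H (suc r) (unit (toList w)))))
      ≤⟨ +-mono-≤ (*-monoʳ-≤ (K * Q * P * (D * D)) (moment t S 0))
           (*-monoʳ-≤ (P * ((n * n) ^ S * (C * (t ^ S * t ^ S)))) few′) ⟩
    K * Q * P * (D * D) * (P * E ^ S) + P * ((n * n) ^ S * (C * (t ^ S * t ^ S))) * (ff t (suc r) * P * Q)
      ≡⟨ e₅ K Q P D (E ^ S) ((n * n) ^ S * (C * (t ^ S * t ^ S))) (ff t (suc r)) ⟩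
    Q * (P * P) * (K * (D * D * E ^ S) + (n * n) ^ S * (C * (t ^ S * t ^ S)) * ff t (suc r))
      ≡⟨ cong (λ z → Q * (P * P) * (K * (D * D * E ^ S) + z)) (*-assoc ((n * n) ^ S) (C * (t ^ S * t ^ S)) (ff t (suc r))) ⟩
    Q * (P * P) * (K * (D * D * E ^ S) + (n * n) ^ S * (C * (t ^ S * t ^ S) * ff t (suc r))) ∎)
    where
    open ≤-Reasoning
    S = 2 + s
    T = tuples vs t
    P = n ^ t
    Q = n ^ suc r
    C = ff r 2 ^ S
    D = ff r S
    f = ff t S
    h = H S (unit vs)
    E = t * t * edges vs + 4 * t * S * (n * n)
    Z Y : Vec X t → ℕ
    Z w = H S (unit (toList w))
    Y w = edges (toList w)
    instance n≢0 : NonZero n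
             n≢0 = >-nonZero 0<n
    pos : 0 < n ^ suc r * (n ^ t * n ^ t)
    pos = *-mono-< (m^n>0 n (suc r)) (*-mono-< (m^n>0 n t) (m^n>0 n t))
    -- A sample with an (r + 1)-clique gets only the trivial bound `t ^ S` on its clique count, paid
    -- for by the factor `H (suc r)`, which is then at least 1.
    pointwise : ∀ w → C * (Z w * Z w) ≤ D * D * (Y w + 0) ^ S + C * (t ^ S * t ^ S) * H (suc r) (unit (toList w))
    pointwise w with H (suc r) (unit (toList w)) in eq
    ... | zero = ≤-trans (turán-≤ r s _ (unit (toList w)) ≤-refl eq)
      (≤-trans (≤-reflexive (cong (λ z → D * D * z ^ S) (sym (+-identityʳ (Y w))))) (m≤m+n _ _))
    ... | suc j = ≤-trans (*-monoʳ-≤ C (*-mono-≤ Z≤ Z≤))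
      (≤-trans (m≤m*n (C * (t ^ S * t ^ S)) (suc j)) (m≤n+m _ (D * D * (Y w + 0) ^ S)))
      where Z≤ : Z w ≤ t ^ S
            Z≤ = ≤-trans (H≤H₁^ S (unit (toList w))) (≤-reflexive (cong (_^ S) (trans (H₁-unit (toList w)) (length-toList w))))
    few′ : K * (n ^ suc r * ∑ T (λ w → H (suc r) (unit (toList w)))) ≤ ff t (suc r) * P * Q
    few′ = begin
      K * (n ^ suc r * ∑ T (λ w → H (suc r) (unit (toList w))))
        ≡⟨ cong (K *_) (∑-H-tuples t (suc r) (λ _ → 1)) ⟩
      K * (ff t (suc r) * P * H (suc r) (unit vs))
        ≡⟨ eq K (ff t (suc r) * P) (H (suc r) (unit vs)) ⟩
      ff t (suc r) * P * (K * H (suc r) (unit vs))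
        ≤⟨ *-monoʳ-≤ (ff t (suc r) * P) few ⟩
      ff t (suc r) * P * Q ∎
      where eq : ∀ a b c → a * (b * c) ≡ b * (a * c)
            eq = solve-∀
    e₁ : ∀ q p k c f h → q * (p * p) * (k * (c * (f * h * (f * h)))) ≡ k * q * c * (f * p * h * (f * p * h))
    e₁ = solve-∀
    e₂ : ∀ k q c x z → k * q * c * (x * z * (x * z)) ≡ k * q * c * (x * x) * (z * z)
    e₂ = solve-∀
    e₃ : ∀ k q c x p z → k * q * c * x * (p * z) ≡ k * q * p * x * (c * z)
    e₃ = solve-∀
    e₄ : ∀ k q p x d c t y z → k * q * p * x * (d * d * y + c * (t * t) * z) ≡
      k * q * p * (d * d) * (x * y) + p * (x * (c * (t * t))) * (k * (q * z))
    e₄ = solve-∀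
    e₅ : ∀ k q p d e x f → k * q * p * (d * d) * (p * e) + p * x * (f * p * q) ≡ q * (p * p) * (k * (d * d * e) + x * f)
    e₅ = solve-∀

-- Blow-ups of cliques and supersaturation.

prod : {X : Set} {t : ℕ} → (X → ℕ) → Vec X t → ℕ
prod f []      = 1
prod f (v ∷ w) = f v * prod f w

prod-* : {X : Set} {t : ℕ} (f g : X → ℕ) (w : Vec X t) → prod (λ v → f v * g v) w ≡ prod f w * prod g w
prod-* f g []      = refl
prod-* f g (v ∷ w) rewrite prod-* f g w = lem (f v) (g v) (prod f w) (prod g w)
  where lem : ∀ a b c d → a * b * (c * d) ≡ a * c * (b * d)
        lem = solve-∀

prod-one : {X : Set} {t : ℕ} (w : Vec X t) → prod (λ _ → 1) w ≡ 1
prod-one []      = refl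
prod-one (v ∷ w) = trans (+-identityʳ _) (prod-one w)

prod-swap : {X Y : Set} {s t : ℕ} (f : X → Y → ℕ) (w : Vec X s) (x : Vec Y t) →
  prod (λ y → prod (λ u → f u y) w) x ≡ prod (λ u → prod (f u) x) w
prod-swap f []      x = prod-one x
prod-swap f (v ∷ w) x = trans (prod-* (f v) (λ y → prod (λ u → f u y) w) x) (cong (prod (f v) x *_) (prod-swap f w x))

module _ {X : Set} where

  prod-≤1 : ∀ {t} (f : X → ℕ) (w : Vec X t) → (∀ v → f v ≤ 1) → prod f w ≤ 1
  prod-≤1 f []      p = ≤-refl
  prod-≤1 f (v ∷ w) p = *-mono-≤ (p v) (prod-≤1 f w p)

  prod-≢0 : ∀ {t} (f : X → ℕ) (w : Vec X t) → prod f w ≢ 0 → ∀ i → f (lookup w i) ≢ 0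
  prod-≢0 f (v ∷ w) p zero    q = p (cong (_* prod f w) q)
  prod-≢0 f (v ∷ w) p (suc i) q = prod-≢0 f w (λ e → p (trans (cong (f v *_) e) (*-zeroʳ (f v)))) i q

  ∑-tuples-prod : ∀ vs t (f : X → ℕ) → ∑ (tuples vs t) (prod f) ≡ ∑ vs f ^ t
  ∑-tuples-prod vs zero    f = refl
  ∑-tuples-prod vs (suc t) f = trans (∑-tuples vs t) (trans (∑-cong vs λ v → trans (∑-*ˡ (tuples vs t) (f v))
    (cong (f v *_) (∑-tuples-prod vs t f))) (∑-*ʳ vs (∑ vs f ^ t)))

-- The averaging argument in constructive form: either a good element is found, or every term is
-- small and hence so is the sum.
search : {B : Set} (xs : List B) (P : B → Set) (f g : B → ℕ) → (∀ x → P x ⊎ f x ≤ g x) → ∃ P ⊎ ∑ xs f ≤ ∑ xs g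
search []       P f g d = inj₂ z≤n
search (x ∷ xs) P f g d with d x
... | inj₁ p = inj₁ (x , p)
... | inj₂ q with search xs P f g d
...   | inj₁ p = inj₁ p
...   | inj₂ q′ = inj₂ (+-mono-≤ q q′)

-- Each level of `supersaturation` turns clique density 1/K into 1/(2 Kᵖ⁺¹). The other argument of
-- `⊔` is the number of vertices beyond which tuples with repeated entries are too rare to matter.
threshold : (p k K : ℕ) → ℕ
threshold p zero    K = 1
threshold p (suc k) K = threshold p k (2 * K ^ suc p) ⊔ suc (2 * K ^ suc p * (suc p * suc p))

module BlowUps {X : Set} (A : X → X → ℕ) (A-sym : ∀ u v → A u v ≡ A v u)
  (δ : X → X → ℕ) (δ-refl : ∀ v → δ v v ≢ 0) (q : ℕ) where

  repeats : ∀ {t} → Vec X t → ℕ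
  repeats []      = 0
  repeats (v ∷ w) = ∑ (toList w) (δ v) + repeats w

  neighbours : ∀ {t} → Vec X t → X → ℕ
  neighbours w v = prod (λ u → A u v) w

  -- A complete k-partite subgraph with parts of size `q`, chosen part by part. The weight `z`
  -- carries the common neighbourhood of the earlier parts, in which all later ones must lie.
  BlowUp : ℕ → (X → ℕ) → Set
  BlowUp zero    z = ⊤
  BlowUp (suc k) z = Σ (Vec X q) λ w → repeats w ≡ 0 × (∀ i → z (lookup w i) ≢ 0) × BlowUp k (λ v → neighbours w v * z v)

  vertex : ∀ k z → BlowUp k z → Fin k → Fin q → X
  vertex (suc k) z (w , _ , _ , b) zero    a = lookup w a
  vertex (suc k) z (w , _ , _ , b) (suc i) a = vertex k _ b i a

  vertex-weight : ∀ k z (b : BlowUp k z) (i : Fin k) (a : Fin q) → z (vertex k z b i a) ≢ 0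
  vertex-weight (suc k) z (w , _ , nz , b) zero    a   = nz a
  vertex-weight (suc k) z (w , _ , nz , b) (suc i) a e =
    vertex-weight k _ b i a (trans (cong (neighbours w (vertex k _ b i a) *_) e) (*-zeroʳ (neighbours w (vertex k _ b i a))))

  vertex-adjacent : ∀ k z (b : BlowUp k z) (i j : Fin k) (a c : Fin q) → i ≢ j → A (vertex k z b i a) (vertex k z b j c) ≢ 0
  vertex-adjacent (suc k) z (w , _ , nz , b) zero    zero    a c i≢j = ⊥-elim (i≢j refl)
  vertex-adjacent (suc k) z (w , _ , nz , b) zero    (suc j) a c i≢j =
    prod-≢0 (λ u → A u x) w (λ e → vertex-weight k (λ v → neighbours w v * z v) b j c (cong (_* z x) e)) a
    where x = vertex k (λ v → neighbours w v * z v) b j c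
  vertex-adjacent (suc k) z B@(w , _ , nz , b) (suc i) zero a c i≢j e =
    vertex-adjacent (suc k) z B zero (suc i) c a (λ ()) (trans (A-sym (lookup w c) (vertex k (λ v → neighbours w v * z v) b i a)) e)
  vertex-adjacent (suc k) z (w , _ , nz , b) (suc i) (suc j) a c i≢j =
    vertex-adjacent k _ b i j a c (λ e → i≢j (cong suc e))

  lookup-injective : ∀ {t} (w : Vec X t) → repeats w ≡ 0 → ∀ a c → lookup w a ≡ lookup w c → a ≡ c
  lookup-injective (v ∷ w) e zero    zero    q = refl
  lookup-injective (v ∷ w) e (suc a) (suc c) q = cong suc (lookup-injective w (m+n≡0⇒n≡0 (∑ (toList w) (δ v)) e) a c q)
  lookup-injective (v ∷ w) e zero    (suc c) q = ⊥-elim (absent w c (m+n≡0⇒m≡0 _ e) q)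
    where
    absent : ∀ {t} (w : Vec X t) c → ∑ (toList w) (δ v) ≡ 0 → v ≢ lookup w c
    absent (x ∷ w) zero    e refl = δ-refl x (m+n≡0⇒m≡0 _ e)
    absent (x ∷ w) (suc c) e q    = absent w c (m+n≡0⇒n≡0 (δ v x) e) q
  lookup-injective (v ∷ w) e (suc a) zero    q = sym (lookup-injective (v ∷ w) e zero (suc a) (sym q))

  vertex-injective : ∀ k z (b : BlowUp k z) (i : Fin k) (a c : Fin q) → vertex k z b i a ≡ vertex k z b i c → a ≡ c
  vertex-injective (suc k) z (w , e , _ , b) zero    a c = lookup-injective w e a c
  vertex-injective (suc k) z (w , e , _ , b) (suc i) a c = vertex-injective k _ b i a c

module Supersaturation {X : Set} (A : X → X → ℕ)
  (A-sym : ∀ u v → A u v ≡ A v u) (A-irr : ∀ v → A v v ≡ 0) (A≤1 : ∀ u v → A u v ≤ 1) (vs : List X)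
  (δ : X → X → ℕ) (δ-refl : ∀ v → δ v v ≢ 0) (∑-δ : ∀ u → ∑ vs (λ v → δ v u) ≤ 1) (p : ℕ) where

  open FewCliques A A-sym A-irr A≤1 vs public
  open BlowUps A A-sym δ δ-refl (suc p) public

  private
    n = length vs
    q = suc p

  -- Birthday estimate: each pair of coordinates coincides with probability at most 1/n, as each
  -- vertex occurs at most once in `vs`.
  ∑-repeats : ∀ t → n * ∑ (tuples vs t) repeats ≤ t * t * n ^ t
  ∑-repeats zero    = ≤-reflexive (*-zeroʳ n)
  ∑-repeats (suc t) = begin
    n * ∑ (tuples vs (suc t)) repeats
      ≡⟨ cong (n *_) (trans (∑-tuples vs t) (trans (∑-cong vs λ v → ∑-+ T) (∑-+ vs))) ⟩
    n * (∑ vs (λ v → ∑ T (λ w → ∑ (toList w) (δ v))) + ∑ vs (λ v → ∑ T repeats))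
      ≤⟨ *-monoʳ-≤ n (+-mono-≤ first (≤-reflexive (∑-const vs (∑ T repeats)))) ⟩
    n * (n ^ t * t + n * ∑ T repeats)
      ≡⟨ *-distribˡ-+ n (n ^ t * t) (n * ∑ T repeats) ⟩
    n * (n ^ t * t) + n * (n * ∑ T repeats)
      ≤⟨ +-monoʳ-≤ (n * (n ^ t * t)) (*-monoʳ-≤ n (∑-repeats t)) ⟩
    n * (n ^ t * t) + n * (t * t * n ^ t)
      ≤⟨ m≤m+n _ ((1 + t) * (n * n ^ t)) ⟩
    n * (n ^ t * t) + n * (t * t * n ^ t) + (1 + t) * (n * n ^ t)
      ≡⟨ lem n (n ^ t) t ⟩
    suc t * suc t * n ^ suc t ∎
    where
    open ≤-Reasoning
    T = tuples vs t
    lem : ∀ n m t → n * (m * t) + n * (t * t * m) + (1 + t) * (n * m) ≡ (1 + t) * (1 + t) * (n * m)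
    lem = solve-∀
    first : ∑ vs (λ v → ∑ T (λ w → ∑ (toList w) (δ v))) ≤ n ^ t * t
    first = begin
      ∑ vs (λ v → ∑ T (λ w → ∑ (toList w) (δ v)))
        ≡⟨ trans (∑-swap vs T) (∑-cong T λ w → ∑-swap vs (toList w)) ⟩
      ∑ T (λ w → ∑ (toList w) (λ u → ∑ vs (λ v → δ v u)))
        ≤⟨ ∑-mono T (λ w → ≤-trans (∑-bound (toList w) ∑-δ) (≤-reflexive (trans (*-identityʳ _) (length-toList w)))) ⟩
      ∑ T (λ w → t)
        ≡⟨ ∑-tuples-const vs t t ⟩
      n ^ t * t ∎

  clique : ∀ {t} → Vec X t → ℕ
  clique []      = 1
  clique (v ∷ x) = prod (A v) x * clique x

  H-∑ : ∀ k (z : X → ℕ) → H k (weigh z vs) ≡ ∑ (tuples vs k) (λ x → clique x * prod z x)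
  H-∑ zero    z = refl
  H-∑ (suc k) z = trans (H-weigh-suc k z vs) (trans (∑-cong vs λ v → begin
    z v * H k (weigh (λ u → A v u * z u) vs)
      ≡⟨ cong (z v *_) (H-∑ k (λ u → A v u * z u)) ⟩
    z v * ∑ (tuples vs k) (λ x → clique x * prod (λ u → A v u * z u) x)
      ≡⟨ sym (∑-*ˡ (tuples vs k) (z v)) ⟩
    ∑ (tuples vs k) (λ x → z v * (clique x * prod (λ u → A v u * z u) x))
      ≡⟨ ∑-cong (tuples vs k) (λ x → trans (cong (λ y → z v * (clique x * y)) (prod-* (A v) z x))
           (lem (z v) (clique x) (prod (A v) x) (prod z x))) ⟩
    ∑ (tuples vs k) (λ x → prod (A v) x * clique x * (z v * prod z x)) ∎) (sym (∑-tuples vs k)))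
    where
    open ≡-Reasoning
    lem : ∀ a b c d → a * (b * (c * d)) ≡ c * b * (a * d)
    lem = solve-∀

  H-unit-≤ : ∀ k z → (∀ v → z v ≤ 1) → H k (weigh z vs) ≤ n ^ k
  H-unit-≤ k z z≤1 = ≤-trans (H≤H₁^ k (weigh z vs)) (^-monoˡ-≤ k (≤-trans (≤-reflexive (H-weigh-suc 0 z vs))
    (≤-trans (∑-bound vs λ v → ≤-trans (≤-reflexive (*-identityʳ (z v))) (z≤1 v)) (≤-reflexive (*-identityʳ n)))))

  -- A (k + 1)-clique is a k-clique `x` with one of its `G x` common neighbours. The power mean over
  -- `x` replaces `G x` by its q-th power, which counts q-tuples of common neighbours; exchanging
  -- the sums counts, for each tuple `w`, the k-cliques in its common neighbourhood.
  blow-up-mean : ∀ k z → (∀ v → z v ≤ 1) → H (suc k) (weigh z vs) ^ q ≤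
    (n ^ k) ^ p * ∑ (tuples vs q) (λ w → prod z w * H k (weigh (λ v → neighbours w v * z v) vs))
  blow-up-mean k z z≤1 = begin
    H (suc k) (weigh z vs) ^ q
      ≡⟨ cong (_^ q) lhs ⟩
    ∑ T (λ x → h x * G x) ^ q
      ≤⟨ power-mean T p h G ⟩
    ∑ T h ^ p * ∑ T (λ x → h x * G x ^ q)
      ≤⟨ *-mono-≤ (^-monoˡ-≤ p (≤-trans (≤-reflexive (sym (H-∑ k z))) (H-unit-≤ k z z≤1))) (≤-reflexive rhs) ⟩
    (n ^ k) ^ p * ∑ (tuples vs q) (λ w → prod z w * H k (weigh (λ v → neighbours w v * z v) vs)) ∎
    where
    open ≤-Reasoning
    T = tuples vs k
    h G : Vec X k → ℕ
    h x = clique x * prod z x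
    G x = ∑ vs (λ u → z u * prod (A u) x)
    lem₁ : ∀ a b c d → a * (b * (c * d)) ≡ b * d * (a * c)
    lem₁ = solve-∀
    lhs : H (suc k) (weigh z vs) ≡ ∑ T (λ x → h x * G x)
    lhs = trans (H-weigh-suc k z vs) (trans (∑-cong vs λ u → trans (cong (z u *_) (H-∑ k _)) (trans (sym (∑-*ˡ T (z u)))
      (∑-cong T λ x → trans (cong (λ y → z u * (clique x * y)) (prod-* (A u) z x)) (lem₁ (z u) (clique x) (prod (A u) x) (prod z x)))))
      (trans (∑-swap vs T) (∑-cong T λ x → ∑-*ˡ vs (h x))))
    rhs : ∑ T (λ x → h x * G x ^ q) ≡ ∑ (tuples vs q) (λ w → prod z w * H k (weigh (λ v → neighbours w v * z v) vs))
    rhs = trans (∑-cong T λ x → trans (cong (h x *_) (sym (∑-tuples-prod vs q _))) (sym (∑-*ˡ (tuples vs q) (h x))))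
      (trans (∑-swap T (tuples vs q)) (∑-cong (tuples vs q) λ w → sym (trans (cong (prod z w *_) (H-∑ k _))
        (trans (sym (∑-*ˡ T (prod z w))) (∑-cong T λ x →
          trans (cong (λ y → prod z w * (clique x * y)) (prod-* (neighbours w) z x))
          (trans (lem₁ (prod z w) (clique x) (prod (neighbours w) x) (prod z x))
          (cong (h x *_) (trans (cong (prod z w *_) (prod-swap A w x)) (sym (prod-* z (λ u → prod (A u) x) w))))))))))

  Rich : ℕ → ℕ → (X → ℕ) → Vec X q → Set
  Rich k K z w = repeats w ≡ 0 × (∀ i → z (lookup w i) ≢ 0) × n ^ k ≤ K * H k (weigh (λ v → neighbours w v * z v) vs)

  -- A tuple that is not rich either sees few k-cliques, accounting for `n ^ k`, or has weight 0, or
  -- repeats an entry, in which case the trivial bound is charged to `repeats w`.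
  rich? : ∀ k K z → (∀ v → z v ≤ 1) → ∀ w →
    Rich k K z w ⊎ K * (prod z w * H k (weigh (λ v → neighbours w v * z v) vs)) ≤ n ^ k + K * n ^ k * repeats w
  rich? k K z z≤1 w with repeats w in e
  ... | suc j = inj₂ (begin
    K * (prod z w * H k (weigh (λ v → neighbours w v * z v) vs))
      ≤⟨ *-monoʳ-≤ (K) (*-mono-≤ (prod-≤1 z w z≤1) (H-unit-≤ k _ (λ v → *-mono-≤ (prod-≤1 _ w (λ u → A≤1 u v)) (z≤1 v)))) ⟩
    K * (1 * n ^ k)
      ≡⟨ cong (K *_) (*-identityˡ (n ^ k)) ⟩
    K * n ^ k
      ≤⟨ m≤m*n (K * n ^ k) (suc j) ⟩
    K * n ^ k * suc j
      ≤⟨ m≤n+m _ (n ^ k) ⟩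
    n ^ k + K * n ^ k * suc j ∎)
    where open ≤-Reasoning
  ... | zero with prod z w in e′ | prod-≤1 z w z≤1
  ...   | zero  | _ = inj₂ (≤-trans (≤-reflexive (*-zeroʳ (K))) z≤n)
  ...   | suc (suc _) | s≤s ()
  ...   | suc zero | _ with ≤-total (n ^ k) (K * H k (weigh (λ v → neighbours w v * z v) vs))
  ...     | inj₁ d = inj₁ (refl , prod-≢0 z w (λ e″ → 1+n≢0 (trans (sym e′) e″)) , d)
  ...     | inj₂ d = inj₂ (≤-trans (≤-reflexive (cong (K *_) (*-identityˡ _))) (≤-trans d (m≤m+n _ _)))

  -- A rich tuple becomes the first part, and its common neighbourhood still has k-clique density at
  -- least 1/(2 K^q), so the induction continues there. If no tuple were rich, the mean in
  -- `blow-up-mean` could not be reached.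
  supersaturation : ∀ k K z → (∀ v → z v ≤ 1) → threshold p k K ≤ n → n ^ k ≤ K * H k (weigh z vs) → BlowUp k z
  supersaturation zero    K z z≤1 large dense = tt
  supersaturation (suc k) K z z≤1 large dense
    with search (tuples vs q) (Rich k (2 * K ^ q) z) _ _ (rich? k (2 * K ^ q) z z≤1)
  ... | inj₁ (w , r , nz , d) = w , r , nz ,
    supersaturation k (2 * K ^ q) (λ v → neighbours w v * z v)
      (λ v → *-mono-≤ (prod-≤1 _ w (λ u → A≤1 u v)) (z≤1 v)) (≤-trans (m≤m⊔n _ _) large) d
  ... | inj₂ sparse = ⊥-elim (<-irrefl refl (<-≤-trans (≤-trans (m≤n⊔m _ _) large) small))
    where
    open ≤-Reasoning
    T = tuples vs q
    K′ = 2 * K ^ q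
    Φ = ∑ T (λ w → prod z w * H k (weigh (λ v → neighbours w v * z v) vs))
    R = ∑ T repeats
    0<n : 0 < n
    0<n = <-≤-trans (s≤s z≤n) (≤-trans (m≤n⊔m (threshold p k K′) _) large)
    instance n≢0 : NonZero n
             n≢0 = >-nonZero 0<n
    lower : n ^ q * n ^ k ≤ K ^ q * Φ
    lower = cancel ((n ^ k) ^ p) (m^n>0 (n ^ k) {{m^n≢0 n k}} p) (begin
      (n ^ k) ^ p * (n ^ q * n ^ k)
        ≡⟨ lem ((n ^ k) ^ p) (n ^ q) (n ^ k) ⟩
      n ^ q * (n ^ k) ^ q
        ≡⟨ sym (^-*-distrib n (n ^ k) q) ⟩
      (n ^ suc k) ^ q
        ≤⟨ ^-monoˡ-≤ q dense ⟩
      (K * H (suc k) (weigh z vs)) ^ q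
        ≡⟨ ^-*-distrib K _ q ⟩
      K ^ q * H (suc k) (weigh z vs) ^ q
        ≤⟨ *-monoʳ-≤ (K ^ q) (blow-up-mean k z z≤1) ⟩
      K ^ q * ((n ^ k) ^ p * Φ)
        ≡⟨ lem′ (K ^ q) ((n ^ k) ^ p) Φ ⟩
      (n ^ k) ^ p * (K ^ q * Φ) ∎)
      where
      lem : ∀ a b c → a * (b * c) ≡ b * (c * a)
      lem = solve-∀
      lem′ : ∀ a b c → a * (b * c) ≡ b * (a * c)
      lem′ = solve-∀
    -- The factor 2 in `K′` doubles the lower bound: tuples seeing few cliques supply at most half
    -- of it, and repetitions would have to supply the other half. The birthday estimate then bounds
    -- n.
    upper : n ^ q ≤ K′ * R
    upper = cancel (n ^ k) (m^n>0 n k) (+-cancelˡ-≤ (n ^ q * n ^ k) _ _ (begin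
      n ^ q * n ^ k + n ^ k * n ^ q
        ≡⟨ lem (n ^ q) (n ^ k) ⟩
      2 * (n ^ q * n ^ k)
        ≤⟨ *-monoʳ-≤ 2 lower ⟩
      2 * (K ^ q * Φ)
        ≡⟨ trans (sym (*-assoc 2 (K ^ q) Φ)) (sym (∑-*ˡ T K′)) ⟩
      ∑ T (λ w → K′ * (prod z w * H k (weigh (λ v → neighbours w v * z v) vs)))
        ≤⟨ sparse ⟩
      ∑ T (λ w → n ^ k + K′ * n ^ k * repeats w)
        ≡⟨ trans (∑-+ T) (cong₂ _+_ (∑-tuples-const vs q (n ^ k)) (∑-*ˡ T (K′ * n ^ k))) ⟩
      n ^ q * n ^ k + K′ * n ^ k * R
        ≡⟨ cong (n ^ q * n ^ k +_) (lem′ K′ (n ^ k) R) ⟩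
      n ^ q * n ^ k + n ^ k * (K′ * R) ∎))
      where
      lem : ∀ a b → a * b + b * a ≡ 2 * (a * b)
      lem = solve-∀
      lem′ : ∀ a b c → a * b * c ≡ b * (a * c)
      lem′ = solve-∀
    small : n ≤ K′ * (q * q)
    small = cancel (n ^ q) (m^n>0 n q) (begin
      n ^ q * n              ≡⟨ *-comm (n ^ q) n ⟩
      n * n ^ q              ≤⟨ *-monoʳ-≤ n upper ⟩
      n * (K′ * R)           ≡⟨ lem n K′ R ⟩
      K′ * (n * R)           ≤⟨ *-monoʳ-≤ K′ (∑-repeats q) ⟩
      K′ * (q * q * n ^ q)   ≡⟨ lem′ K′ (q * q) (n ^ q) ⟩
      n ^ q * (K′ * (q * q)) ∎)
      where
      lem : ∀ a b c → a * (b * c) ≡ b * (a * c)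
      lem = solve-∀
      lem′ : ∀ a b c → a * (b * c) ≡ c * (a * b)
      lem′ = solve-∀

-- Discarding vertices of small degree.

∑-mono-All : {X : Set} (xs : List X) {f g : X → ℕ} → All (λ x → f x ≤ g x) xs → ∑ xs f ≤ ∑ xs g
∑-mono-All []       []       = z≤n
∑-mono-All (x ∷ xs) (p ∷ ps) = +-mono-≤ p (∑-mono-All xs ps)

splitBy : {X : Set} (f : X → ℕ) (θ : ℕ) (xs : List X) →
  ∃ λ us → ∃ λ hs → xs ↭ us ++ hs × All (λ u → f u ≤ θ) us × All (λ u → θ ≤ f u) hs
splitBy f θ [] = [] , [] , Perm.refl , [] , []
splitBy f θ (x ∷ xs) with splitBy f θ xs | ≤-total (f x) θ
... | us , hs , p , a , b | inj₁ q = x ∷ us , hs , Perm.prep x p , q ∷ a , b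
... | us , hs , p , a , b | inj₂ q = us , x ∷ hs ,
  Perm.trans (Perm.prep x p) (Perm.↭-sym (PermP.shift x us hs)) , a , q ∷ b

module Truncation {X : Set} (A : X → X → ℕ)
  (A-sym : ∀ u v → A u v ≡ A v u) (A-irr : ∀ v → A v v ≡ 0) (A≤1 : ∀ u v → A u v ≤ 1) where

  open UnitWeights A A-sym A-irr A≤1 public

  degree : List X → X → ℕ
  degree xs u = H 1 (restrict u (unit xs))

  edges-degree : ∀ xs → edges xs ≡ ∑ xs (degree xs)
  edges-degree xs = trans (∑-map _ xs) (∑-cong xs λ u → *-identityˡ _)

  -- The vertices of `us` are removed one at a time by `H-∷`; measuring every loss in the full list
  -- only enlarges it.
  H-delete : ∀ s us hs →
    H (suc s) (unit (us ++ hs)) ≤ H (suc s) (unit hs) + suc s * ∑ us (λ u → H s (restrict u (unit (us ++ hs))))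
  H-delete s []       hs = m≤m+n _ _
  H-delete s (u ∷ us) hs = begin
    H (suc s) (unit (u ∷ us ++ hs))
      ≡⟨ H-∷ s u 1 (unit (us ++ hs)) ⟩
    H (suc s) (unit (us ++ hs)) + suc s * 1 * H s (restrict u (unit (us ++ hs)))
      ≤⟨ +-mono-≤ (≤-trans (H-delete s us hs) (+-monoʳ-≤ (H (suc s) (unit hs)) (*-monoʳ-≤ (suc s)
           (∑-mono us λ v → H-∷-≥ s _ (restrict v (unit (us ++ hs)))))))
           (*-mono-≤ (≤-reflexive (*-identityʳ (suc s))) (H-∷-≥ s (u , A u u * 1) (restrict u (unit (us ++ hs))))) ⟩
    H (suc s) (unit hs) + suc s * ∑ us (λ v → H s (restrict v (unit (u ∷ us ++ hs))))
      + suc s * H s (restrict u (unit (u ∷ us ++ hs)))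
      ≡⟨ lem (H (suc s) (unit hs)) (suc s) _ _ ⟩
    H (suc s) (unit hs) + suc s * ∑ (u ∷ us) (λ v → H s (restrict v (unit (u ∷ us ++ hs)))) ∎
    where
    open ≤-Reasoning
    lem : ∀ h s a b → h + s * a + s * b ≡ h + s * (b + a)
    lem = solve-∀

  -- An s+2-clique meeting a vertex u of degree at most θ is determined by an edge at u and s further neighbours of u.
  truncate : ∀ θ xs → ∃ λ hs → (∀ f → ∑ hs f ≤ ∑ xs f) × length hs * θ ≤ edges xs × edges hs ≤ edges xs ×
    (∀ s → H (2 + s) (unit xs) ≤ H (2 + s) (unit hs) + (2 + s) * (edges xs * θ ^ s))
  truncate θ xs with splitBy (degree xs) θ xs
  ... | us , hs , p , low , high = hs , sub , many , few , bound
    where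
    open ≤-Reasoning
    p′ : unit xs ↭ unit (us ++ hs)
    p′ = PermP.map⁺ _ p
    sub : ∀ f → ∑ hs f ≤ ∑ xs f
    sub f = ≤-trans (m≤n+m (∑ hs f) (∑ us f)) (≤-reflexive (trans (sym (∑-++ us hs)) (sym (∑-↭ p))))
    sub′ : ∀ f → ∑ us f ≤ ∑ xs f
    sub′ f = ≤-trans (m≤m+n (∑ us f) (∑ hs f)) (≤-reflexive (trans (sym (∑-++ us hs)) (sym (∑-↭ p))))
    many : length hs * θ ≤ edges xs
    many = begin
      length hs * θ        ≡⟨ sym (∑-const hs θ) ⟩
      ∑ hs (λ _ → θ)       ≤⟨ ∑-mono-All hs high ⟩
      ∑ hs (degree xs)     ≤⟨ sub (degree xs) ⟩
      ∑ xs (degree xs)     ≡⟨ sym (edges-degree xs) ⟩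
      edges xs ∎
    few : edges hs ≤ edges xs
    few = begin
      edges hs                   ≤⟨ H-++-≥ 2 (unit us) (unit hs) ⟩
      H 2 (unit us ++ unit hs)   ≡⟨ cong (H 2) (sym (map-++ _ us hs)) ⟩
      edges (us ++ hs)           ≡⟨ sym (H-↭ 2 p′) ⟩
      edges xs ∎
    bound : ∀ s → H (2 + s) (unit xs) ≤ H (2 + s) (unit hs) + (2 + s) * (edges xs * θ ^ s)
    bound s = begin
      H (2 + s) (unit xs)
        ≡⟨ H-↭ (2 + s) p′ ⟩
      H (2 + s) (unit (us ++ hs))
        ≤⟨ H-delete (suc s) us hs ⟩
      H (2 + s) (unit hs) + (2 + s) * ∑ us (λ u → H (suc s) (restrict u (unit (us ++ hs))))
        ≡⟨ cong (λ z → H (2 + s) (unit hs) + (2 + s) * z) (∑-cong us λ u → sym (H-↭ (suc s) (restrict-↭ p′))) ⟩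
      H (2 + s) (unit hs) + (2 + s) * ∑ us (λ u → H (suc s) (restrict u (unit xs)))
        ≤⟨ +-monoʳ-≤ (H (2 + s) (unit hs)) (*-monoʳ-≤ (2 + s) (∑-mono-All us (pow low))) ⟩
      H (2 + s) (unit hs) + (2 + s) * ∑ us (λ u → degree xs u * θ ^ s)
        ≤⟨ +-monoʳ-≤ (H (2 + s) (unit hs)) (*-monoʳ-≤ (2 + s) (sub′ _)) ⟩
      H (2 + s) (unit hs) + (2 + s) * ∑ xs (λ u → degree xs u * θ ^ s)
        ≡⟨ cong (λ z → H (2 + s) (unit hs) + (2 + s) * z) (trans (∑-*ʳ xs (θ ^ s)) (cong (_* θ ^ s) (sym (edges-degree xs)))) ⟩
      H (2 + s) (unit hs) + (2 + s) * (edges xs * θ ^ s) ∎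
      where
      pow : ∀ {us} → All (λ u → degree xs u ≤ θ) us → All (λ u → H (suc s) (restrict u (unit xs)) ≤ degree xs u * θ ^ s) us
      pow []             = []
      pow {u ∷ _} (p ∷ ps) = ≤-trans (H≤H₁^ (suc s) (restrict u (unit xs))) (*-monoʳ-≤ (degree xs u) (^-monoˡ-≤ s p)) ∷ pow ps

-- Choice of constants and the upper bound.

+-^-≤ : ∀ x y s → (x + y) ^ suc s ≤ x ^ suc s + suc s * (y * (x + y) ^ s)
+-^-≤ x y zero    = ≤-reflexive (lem x y)
  where lem : ∀ x y → (x + y) * 1 ≡ x * 1 + 1 * (y * 1)
        lem = solve-∀
+-^-≤ x y (suc s) = begin
  (x + y) * (x + y) ^ suc s
    ≡⟨ *-distribʳ-+ ((x + y) ^ suc s) x y ⟩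
  x * (x + y) ^ suc s + y * (x + y) ^ suc s
    ≤⟨ +-monoˡ-≤ _ (*-monoʳ-≤ x (+-^-≤ x y s)) ⟩
  x * (x ^ suc s + suc s * (y * (x + y) ^ s)) + y * (x + y) ^ suc s
    ≡⟨ lem x (x ^ suc s) (suc s) y ((x + y) ^ s) ((x + y) ^ suc s) ⟩
  x * x ^ suc s + suc s * (y * (x * (x + y) ^ s)) + y * (x + y) ^ suc s
    ≤⟨ +-monoˡ-≤ _ (+-monoʳ-≤ (x * x ^ suc s) (*-monoʳ-≤ (suc s) (*-monoʳ-≤ y (*-monoˡ-≤ ((x + y) ^ s) (m≤m+n x y))))) ⟩
  x * x ^ suc s + suc s * (y * (x + y) ^ suc s) + y * (x + y) ^ suc s
    ≡⟨ lem′ (x * x ^ suc s) (suc s) (y * (x + y) ^ suc s) ⟩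
  x ^ (2 + s) + (2 + s) * (y * (x + y) ^ suc s) ∎
  where
  open ≤-Reasoning
  lem : ∀ x p s y q r → x * (p + s * (y * q)) + y * r ≡ x * p + s * (y * (x * q)) + y * r
  lem = solve-∀
  lem′ : ∀ a s b → a + s * b + b ≡ a + (1 + s) * b
  lem′ = solve-∀

shift-negligible : ∀ N e s → ∃ λ t → 0 < t × N * (t + e) ^ suc s ≤ suc N * t ^ suc s
shift-negligible N e s = t , s≤s z≤n , (begin
  N * (t + e) ^ suc s
    ≤⟨ *-monoʳ-≤ N (+-^-≤ t e s) ⟩
  N * (t ^ suc s + suc s * (e * (t + e) ^ s))
    ≤⟨ *-monoʳ-≤ N (+-monoʳ-≤ (t ^ suc s) (*-monoʳ-≤ (suc s) (*-monoʳ-≤ e (≤-trans (^-monoˡ-≤ s t+e≤) (≤-reflexive (^-*-distrib t (1 + e) s)))))) ⟩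
  N * (t ^ suc s + suc s * (e * (t ^ s * (1 + e) ^ s)))
    ≡⟨ lem N (t ^ suc s) (suc s) e (t ^ s) ((1 + e) ^ s) ⟩
  N * t ^ suc s + N * suc s * e * (1 + e) ^ s * t ^ s
    ≤⟨ +-monoʳ-≤ (N * t ^ suc s) (*-monoˡ-≤ (t ^ s) (n≤1+n (N * suc s * e * (1 + e) ^ s))) ⟩
  N * t ^ suc s + t * t ^ s
    ≡⟨ +-comm (N * t ^ suc s) (t ^ suc s) ⟩
  suc N * t ^ suc s ∎)
  where
  open ≤-Reasoning
  -- With `t + e ≤ t * (1 + e)`, this choice makes the whole correction term at most `t * t ^ s`.
  t = suc (N * suc s * e * (1 + e) ^ s)
  t+e≤ : t + e ≤ t * (1 + e)
  t+e≤ = ≤-trans (+-monoʳ-≤ t (m≤n*m e t)) (≤-reflexive (sym (*-suc t e)))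
  lem : ∀ n p s e q r → n * (p + s * (e * (q * r))) ≡ n * p + n * s * e * r * q
  lem = solve-∀

square-cancel-≤ : ∀ a b → a * a ≤ b * b → a ≤ b
square-cancel-≤ a b p with ≤-<-connex a b
... | inj₁ q = q
... | inj₂ q = ⊥-elim (<⇒≱ (*-mono-< q q) p)

-- The arithmetic after sampling: `n` vertices, edge sum `e`, clique sum `h`, and `f`, `G` the
-- falling factorials of the sample size `t`. In the term `F + 2`, the `F` pays for replacing
-- `t + E` by `t₀` in the main term and the 2 for the samples with an (r + 1)-clique.
dense-numeric : ∀ r S N D E t₀ t c F G f h n e x → t ≡ t₀ + S → E ≡ 4 * S * (D * D) + 1 →
  0 < N → 0 < c → 0 < t₀ → 0 < D → N * (t₀ + (S + E)) ^ S ≤ suc N * t₀ ^ S → (t₀ + (S + E)) ^ S ≤ 2 * t₀ ^ S →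
  3 * (t * t) ≤ x → n ≤ D * x → e ≤ c * ((1 + x) * (1 + x)) → t₀ ^ S ≤ f → G ≤ t ^ suc r →
  N * N * (D ^ S * D ^ S * t ^ suc r) * (c ^ S * (f * h * (f * h))) ≤
    N * N * (D ^ S * D ^ S * t ^ suc r) * (F * F * (t * t * e + 4 * t * S * (n * n)) ^ S)
    + (n * n) ^ S * (c ^ S * (t ^ S * t ^ S) * G) →
  N * h ≤ (N * F + (F + 2)) * x ^ S
dense-numeric r S N D E t₀ t c F G f h n e x t≡ E≡ 0<N 0<c 0<t₀ 0<D N-spec 2-spec x-large n≤ e≤ f≥ G≤ sampled =
  cancel (t₀ ^ S) (m^n>0 t₀ {{t₀≢0}} S) (begin
  t₀ ^ S * (N * h)
    ≤⟨ *-monoˡ-≤ (N * h) f≥ ⟩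
  f * (N * h)
    ≡⟨ lem₁ f N h ⟩
  N * (f * h)
    ≤⟨ square-cancel-≤ _ _ (≤-trans squared (≤-trans (m≤m+n _ (2 * a * b)) (≤-reflexive (sym (binomial a b))))) ⟩
  a + b
    ≤⟨ +-mono-≤ (≤-reflexive (lem₂ N F (x ^ S) ((t + E) ^ S)))
         (*-monoʳ-≤ (x ^ S) (^-monoˡ-≤ S (≤-trans (≤-reflexive t≡) (+-monoʳ-≤ t₀ (m≤m+n S E))))) ⟩
  F * x ^ S * (N * (t + E) ^ S) + x ^ S * (t₀ + (S + E)) ^ S
    ≤⟨ +-mono-≤ (*-monoʳ-≤ (F * x ^ S) (≤-trans (≤-reflexive (cong (λ z → N * z ^ S) (trans (cong (_+ E) t≡) (+-assoc t₀ S E)))) N-spec))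
         (*-monoʳ-≤ (x ^ S) 2-spec) ⟩
  F * x ^ S * (suc N * t₀ ^ S) + x ^ S * (2 * t₀ ^ S)
    ≡⟨ lem₃ F (x ^ S) N (t₀ ^ S) ⟩
  t₀ ^ S * ((N * F + (F + 2)) * x ^ S) ∎)
  where
  open ≤-Reasoning
  a b : ℕ
  a = N * (F * (x ^ S * (t + E) ^ S))
  b = x ^ S * t ^ S
  t₀≢0 : NonZero t₀
  t₀≢0 = >-nonZero 0<t₀
  M κ : ℕ
  M = D ^ S * D ^ S * t ^ suc r
  κ = N * N * M
  0<t : 0 < t
  0<t = ≤-trans 0<t₀ (≤-trans (m≤m+n t₀ S) (≤-reflexive (sym t≡)))
  lem₁ : ∀ f n h → f * (n * h) ≡ n * (f * h)
  lem₁ = solve-∀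
  lem₂ : ∀ n f x t → n * (f * (x * t)) ≡ f * x * (n * t)
  lem₂ = solve-∀
  lem₃ : ∀ f x n t → f * x * ((1 + n) * t) + x * (2 * t) ≡ t * ((n * f + (f + 2)) * x)
  lem₃ = solve-∀
  binomial : ∀ a b → (a + b) * (a + b) ≡ a * a + b * b + 2 * a * b
  binomial = solve-∀
  n²≤ : n * n ≤ D * x * (D * x)
  n²≤ = *-mono-≤ n≤ n≤
  1≤x : 1 ≤ x
  1≤x = ≤-trans (*-mono-≤ {1} {3} {1} {t * t} (s≤s z≤n) (*-mono-≤ 0<t 0<t)) x-large
  -- In `E`, the part `4 * S * (D * D)` absorbs the shift from resampling, using `n ≤ D * x`. The 1
  -- absorbs the rounding of the square root, that is (1 + x)² in place of x², using
  -- `3 * (t * t) ≤ x`.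
  inner : t * t * e + 4 * t * S * (n * n) ≤ c * (x * (t + E) * (x * (t + E)))
  inner = begin
    t * t * e + 4 * t * S * (n * n)
      ≤⟨ +-mono-≤ (*-monoʳ-≤ (t * t) e≤) (*-monoʳ-≤ (4 * t * S) n²≤) ⟩
    t * t * (c * ((1 + x) * (1 + x))) + 4 * t * S * (D * x * (D * x))
      ≡⟨ i₁ t c x S D ⟩
    c * (x * x) * (t * t) + c * (t * t * (1 + 2 * x)) + 1 * (4 * t * S * (D * D) * (x * x))
      ≤⟨ +-mono-≤ (+-monoʳ-≤ (c * (x * x) * (t * t)) (*-monoʳ-≤ c (≤-trans (*-monoʳ-≤ (t * t) (+-monoˡ-≤ (2 * x) 1≤x))
           (≤-trans (≤-reflexive (i₂ t x)) (≤-trans (*-monoˡ-≤ x x-large) (m≤m*n (x * x) t {{>-nonZero 0<t}}))))))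
           (*-monoˡ-≤ (4 * t * S * (D * D) * (x * x)) 0<c) ⟩
    c * (x * x) * (t * t) + c * (x * x * t) + c * (4 * t * S * (D * D) * (x * x))
      ≡⟨ trans (i₃ c x t S D) (cong (λ z → c * (x * x) * (t * t + t * z)) (sym E≡)) ⟩
    c * (x * x) * (t * t + t * E)
      ≤⟨ m≤m+n _ (c * (x * x) * (t * E + E * E)) ⟩
    c * (x * x) * (t * t + t * E) + c * (x * x) * (t * E + E * E)
      ≡⟨ i₄ c x t E ⟩
    c * (x * (t + E) * (x * (t + E))) ∎
    where
    i₁ : ∀ t c x s d → t * t * (c * ((1 + x) * (1 + x))) + 4 * t * s * (d * x * (d * x)) ≡
         c * (x * x) * (t * t) + c * (t * t * (1 + 2 * x)) + 1 * (4 * t * s * (d * d) * (x * x))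
    i₁ = solve-∀
    i₂ : ∀ t x → t * t * (x + 2 * x) ≡ 3 * (t * t) * x
    i₂ = solve-∀
    i₃ : ∀ c x t s d → c * (x * x) * (t * t) + c * (x * x * t) + c * (4 * t * s * (d * d) * (x * x)) ≡
         c * (x * x) * (t * t + t * (4 * s * (d * d) + 1))
    i₃ = solve-∀
    i₄ : ∀ c x t e → c * (x * x) * (t * t + t * e) + c * (x * x) * (t * e + e * e) ≡ c * (x * (t + e) * (x * (t + e)))
    i₄ = solve-∀
  -- The factor `M` is the size of (n/x)^(2S) times `G` in the worst case, so after cancelling it
  -- the error term is exactly `b * b`.
  squared : N * (f * h) * (N * (f * h)) ≤ a * a + b * b
  squared = cancel (M * c ^ S) (*-mono-< 0<M (m^n>0 c {{>-nonZero 0<c}} S)) (begin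
    M * c ^ S * (N * (f * h) * (N * (f * h)))
      ≡⟨ j₁ M (c ^ S) N (f * h) ⟩
    κ * (c ^ S * (f * h * (f * h)))
      ≤⟨ sampled ⟩
    κ * (F * F * (t * t * e + 4 * t * S * (n * n)) ^ S) + (n * n) ^ S * (c ^ S * (t ^ S * t ^ S) * G)
      ≤⟨ +-mono-≤ (*-monoʳ-≤ κ (*-monoʳ-≤ (F * F) (^-monoˡ-≤ S inner)))
           (*-mono-≤ (^-monoˡ-≤ S n²≤) (*-monoʳ-≤ (c ^ S * (t ^ S * t ^ S)) G≤)) ⟩
    κ * (F * F * (c * (x * (t + E) * (x * (t + E)))) ^ S) + (D * x * (D * x)) ^ S * (c ^ S * (t ^ S * t ^ S) * t ^ suc r)
      ≡⟨ cong₂ (λ y z → κ * (F * F * y) + z * (c ^ S * (t ^ S * t ^ S) * t ^ suc r)) expand₁ expand₂ ⟩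
    κ * (F * F * (c ^ S * (x ^ S * (t + E) ^ S * (x ^ S * (t + E) ^ S))))
      + D ^ S * x ^ S * (D ^ S * x ^ S) * (c ^ S * (t ^ S * t ^ S) * t ^ suc r)
      ≡⟨ j₂ N (D ^ S) (t ^ suc r) F (c ^ S) (x ^ S) ((t + E) ^ S) (t ^ S) ⟩
    M * c ^ S * (a * a + b * b) ∎)
    where
    0<M : 0 < M
    0<M = *-mono-< (*-mono-< (m^n>0 D {{>-nonZero 0<D}} S) (m^n>0 D {{>-nonZero 0<D}} S)) (m^n>0 t {{>-nonZero 0<t}} (suc r))
    expand₁ : (c * (x * (t + E) * (x * (t + E)))) ^ S ≡ c ^ S * (x ^ S * (t + E) ^ S * (x ^ S * (t + E) ^ S))
    expand₁ = trans (^-*-distrib c _ S) (cong (c ^ S *_) (trans (^-*-distrib (x * (t + E)) _ S)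
      (cong₂ _*_ (^-*-distrib x (t + E) S) (^-*-distrib x (t + E) S))))
    expand₂ : (D * x * (D * x)) ^ S ≡ D ^ S * x ^ S * (D ^ S * x ^ S)
    expand₂ = trans (^-*-distrib (D * x) _ S) (cong₂ _*_ (^-*-distrib D x S) (^-*-distrib D x S))
    j₁ : ∀ m c n f → m * c * (n * f * (n * f)) ≡ n * n * m * (c * (f * f))
    j₁ = solve-∀
    j₂ : ∀ n d u f c x y z →
      n * n * (d * d * u) * (f * f * (c * (x * y * (x * y)))) + d * x * (d * x) * (c * (z * z) * u) ≡
      d * d * u * c * (n * (f * (x * y)) * (n * (f * (x * y))) + x * z * (x * z))
    j₂ = solve-∀

module Parameters (r s N : ℕ) (p : ℕ) (0<N : 0 < N) (0<c : 0 < ff r 2) where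

  instance
    N≢0 : NonZero N
    N≢0 = >-nonZero 0<N

  S : ℕ
  S = 3 + s

  abstract

    -- At most `D * x` vertices survive truncation: their degrees are at least x / (2N), while the
    -- edge sum is at most 4 c x² for c = `ff r 2`. Next, `t₀` is so large that a shift by `S + E`
    -- costs a factor of at most 1 + 1/N in S-th powers. Finally, 1/κ is the density of (r +
    -- 1)-cliques that sampling tolerates, and from `τ` vertices on a density of at least 1/κ forces
    -- a blow-up.
    D E t₀ κ τ : ℕ
    D = 8 * N * ff r 2
    E = 4 * S * (D * D) + 1
    t₀ = proj₁ (shift-negligible N (S + E) (2 + s))
    κ = N * N * (D ^ S * D ^ S * (t₀ + S) ^ suc r)
    τ = threshold p (suc r) κ

    D-def : D ≡ 8 * N * ff r 2
    D-def = refl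

    E-def : E ≡ 4 * S * (D * D) + 1
    E-def = refl

    0<t₀ : 0 < t₀
    0<t₀ = proj₁ (proj₂ (shift-negligible N (S + E) (2 + s)))

    t₀-spec : N * (t₀ + (S + E)) ^ S ≤ suc N * t₀ ^ S
    t₀-spec = proj₂ (proj₂ (shift-negligible N (S + E) (2 + s)))

    κ-def : κ ≡ N * N * (D ^ S * D ^ S * (t₀ + S) ^ suc r)
    κ-def = refl

    τ-def : τ ≡ threshold p (suc r) κ
    τ-def = refl

    0<τ : 0 < τ
    0<τ = ≤-trans (s≤s z≤n) (m≤n⊔m (threshold p r (2 * κ ^ suc p)) _)

  -- The summands of `X₀` ensure in turn that `x / N` is positive, that rounding is negligible
  -- against the sample size, and that fewer than `τ` vertices contribute too little to matter.
  t X₀ : ℕ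
  t = t₀ + S
  X₀ = N + 3 * (t * t) + N * τ

  t₀^S-spec : (t₀ + (S + E)) ^ S ≤ 2 * t₀ ^ S
  t₀^S-spec = cancel N 0<N (≤-trans t₀-spec (≤-trans (*-monoˡ-≤ (t₀ ^ S) (≤-trans (+-monoˡ-≤ N 0<N) (≤-reflexive (lem N))))
    (≤-reflexive (*-assoc N 2 (t₀ ^ S)))))
    where lem : ∀ n → n + n ≡ n * 2
          lem = solve-∀

  -- The error of `dense-numeric` plus, in the summand `4 * S * ff r 2`, the cliques lost by
  -- truncation.
  C : ℕ
  C = ff r S + 2 + 4 * S * ff r 2

  module _ {X : Set} (A : X → X → ℕ)
    (A-sym : ∀ u v → A u v ≡ A v u) (A-irr : ∀ v → A v v ≡ 0) (A≤1 : ∀ u v → A u v ≤ 1)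
    (δ : X → X → ℕ) (δ-refl : ∀ v → δ v v ≢ 0) where

    open Truncation A A-sym A-irr A≤1
    open BlowUps A A-sym δ δ-refl (suc p) using (BlowUp)

    dense-bound : ∀ x hs → 3 * (t * t) ≤ x → length hs ≤ D * x → edges hs ≤ ff r 2 * ((1 + x) * (1 + x)) →
      0 < length hs → κ * H (suc r) (unit hs) ≤ length hs ^ suc r →
      N * H S (unit hs) ≤ (N * ff r S + (ff r S + 2)) * x ^ S
    dense-bound x hs x-large n≤ e≤ 0<n few =
      dense-numeric r S N D E t₀ t (ff r 2) (ff r S) (ff t (suc r)) (ff t S) (H S (unit hs)) (length hs) (edges hs) x refl E-def
        0<N 0<c 0<t₀ 0<D t₀-spec t₀^S-spec x-large n≤ e≤ (^≤ff t₀ S) (ff≤^ t (suc r))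
        (subst (λ k → k * (ff r 2 ^ S * (ff t S * H S (unit hs) * (ff t S * H S (unit hs)))) ≤
          k * (ff r S * ff r S * (t * t * edges hs + 4 * t * S * (length hs * length hs)) ^ S)
            + (length hs * length hs) ^ S * (ff r 2 ^ S * (t ^ S * t ^ S) * ff t (suc r)))
          κ-def (FewCliques.turán-few A A-sym A-irr A≤1 hs r (suc s) t κ 0<n few))
      where
      0<D : 0 < D
      0<D = ≤-trans (*-mono-≤ {1} {8 * N} {1} {ff r 2} (*-mono-≤ {1} {8} {1} {N} (s≤s z≤n) 0<N) 0<c) (≤-reflexive (sym D-def))

    upper-bound : ∀ x xs → X₀ ≤ x → (∀ u → ∑ xs (λ v → δ v u) ≤ 1) → ¬ BlowUp (suc r) (λ _ → 1) →
      edges xs ≤ ff r 2 * ((1 + x) * (1 + x)) → N * H S (unit xs) ≤ (N * ff r S + C) * x ^ S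
    upper-bound x xs x-large ∑-δ free e≤ with truncate (x / N) xs
    ... | hs , sub , many , fewer , bound = begin
      N * H S (unit xs)
        ≤⟨ *-monoʳ-≤ N (bound (suc s)) ⟩
      N * (H S (unit hs) + S * (edges xs * θ ^ suc s))
        ≡⟨ k₁ N (H S (unit hs)) S (edges xs) θ (θ ^ s) ⟩
      N * H S (unit hs) + S * (edges xs * (θ * N * θ ^ s))
        ≤⟨ +-mono-≤ main (*-monoʳ-≤ S (*-mono-≤ e≤′ (*-mono-≤ (m/n*n≤m x N) (^-monoˡ-≤ s (m/n≤m x N))))) ⟩
      (N * ff r S + (ff r S + 2)) * x ^ S + S * (4 * (x * x) * ff r 2 * (x * x ^ s))
        ≡⟨ k₂ (N * ff r S) (ff r S) x (x ^ s) S (ff r 2) ⟩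
      (N * ff r S + C) * x ^ S ∎
      where
      open ≤-Reasoning
      θ = x / N
      N≤x : N ≤ x
      N≤x = ≤-trans (m≤m+n N _) (≤-trans (m≤m+n (N + 3 * (t * t)) _) x-large)
      1≤x : 1 ≤ x
      1≤x = ≤-trans 0<N N≤x
      t²≤x : 3 * (t * t) ≤ x
      t²≤x = ≤-trans (m≤n+m (3 * (t * t)) N) (≤-trans (m≤m+n (N + 3 * (t * t)) _) x-large)
      thr≤x : N * τ ≤ x
      thr≤x = ≤-trans (m≤n+m _ (N + 3 * (t * t))) x-large
      k₁ : ∀ n h s e t u → n * (h + s * (e * (t * u))) ≡ n * h + s * (e * (t * n * u))
      k₁ = solve-∀
      k₂ : ∀ a f x y s c → (a + (f + 2)) * (x * (x * (x * y))) + s * (4 * (x * x) * c * (x * y)) ≡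
        (a + (f + 2 + 4 * s * c)) * (x * (x * (x * y)))
      k₂ = solve-∀
      e≤′ : edges xs ≤ 4 * (x * x) * ff r 2
      e≤′ = ≤-trans e≤ (≤-trans (*-monoʳ-≤ (ff r 2) (*-mono-≤ (+-monoˡ-≤ x 1≤x) (+-monoˡ-≤ x 1≤x))) (≤-reflexive (lem (ff r 2) x)))
        where lem : ∀ c x → c * ((x + x) * (x + x)) ≡ 4 * (x * x) * c
              lem = solve-∀
      n≤ : length hs ≤ D * x
      n≤ = cancel x 1≤x (begin
        x * length hs
          ≤⟨ *-monoˡ-≤ (length hs) x≤ ⟩
        2 * (N * θ) * length hs
          ≡⟨ lem N θ (length hs) ⟩
        2 * N * (length hs * θ)
          ≤⟨ *-monoʳ-≤ (2 * N) (≤-trans many e≤′) ⟩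
        2 * N * (4 * (x * x) * ff r 2)
          ≡⟨ trans (lem′ N x (ff r 2)) (cong (λ z → x * (z * x)) (sym D-def)) ⟩
        x * (D * x) ∎)
        where
        lem : ∀ n t h → 2 * (n * t) * h ≡ 2 * n * (h * t)
        lem = solve-∀
        lem′ : ∀ n x c → 2 * n * (4 * (x * x) * c) ≡ x * (8 * n * c * x)
        lem′ = solve-∀
        0<θ : 0 < θ
        0<θ = m≥n⇒m/n>0 N≤x
        x≤ : x ≤ 2 * (N * θ)
        x≤ = begin
          x                   ≡⟨ m≡m%n+[m/n]*n x N ⟩
          x % N + θ * N       ≤⟨ +-monoˡ-≤ (θ * N) (<⇒≤ (m%n<n x N)) ⟩
          N + θ * N           ≤⟨ +-monoˡ-≤ (θ * N) (m≤n*m N θ {{>-nonZero 0<θ}}) ⟩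
          θ * N + θ * N       ≡⟨ lem″ θ N ⟩
          2 * (N * θ) ∎
          where lem″ : ∀ a b → a * b + a * b ≡ 2 * (b * a)
                lem″ = solve-∀
      open Supersaturation A A-sym A-irr A≤1 hs δ δ-refl (λ u → ≤-trans (sub _) (∑-δ u)) p using (supersaturation; H-unit-≤)
      main : N * H S (unit hs) ≤ (N * ff r S + (ff r S + 2)) * x ^ S
      main with ≤-<-connex (τ) (length hs)
      -- With fewer than `τ` vertices even the number of all S-tuples is small enough, because
      -- `N * τ ≤ x`.
      ... | inj₂ small = begin
        N * H S (unit hs)
          ≤⟨ *-mono-≤ (m≤m*n N (N ^ (2 + s)) {{m^n≢0 N (2 + s)}}) (≤-trans (H-unit-≤ S (λ _ → 1) (λ _ → ≤-refl)) (^-monoˡ-≤ S (<⇒≤ small))) ⟩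
        N ^ S * τ ^ S
          ≡⟨ sym (^-*-distrib N (τ) S) ⟩
        (N * τ) ^ S
          ≤⟨ ^-monoˡ-≤ S thr≤x ⟩
        x ^ S
          ≤⟨ m≤n*m (x ^ S) (N * ff r S + (ff r S + 2)) {{>-nonZero (≤-trans (s≤s z≤n) (≤-trans (m≤n+m 2 (ff r S)) (m≤n+m _ (N * ff r S))))}} ⟩
        (N * ff r S + (ff r S + 2)) * x ^ S ∎
      ... | inj₁ large with ≤-total (length hs ^ suc r) (κ * H (suc r) (unit hs))
      ...   | inj₁ dense = ⊥-elim (free (supersaturation (suc r) κ (λ _ → 1) (λ _ → ≤-refl) (≤-trans (≤-reflexive (sym τ-def)) large) dense))
      ...   | inj₂ few = dense-bound x hs t²≤x n≤ (≤-trans fewer e≤) (≤-trans 0<τ large) few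

-- Clique counts as homomorphism counts.

indicator : Bool → ℕ
indicator b = if b then 1 else 0

indicator-∧ : ∀ b c → indicator (b ∧ c) ≡ indicator c * indicator b
indicator-∧ false c = sym (*-zeroʳ (indicator c))
indicator-∧ true  c = sym (*-identityʳ (indicator c))

indicator-≤1 : ∀ b → indicator b ≤ 1
indicator-≤1 false = z≤n
indicator-≤1 true  = ≤-refl

module _ {A : Set} where

  countB-++ : (f : A → Bool) (xs ys : List A) → countB f (xs ++ ys) ≡ countB f xs + countB f ys
  countB-++ f []       ys = refl
  countB-++ f (x ∷ xs) ys with f x
  ... | true  = cong suc (countB-++ f xs ys)
  ... | false = countB-++ f xs ys

  countB-map : {B : Set} (f : A → Bool) (g : B → A) (xs : List B) → countB f (map g xs) ≡ countB (λ x → f (g x)) xs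
  countB-map f g []       = refl
  countB-map f g (x ∷ xs) with f (g x)
  ... | true  = cong suc (countB-map f g xs)
  ... | false = countB-map f g xs

  countB-cong : {f g : A → Bool} (xs : List A) → (∀ x → f x ≡ g x) → countB f xs ≡ countB g xs
  countB-cong []       e = refl
  countB-cong {f} {g} (x ∷ xs) e rewrite e x with g x
  ... | true  = cong suc (countB-cong xs e)
  ... | false = countB-cong xs e

  countB-false : {f : A → Bool} (xs : List A) → (∀ x → f x ≡ false) → countB f xs ≡ 0
  countB-false []       e = refl
  countB-false {f} (x ∷ xs) e rewrite e x = countB-false xs e

  and-map⁺ : (f : A → Bool) (xs : List A) → (∀ x → f x ≡ true) → and (map f xs) ≡ true
  and-map⁺ f []       e = refl
  and-map⁺ f (x ∷ xs) e rewrite e x = and-map⁺ f xs e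

  and-map⁻ : (f : A → Bool) {xs : List A} → and (map f xs) ≡ true → ∀ {x} → x ∈ xs → f x ≡ true
  and-map⁻ f {y ∷ xs} e (here refl) with f y
  ... | true = refl
  and-map⁻ f {y ∷ xs} e (there p) with f y
  ... | true = and-map⁻ f {xs} e p

-- The clique test rewritten as a recursion over the subset vector. `P` marks the vertices still
-- admissible, shrinking to the neighbours of each chosen vertex, exactly as `restrict` does with
-- weights.
cliqueIn : ∀ {n} → (Fin n → Fin n → Bool) → (Fin n → Bool) → Vec Bool n → Bool
cliqueIn a P []          = true
cliqueIn a P (false ∷ p) = cliqueIn (λ i j → a (suc i) (suc j)) (λ i → P (suc i)) p
cliqueIn a P (true ∷ p)  = P zero ∧ cliqueIn (λ i j → a (suc i) (suc j)) (λ i → P (suc i) ∧ a zero (suc i)) p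

IsClique : ∀ {n} → (Fin n → Fin n → Bool) → Vec Bool n → Set
IsClique a p = ∀ i j → lookup p i ≡ true → lookup p j ≡ true → i ≢ j → a i j ≡ true

∧-true : ∀ {b c} → b ∧ c ≡ true → b ≡ true × c ≡ true
∧-true {true} e = refl , e

cliqueIn-sound : ∀ {n} (a : Fin n → Fin n → Bool) → (∀ i j → a i j ≡ a j i) → ∀ P p → cliqueIn a P p ≡ true →
  (∀ i → lookup p i ≡ true → P i ≡ true) × IsClique a p
cliqueIn-sound a s P [] e = (λ ()) , (λ ())
cliqueIn-sound a s P (false ∷ p) e with cliqueIn-sound _ (λ i j → s (suc i) (suc j)) _ p e
... | q , c = (λ { (suc i) → q i }) , λ { (suc i) (suc j) x y z → c i j x y (λ e → z (cong suc e)) }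
cliqueIn-sound a s P (true ∷ p) e with ∧-true e
... | e₀ , e₁ with cliqueIn-sound _ (λ i j → s (suc i) (suc j)) _ p e₁
...   | q , c = (λ { zero _ → e₀ ; (suc i) x → proj₁ (∧-true (q i x)) }) ,
  λ { zero zero _ _ z → ⊥-elim (z refl)
    ; zero (suc j) _ y _ → proj₂ (∧-true (q j y))
    ; (suc i) zero x _ _ → trans (s (suc i) zero) (proj₂ (∧-true (q i x)))
    ; (suc i) (suc j) x y z → c i j x y (λ e → z (cong suc e)) }

cliqueIn-complete : ∀ {n} (a : Fin n → Fin n → Bool) P p →
  (∀ i → lookup p i ≡ true → P i ≡ true) → IsClique a p → cliqueIn a P p ≡ true
cliqueIn-complete a P [] q c = refl
cliqueIn-complete a P (false ∷ p) q c =
  cliqueIn-complete _ _ p (λ i → q (suc i)) (λ i j x y z → c (suc i) (suc j) x y (λ e → z (Fin.suc-injective e)))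
cliqueIn-complete a P (true ∷ p) q c rewrite q zero refl =
  cliqueIn-complete _ _ p (λ i x → cong₂ _∧_ (q (suc i) x) (c zero (suc i) refl x (λ ())))
    (λ i j x y z → c (suc i) (suc j) x y (λ e → z (Fin.suc-injective e)))

isClique≡cliqueIn : ∀ G p → isClique G p ≡ cliqueIn (adj G) (λ _ → true) p
isClique≡cliqueIn G p = ⇔→≡ {z = true} (mk⇔
  (λ e → cliqueIn-complete (adj G) _ p (λ _ _ → refl) λ i j x y z →
    cell⁻ i j x y z (and-map⁻ _ (and-map⁻ _ e (∈-allFin i)) (∈-allFin j)))
  (λ e → and-map⁺ _ (allFin (V G)) λ i → and-map⁺ _ (allFin (V G)) λ j →
    cell⁺ i j (proj₂ (cliqueIn-sound (adj G) (Graph.sym G) (λ _ → true) p e) i j)))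
  where
  cell⁻ : ∀ i j → lookup p i ≡ true → lookup p j ≡ true → i ≢ j →
    not (lookup p i ∧ lookup p j) ∨ ⌊ i Fin.≟ j ⌋ ∨ adj G i j ≡ true → adj G i j ≡ true
  cell⁻ i j x y z e rewrite x | y with i Fin.≟ j
  ... | yes q = ⊥-elim (z q)
  ... | no _  = e
  cell⁺ : ∀ i j → (lookup p i ≡ true → lookup p j ≡ true → i ≢ j → adj G i j ≡ true) →
    not (lookup p i ∧ lookup p j) ∨ ⌊ i Fin.≟ j ⌋ ∨ adj G i j ≡ true
  cell⁺ i j c with lookup p i | lookup p j | i Fin.≟ j
  ... | false | _     | _     = refl
  ... | true  | false | _     = refl
  ... | true  | true  | yes _ = refl
  ... | true  | true  | no z  = c refl refl z

⌊suc≟suc⌋ : ∀ {n} (i j : Fin n) → ⌊ Fin.suc i Fin.≟ suc j ⌋ ≡ ⌊ i Fin.≟ j ⌋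
⌊suc≟suc⌋ i j with i Fin.≟ j
... | yes _ = refl
... | no _  = refl

⌊1+≟1+⌋ : ∀ m n → ⌊ suc m ℕ.≟ suc n ⌋ ≡ ⌊ m ℕ.≟ n ⌋
⌊1+≟1+⌋ m n with m ℕ.≟ n | suc m ℕ.≟ suc n
... | yes _ | yes _ = refl
... | no _  | no _  = refl
... | yes p | no q  = ⊥-elim (q (cong suc p))
... | no p  | yes q = ⊥-elim (p (suc-injective q))

∑-δ-allFin : ∀ n (u : Fin n) → ∑ (allFin n) (λ v → indicator ⌊ v Fin.≟ u ⌋) ≤ 1
∑-δ-allFin (suc n) u rewrite sym (map-tabulate {n = n} (λ i → i) (Fin.suc)) = go u
  where
  go : ∀ u → indicator ⌊ zero Fin.≟ u ⌋ + ∑ (map Fin.suc (allFin n)) (λ v → indicator ⌊ v Fin.≟ u ⌋) ≤ 1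
  go zero    = ≤-reflexive (cong suc (trans (∑-map suc (allFin n)) (∑-zero (allFin n) λ _ → refl)))
  go (suc u) = ≤-trans (≤-reflexive (trans (∑-map suc (allFin n)) (∑-cong (allFin n) λ v → cong indicator (⌊suc≟suc⌋ v u)))) (∑-δ-allFin n u)

allFin-suc : ∀ n → allFin (suc n) ≡ zero ∷ map suc (allFin n)
allFin-suc n = cong (zero ∷_) (sym (map-tabulate {n = n} (λ i → i) suc))

H-allFin-suc : ∀ {n} (a : Fin (suc n) → Fin (suc n) → ℕ) → (∀ i j → a i j ≡ a j i) → (∀ i → a i i ≡ 0) →
  (∀ i j → a i j ≤ 1) → ∀ s z → let a⁻ = λ i j → a (suc i) (suc j) in
  Cliques.H a (suc s) (weigh z (allFin (suc n))) ≡
  Cliques.H a⁻ (suc s) (weigh (λ i → z (suc i)) (allFin n))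
    + suc s * z zero * Cliques.H a⁻ s (weigh (λ i → a zero (suc i) * z (suc i)) (allFin n))
H-allFin-suc {n} a a-sym a-irr a≤1 s z = begin
  H (suc s) (weigh z (allFin (suc n)))
    ≡⟨ cong (λ l → H (suc s) (weigh z l)) (allFin-suc n) ⟩
  H (suc s) ((zero , z zero) ∷ weigh z (map suc (allFin n)))
    ≡⟨ H-∷ s zero (z zero) _ ⟩
  H (suc s) (weigh z (map suc (allFin n))) + suc s * z zero * H s (restrict zero (weigh z (map suc (allFin n))))
    ≡⟨ cong₂ (λ x y → x + suc s * z zero * y) (H-map a suc (suc s) z (allFin n))
         (trans (cong (H s) (restrict-weigh zero z (map suc (allFin n)))) (H-map a suc s _ (allFin n))) ⟩
  _ ∎
  where
  open ≡-Reasoning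
  open CliqueProperties a a-sym a-irr a≤1

-- Every s-clique has `s !` orderings. Splitting the subsets by whether they contain vertex 0
-- mirrors the expansion of `H` along that vertex, and the factor `suc s` there matches the step
-- from `s !` to `suc s !`.
countCliques : ∀ {n} (a : Fin n → Fin n → Bool) → (∀ i j → a i j ≡ a j i) → (∀ i → a i i ≡ false) → ∀ s P →
  s ! * countB (λ p → ⌊ card p ℕ.≟ s ⌋ ∧ cliqueIn a P p) (allSubsets n) ≡
  Cliques.H (λ i j → indicator (a i j)) s (weigh (λ i → indicator (P i)) (allFin n))
countCliques {zero} a a-sym a-irr zero    P = refl
countCliques {zero} a a-sym a-irr (suc s) P = *-zeroʳ (suc s !)
countCliques {suc n} a a-sym a-irr s P = trans (cong (s ! *_) (trans (countB-++ good (map (false ∷_) (allSubsets n)) _)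
    (cong₂ _+_ (countB-map good (false ∷_) (allSubsets n)) (countB-map good (true ∷_) (allSubsets n))))) (go s)
  where
  a⁻ : Fin n → Fin n → Bool
  a⁻ i j = a (suc i) (suc j)
  P⁻ P⁺ : Fin n → Bool
  P⁻ i = P (suc i)
  P⁺ i = P (suc i) ∧ a zero (suc i)
  ih = countCliques a⁻ (λ i j → a-sym (suc i) (suc j)) (λ i → a-irr (suc i))
  good : Vec Bool (suc n) → Bool
  good p = ⌊ card p ℕ.≟ s ⌋ ∧ cliqueIn a P p
  count : ℕ → (Fin n → Bool) → ℕ
  count s Q = countB (λ p → ⌊ card p ℕ.≟ s ⌋ ∧ cliqueIn a⁻ Q p) (allSubsets n)
  with-zero : ∀ s → countB (λ p → ⌊ card p ℕ.≟ s ⌋ ∧ (P zero ∧ cliqueIn a⁻ P⁺ p)) (allSubsets n) ≡ indicator (P zero) * count s P⁺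
  with-zero s with P zero
  ... | true  = sym (+-identityʳ _)
  ... | false = countB-false (allSubsets n) λ p → ∧-zeroʳ ⌊ card p ℕ.≟ s ⌋
  go : ∀ s → s ! * (count s P⁻ + countB (λ p → ⌊ suc (card p) ℕ.≟ s ⌋ ∧ (P zero ∧ cliqueIn a⁻ P⁺ p)) (allSubsets n)) ≡
    Cliques.H (λ i j → indicator (a i j)) s (weigh (λ i → indicator (P i)) (allFin (suc n)))
  go zero = trans (cong (λ z → 1 * (count 0 P⁻ + z)) (countB-false (allSubsets n) λ _ → refl))
    (trans (cong (1 *_) (+-identityʳ (count 0 P⁻))) (ih zero P⁻))
  go (suc s) = begin
    suc s ! * (count (suc s) P⁻ + countB (λ p → ⌊ suc (card p) ℕ.≟ suc s ⌋ ∧ (P zero ∧ cliqueIn a⁻ P⁺ p)) (allSubsets n))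
      ≡⟨ cong (λ z → suc s ! * (count (suc s) P⁻ + z)) (trans (countB-cong (allSubsets n) λ p →
           cong (_∧ (P zero ∧ cliqueIn a⁻ P⁺ p)) (⌊1+≟1+⌋ (card p) s)) (with-zero s)) ⟩
    suc s ! * (count (suc s) P⁻ + indicator (P zero) * count s P⁺)
      ≡⟨ lem (suc s) (s !) (count (suc s) P⁻) (indicator (P zero)) (count s P⁺) ⟩
    suc s ! * count (suc s) P⁻ + suc s * indicator (P zero) * (s ! * count s P⁺)
      ≡⟨ cong₂ (λ x y → x + suc s * indicator (P zero) * y) (ih (suc s) P⁻)
           (trans (ih s P⁺) (cong (Cliques.H (λ i j → indicator (a⁻ i j)) s)
             (map-cong (λ i → cong (i ,_) (indicator-∧ (P (suc i)) (a zero (suc i)))) (allFin n)))) ⟩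
    _ ≡⟨ sym (H-allFin-suc (λ i j → indicator (a i j)) (λ i j → cong indicator (a-sym i j)) (λ i → cong indicator (a-irr i))
           (λ i j → indicator-≤1 (a i j)) s (λ i → indicator (P i))) ⟩
    Cliques.H (λ i j → indicator (a i j)) (suc s) (weigh (λ i → indicator (P i)) (allFin (suc n))) ∎
    where
    open ≡-Reasoning
    lem : ∀ s f x p y → s * f * (x + p * y) ≡ s * f * x + s * p * (f * y)
    lem = solve-∀

edge : (G : Graph) → Fin (V G) → Fin (V G) → ℕ
edge G i j = indicator (adj G i j)

edge-sym : ∀ G i j → edge G i j ≡ edge G j i
edge-sym G i j = cong indicator (Graph.sym G i j)

edge-irr : ∀ G i → edge G i i ≡ 0
edge-irr G i = cong indicator (irrefl G i)

edge-≤1 : ∀ G i j → edge G i j ≤ 1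
edge-≤1 G i j = indicator-≤1 (adj G i j)

-- The number of homomorphisms K s → G.
hom : ℕ → Graph → ℕ
hom s G = Cliques.H (edge G) s (unit (allFin (V G)))

cliqueCount-hom : ∀ s G → s ! * cliqueCount s G ≡ hom s G
cliqueCount-hom s G = trans
  (cong (s ! *_) (countB-cong (allSubsets (V G)) λ p → cong (⌊ card p ℕ.≟ s ⌋ ∧_) (isClique≡cliqueIn G p)))
  (countCliques (adj G) (Graph.sym G) (irrefl G) s (λ _ → true))

-- The multipartite construction.

∑-allFin-+ : ∀ m n (f : Fin (m + n) → ℕ) →
  ∑ (allFin (m + n)) f ≡ ∑ (allFin m) (λ i → f (i ↑ˡ n)) + ∑ (allFin n) (λ i → f (m ↑ʳ i))
∑-allFin-+ zero    n f = refl
∑-allFin-+ (suc m) n f = trans (cong (λ l → ∑ l f) (allFin-suc (m + n)))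
  (trans (cong (f zero +_) (trans (∑-map suc (allFin (m + n))) (∑-allFin-+ m n (λ i → f (suc i)))))
  (trans (sym (+-assoc (f zero) _ _)) (cong (_+ ∑ (allFin n) (λ i → f (suc (m ↑ʳ i))))
    (sym (trans (cong (λ l → ∑ l (λ i → f (i ↑ˡ n))) (allFin-suc m)) (cong (f zero +_) (∑-map suc (allFin m))))))))

quotient-↑ˡ : ∀ r x (i : Fin x) → quotient {suc r} x (i ↑ˡ (r * x)) ≡ zero
quotient-↑ˡ r x i = cong proj₁ (Fin.remQuot-combine {suc r} zero i)

quotient-↑ʳ : ∀ r x (i : Fin (r * x)) → quotient {suc r} x (x ↑ʳ i) ≡ suc (quotient x i)
quotient-↑ʳ r x i rewrite Fin.splitAt-↑ʳ x (r * x) i = refl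

∑-quotient : ∀ r x (f : Fin r → ℕ) → ∑ (allFin (r * x)) (λ i → f (quotient x i)) ≡ x * ∑ (allFin r) f
∑-quotient zero    x f = sym (*-zeroʳ x)
∑-quotient (suc r) x f = begin
  ∑ (allFin (x + r * x)) (λ i → f (quotient x i))
    ≡⟨ ∑-allFin-+ x (r * x) _ ⟩
  ∑ (allFin x) (λ i → f (quotient x (i ↑ˡ (r * x)))) + ∑ (allFin (r * x)) (λ i → f (quotient {suc r} x (x ↑ʳ i)))
    ≡⟨ cong₂ _+_ (∑-cong (allFin x) λ i → cong f (quotient-↑ˡ r x i))
         (∑-cong (allFin (r * x)) λ i → cong f (quotient-↑ʳ r x i)) ⟩
  ∑ (allFin x) (λ _ → f zero) + ∑ (allFin (r * x)) (λ i → f (suc (quotient x i)))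
    ≡⟨ cong₂ _+_ (trans (∑-const (allFin x) (f zero)) (cong (_* f zero) (length-allFin x))) (∑-quotient r x (λ i → f (suc i))) ⟩
  x * f zero + x * ∑ (allFin r) (λ i → f (suc i))
    ≡⟨ sym (*-distribˡ-+ x (f zero) _) ⟩
  x * (f zero + ∑ (allFin r) (λ i → f (suc i)))
    ≡⟨ cong (x *_) (sym (trans (cong (λ l → ∑ l f) (allFin-suc r)) (cong (f zero +_) (∑-map suc (allFin r))))) ⟩
  x * ∑ (allFin (suc r)) f ∎
  where
  open ≡-Reasoning
  length-allFin : ∀ n → length (allFin n) ≡ n
  length-allFin zero    = refl
  length-allFin (suc n) = trans (cong length (allFin-suc n)) (cong suc (trans (length-map suc (allFin n)) (length-allFin n)))

-- The hypothesis says that, with multiplicity, `ys` is `x` copies of `xs`, so each of the s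
-- positions of a clique can be filled in `x` times as many ways.
H-multiple : {X : Set} (A : X → X → ℕ) (xs ys : List X) (x : ℕ) → (∀ f → ∑ ys f ≡ x * ∑ xs f) →
  ∀ s z → Cliques.H A s (weigh z ys) ≡ x ^ s * Cliques.H A s (weigh z xs)
H-multiple A xs ys x e zero    z = refl
H-multiple A xs ys x e (suc s) z = begin
  H (suc s) (weigh z ys)
    ≡⟨ H-weigh-suc s z ys ⟩
  ∑ ys (λ v → z v * H s (weigh (λ u → A v u * z u) ys))
    ≡⟨ e _ ⟩
  x * ∑ xs (λ v → z v * H s (weigh (λ u → A v u * z u) ys))
    ≡⟨ cong (x *_) (trans (∑-cong xs λ v → trans (cong (z v *_) (H-multiple A xs ys x e s _)) (lem (z v) (x ^ s) _)) (∑-*ˡ xs (x ^ s))) ⟩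
  x * (x ^ s * ∑ xs (λ v → z v * H s (weigh (λ u → A v u * z u) xs)))
    ≡⟨ trans (sym (*-assoc x (x ^ s) _)) (cong (x ^ suc s *_) (sym (H-weigh-suc s z xs))) ⟩
  x ^ suc s * H (suc s) (weigh z xs) ∎
  where
  open ≡-Reasoning
  open Cliques A
  lem : ∀ a b c → a * (b * c) ≡ b * (a * c)
  lem = solve-∀

hom-K : ∀ r s → hom s (K r) ≡ ff r s
hom-K zero    zero    = refl
hom-K zero    (suc s) = refl
hom-K (suc r) zero    = refl
hom-K (suc r) (suc s) = trans
  (H-allFin-suc (edge (K (suc r))) (edge-sym (K (suc r))) (edge-irr (K (suc r))) (edge-≤1 (K (suc r))) s (λ _ → 1))
  (cong₂ (λ x y → x + y) (trans (shrink (suc s)) (hom-K r (suc s)))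
    (cong₂ _*_ (*-identityʳ (suc s)) (trans (shrink s) (hom-K r s))))
  where
  shrink : ∀ s → Cliques.H (λ i j → edge (K (suc r)) (suc i) (suc j)) s (unit (allFin r)) ≡ hom s (K r)
  shrink s = go s (unit (allFin r))
    where
    go : ∀ s l → Cliques.H (λ i j → edge (K (suc r)) (suc i) (suc j)) s l ≡ Cliques.H (edge (K r)) s l
    go zero    l = refl
    go (suc s) l = ∑-cong l λ e → cong (proj₂ e *_) (trans (go s _) (cong (Cliques.H (edge (K r)) s)
      (map-cong (λ f → cong (λ b → proj₁ f , indicator (not b) * proj₂ f) (⌊suc≟suc⌋ (proj₁ e) (proj₁ f))) l)))

module _ (r x : ℕ) where

  multipartite : Graph
  multipartite = record
    { V = r * x
    ; adj = λ i j → adj (K r) (quotient x i) (quotient x j)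
    ; sym = λ i j → Graph.sym (K r) (quotient x i) (quotient x j)
    ; irrefl = λ i → irrefl (K r) (quotient x i)
    }

  multipartite-colorable : Colorable multipartite r
  multipartite-colorable = quotient x , λ i j e q → different (quotient x i) (quotient x j) e q
    where
    different : ∀ (a b : Fin r) → adj (K r) a b ≡ true → a ≢ b
    different a b e q with a Fin.≟ b
    different a b () q | yes _
    different a b e  q | no a≢b = a≢b q

  -- The graph is the pullback of `K r` along `quotient`, whose fibres have size x; `H-map` and
  -- `H-multiple` reduce the count to `K r`.
  hom-multipartite : ∀ s → hom s multipartite ≡ x ^ s * ff r s
  hom-multipartite s = trans (sym (H-map (edge (K r)) (quotient x) s (λ _ → 1) (allFin (r * x))))
    (trans (H-multiple (edge (K r)) (allFin r) (map (quotient x) (allFin (r * x))) x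
      (λ f → trans (∑-map (quotient {r} x) (allFin (r * x)) {f}) (∑-quotient r x f)) s (λ _ → 1))
    (cong (x ^ s *_) (hom-K r s)))

module _ (G : Graph) where

  addEdge : Graph
  addEdge = record { V = 2 + V G ; adj = a ; sym = a-sym ; irrefl = a-irr }
    where
    a : Fin (2 + V G) → Fin (2 + V G) → Bool
    a zero          (suc zero)    = true
    a (suc zero)    zero          = true
    a (suc (suc i)) (suc (suc j)) = adj G i j
    a _             _             = false
    a-sym : ∀ i j → a i j ≡ a j i
    a-sym zero          zero          = refl
    a-sym zero          (suc zero)    = refl
    a-sym zero          (suc (suc j)) = refl
    a-sym (suc zero)    zero          = refl
    a-sym (suc zero)    (suc zero)    = refl
    a-sym (suc zero)    (suc (suc j)) = refl
    a-sym (suc (suc i)) zero          = refl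
    a-sym (suc (suc i)) (suc zero)    = refl
    a-sym (suc (suc i)) (suc (suc j)) = Graph.sym G i j
    a-irr : ∀ i → a i i ≡ false
    a-irr zero          = refl
    a-irr (suc zero)    = refl
    a-irr (suc (suc i)) = irrefl G i

  addEdge-colorable : ∀ {r} → 2 ≤ r → Colorable G r → Colorable addEdge r
  addEdge-colorable {suc (suc r)} _ (c , proper) = c′ , proper′
    where
    c′ : Fin (2 + V G) → Fin (2 + r)
    c′ zero          = zero
    c′ (suc zero)    = suc zero
    c′ (suc (suc i)) = c i
    proper′ : ∀ i j → adj addEdge i j ≡ true → c′ i ≢ c′ j
    proper′ zero          (suc zero)    e ()
    proper′ (suc zero)    zero          e ()
    proper′ (suc (suc i)) (suc (suc j)) e = proper i j e
  addEdge-colorable {suc zero} (s≤s ())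

  open CliqueProperties (edge addEdge) (edge-sym addEdge) (edge-irr addEdge) (edge-≤1 addEdge)

  private
    old : List (Fin (2 + V G))
    old = map (λ i → suc (suc i)) (allFin (V G))

  hom-addEdge : ∀ s → hom s addEdge ≡ H s (unit (zero ∷ suc zero ∷ old))
  hom-addEdge s = cong (λ l → H s (unit l)) (trans (allFin-suc (suc (V G)))
    (cong (zero ∷_) (trans (cong (map suc) (allFin-suc (V G))) (cong (suc zero ∷_) (sym (map-∘ (allFin (V G))))))))

  H-old : ∀ s → H s (unit old) ≡ hom s G
  H-old s = H-map (edge addEdge) (λ i → suc (suc i)) s (λ _ → 1) (allFin (V G))

  hom-addEdge-≥ : ∀ s → hom s G ≤ hom s addEdge
  hom-addEdge-≥ s = begin
    hom s G                              ≡⟨ sym (H-old s) ⟩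
    H s (unit old)                       ≤⟨ H-∷-≥ s (suc zero , 1) (unit old) ⟩
    H s (unit (suc zero ∷ old))          ≤⟨ H-∷-≥ s (zero , 1) (unit (suc zero ∷ old)) ⟩
    H s (unit (zero ∷ suc zero ∷ old))   ≡⟨ sym (hom-addEdge s) ⟩
    hom s addEdge ∎
    where open ≤-Reasoning

  hom₂-addEdge : hom 2 addEdge ≡ hom 2 G + 2
  hom₂-addEdge = begin
    hom 2 addEdge
      ≡⟨ hom-addEdge 2 ⟩
    H 2 (unit (zero ∷ suc zero ∷ old))
      ≡⟨ H-∷ 1 zero 1 (unit (suc zero ∷ old)) ⟩
    H 2 (unit (suc zero ∷ old)) + 2 * (1 + H 1 (restrict zero (unit old)))
      ≡⟨ cong₂ (λ a b → a + 2 * (1 + b)) (H-∷ 1 (suc zero) 1 (unit old)) (isolated zero λ _ → refl) ⟩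
    H 2 (unit old) + 2 * H 1 (restrict (suc zero) (unit old)) + 2
      ≡⟨ cong₂ (λ a b → a + 2 * b + 2) (H-old 2) (isolated (suc zero) λ _ → refl) ⟩
    hom 2 G + 0 + 2
      ≡⟨ cong (_+ 2) (+-identityʳ (hom 2 G)) ⟩
    hom 2 G + 2 ∎
    where
    open ≡-Reasoning
    isolated : ∀ u → (∀ i → edge addEdge u (suc (suc i)) ≡ 0) → H 1 (restrict u (unit old)) ≡ 0
    isolated u e = trans (cong (H 1) (restrict-weigh u (λ _ → 1) old)) (trans (H-weigh-suc 0 _ old)
      (trans (∑-map (λ i → suc (suc i)) (allFin (V G))) (∑-zero (allFin (V G)) λ i → cong (λ z → z * 1 * 1) (e i))))

-- Disjoint edges adjust the number of edges to exactly m. Only `hom 2` has to be known exactly;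
-- larger clique counts need not drop.
addEdges : ∀ r → 2 ≤ r → ∀ G → Colorable G r → ∀ j → ∃ λ G′ →
  Colorable G′ r × hom 2 G′ ≡ hom 2 G + 2 * j × (∀ s → hom s G ≤ hom s G′)
addEdges r 2≤r G c zero    = G , c , sym (+-identityʳ _) , λ _ → ≤-refl
addEdges r 2≤r G c (suc j) with addEdges r 2≤r G c j
... | G′ , c′ , e , h = addEdge G′ , addEdge-colorable G′ 2≤r c′ ,
  trans (hom₂-addEdge G′) (trans (cong (_+ 2) e) (lem (hom 2 G) j)) , λ s → ≤-trans (h s) (hom-addEdge-≥ G′ s)
  where lem : ∀ a j → a + 2 * j + 2 ≡ a + 2 * (1 + j)
        lem = solve-∀

extremal-lower : ∀ r s x m → 2 ≤ r → x * x * ff r 2 ≤ 2 * m → ∃ λ G →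
  Colorable G r × edgeCount G ≡ m × x ^ s * ff r s ≤ s ! * cliqueCount s G
extremal-lower r s x m 2≤r small with addEdges r 2≤r (multipartite r x) (multipartite-colorable r x) (m ∸ edgeCount (multipartite r x))
... | G , c , e , h = G , c , *-cancelˡ-≡ _ _ 2 edges≡ ,
  ≤-trans (≤-reflexive (sym (hom-multipartite r x s))) (≤-trans (h s) (≤-reflexive (sym (cliqueCount-hom s G))))
  where
  T = multipartite r x
  T≤m : edgeCount T ≤ m
  T≤m = *-cancelˡ-≤ 2 (≤-trans (≤-reflexive (trans (cliqueCount-hom 2 T) (trans (hom-multipartite r x 2)
    (cong (λ z → x * z * ff r 2) (*-identityʳ x))))) small)
  edges≡ : 2 * edgeCount G ≡ 2 * m
  edges≡ = trans (cliqueCount-hom 2 G) (trans e (trans (cong (_+ 2 * (m ∸ edgeCount T)) (sym (cliqueCount-hom 2 T)))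
    (trans (sym (*-distribˡ-+ 2 (edgeCount T) _)) (cong (2 *_) (m+[n∸m]≡n T≤m)))))

-- Colourings and embeddings into blow-ups.

same : ∀ {n} → Fin n → Fin n → ℕ
same u v = indicator ⌊ u Fin.≟ v ⌋

same-refl : ∀ {n} (v : Fin n) → same v v ≢ 0
same-refl v e with v Fin.≟ v
same-refl v () | yes _
same-refl v e  | no q = q refl

Colorable-⊆ : ∀ {F G r} → F ⊆ᴳ G → Colorable G r → Colorable F r
Colorable-⊆ (f , _ , hom) (c , proper) = (λ i → c (f i)) , λ i j e → proper (f i) (f j) (hom i j e)

K-chromatic : ∀ r → ChromaticNumberIs (K (suc r)) (suc r)
K-chromatic r = ((λ i → i) , proper) , λ { (c , p) → clash c p }
  where
  proper : ∀ i j → adj (K (suc r)) i j ≡ true → i ≢ j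
  proper i j e q with i Fin.≟ j
  proper i j () q | yes _
  proper i j e q  | no i≢j = i≢j q
  adjacent : ∀ i j → i ≢ j → adj (K (suc r)) i j ≡ true
  adjacent i j i≢j with i Fin.≟ j
  ... | yes q = ⊥-elim (i≢j q)
  ... | no _  = refl
  clash : (c : Fin (suc r) → Fin r) → ¬ (∀ i j → adj (K (suc r)) i j ≡ true → c i ≢ c j)
  clash c p with Fin.pigeonhole ≤-refl c
  ... | i , j , i<j , e = p i j (adjacent i j (Fin.<⇒≢ i<j)) e

module _ (F G : Graph) {k : ℕ} where

  open BlowUps (edge G) (edge-sym G) same same-refl (suc (V F))

  blow-up-⊇ : ∀ z → BlowUp k z → Colorable F k → F ⊆ᴳ G
  blow-up-⊇ z b (c , proper) = f , injective , λ i j e → nonzero (cross i j (proper i j e))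
    where
    f : Fin (V F) → Fin (V G)
    -- Colour classes go to parts, and inside a part each vertex keeps its own index. The parts have
    -- `suc (V F)` elements, a successor as the power mean requires, hence `inject₁`.
    f i = vertex k z b (c i) (inject₁ i)
    nonzero : ∀ {b} → indicator b ≢ 0 → b ≡ true
    nonzero {true}  _ = refl
    nonzero {false} q = ⊥-elim (q refl)
    cross : ∀ i j → c i ≢ c j → edge G (f i) (f j) ≢ 0
    cross i j = vertex-adjacent k z b (c i) (c j) (inject₁ i) (inject₁ j)
    injective : ∀ {i j} → f i ≡ f j → i ≡ j
    injective {i} {j} e with c i Fin.≟ c j
    ... | yes q = Fin.inject₁-injective (vertex-injective k z b (c i) (inject₁ i) (inject₁ j)
      (trans e (cong (λ a → vertex k z b a (inject₁ j)) (sym q))))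
    ... | no q  = ⊥-elim (cross i j q (trans (cong (edge G (f i)) (sym e)) (edge-irr G (f i))))

-- Comparison of the two extremal numbers.

extremal-upper : ∀ r s N → 3 ≤ s → 0 < N → 0 < ff r 2 → ∀ F → Colorable F (suc r) →
  ∃ λ X₀ → ∀ x → X₀ ≤ x → ∀ G → G Free F → 2 * edgeCount G ≤ ff r 2 * ((1 + x) * (1 + x)) →
  N * (s ! * cliqueCount s G) ≤ (N * ff r s + (ff r s + 2 + 4 * s * ff r 2)) * x ^ s
extremal-upper r s@(suc (suc (suc s′))) N (s≤s (s≤s (s≤s z≤n))) 0<N 0<c F col = X₀ , λ x x≥ G free e≤ →
  subst (λ z → N * z ≤ (N * ff r s + C) * x ^ s) (sym (cliqueCount-hom s G))
    (upper-bound (edge G) (edge-sym G) (edge-irr G) (edge-≤1 G) same same-refl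
      x (allFin (V G)) x≥ (∑-δ-allFin (V G)) (λ b → free (blow-up-⊇ F G (λ _ → 1) b col))
      (≤-trans (≤-reflexive (sym (cliqueCount-hom 2 G))) e≤))
  where open Parameters r s′ N (V F) 0<N 0<c

2≤ff₂ : ∀ r → 3 ≤ r → 2 ≤ ff r 2
2≤ff₂ r@(suc (suc (suc r′))) (s≤s (s≤s (s≤s z≤n))) = subst (2 ≤_)
  (sym (trans (ff-suc r 1) (cong ((2 + r′) *_) (ff-suc r 0))))
  (*-mono-≤ {2} {2 + r′} {1} {(3 + r′) * 1} (s≤s (s≤s z≤n)) (s≤s z≤n))

-- The integer part of √(y/c). With y = 2m it is the part size x for which the r-partite graph just
-- fits into m edges.
floor-sqrt : ∀ c → 0 < c → ∀ y → ∃ λ x → x * x * c ≤ y × y < c * ((1 + x) * (1 + x))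
floor-sqrt c 0<c zero    = 0 , z≤n , ≤-trans 0<c (≤-reflexive (sym (*-identityʳ c)))
floor-sqrt c 0<c (suc y) with floor-sqrt c 0<c y
... | x , lo , hi with ≤-<-connex (c * ((1 + x) * (1 + x))) (suc y)
...   | inj₂ q = x , m≤n⇒m≤1+n lo , q
...   | inj₁ q = suc x , ≤-trans (≤-reflexive (*-comm ((1 + x) * (1 + x)) c)) q ,
  ≤-<-trans hi (*-monoʳ-< c {{>-nonZero 0<c}} (*-mono-< (n<1+n (suc x)) (n<1+n (suc x))))

∣-∣-≤ : ∀ a b d → a ≤ b + d → b ≤ a + d → ∣ a - b ∣ ≤ d
∣-∣-≤ zero    b       d p q = q
∣-∣-≤ (suc a) zero    d p q = p
∣-∣-≤ (suc a) (suc b) d p q = ∣-∣-≤ a b d (s≤s⁻¹ p) (s≤s⁻¹ q)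

theorem1p10 : (r s : ℕ) → 3 ≤ r → 3 ≤ s → (F : Graph) → ChromaticNumberIs F (suc r) →
    (k : ℕ) → Σ ℕ λ M → (m : ℕ) → M ≤ m → (a b : ℕ) →
    IsMex s m F a → IsMex s m (K (suc r)) b →
    (suc k ^ 2) * (∣ a - b ∣ ^ 2) ≤ m ^ s
theorem1p10 r s 3≤r 3≤s F (F-col , F-uncol) k =
  -- If `m` is at least this large, then `x ≥ X`: otherwise c (1 + x)² ≤ c X² ≤ m, against the
  -- maximality of `x` for 2m.
  c * (X * X) , proof
  where
  c C N X : ℕ
  c = ff r 2
  C = ff r s + 2 + 4 * s * c
  -- The window has width `C * x ^ s`; cancelling `C` leaves the factor `suc k` demanded by the
  -- conclusion.
  N = suc k * C
  2≤c : 2 ≤ c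
  2≤c = 2≤ff₂ r 3≤r
  0<c : 0 < c
  0<c = ≤-trans (s≤s z≤n) 2≤c
  0<C : 0 < C
  0<C = ≤-trans (s≤s z≤n) (≤-trans (m≤n+m 2 (ff r s)) (m≤m+n (ff r s + 2) (4 * s * c)))
  0<N : 0 < N
  0<N = *-mono-≤ {1} {suc k} {1} {C} (s≤s z≤n) 0<C
  K-col : Colorable (K (suc r)) (suc r)
  K-col = proj₁ (K-chromatic r)
  upper-F = extremal-upper r s N 3≤s 0<N 0<c F F-col
  upper-K = extremal-upper r s N 3≤s 0<N 0<c (K (suc r)) K-col
  X = proj₁ upper-F ⊔ proj₁ upper-K
  proof : (m : ℕ) → c * (X * X) ≤ m → (a b : ℕ) → IsMex s m F a → IsMex s m (K (suc r)) b →
    (suc k ^ 2) * (∣ a - b ∣ ^ 2) ≤ m ^ s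
  proof m m-large a b ((G , G-free , G-edges , G-count) , a-max) ((G′ , G′-free , G′-edges , G′-count) , b-max)
    with floor-sqrt c 0<c (2 * m)
  ... | x , lo , hi with extremal-lower r s x m (≤-trans (n≤1+n 2) 3≤r) lo
  ...   | T , T-col , T-edges , T-count = begin
    (suc k ^ 2) * (∣ a - b ∣ ^ 2)
      ≡⟨ sym (^-*-distrib (suc k) ∣ a - b ∣ 2) ⟩
    (suc k * ∣ a - b ∣) ^ 2
      ≤⟨ ^-monoˡ-≤ 2 close ⟩
    (x ^ s) ^ 2
      ≡⟨ trans (cong (x ^ s *_) (*-identityʳ (x ^ s))) (sym (^-*-distrib x x s)) ⟩
    (x * x) ^ s
      ≤⟨ ^-monoˡ-≤ s x²≤m ⟩
    m ^ s ∎
    where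
    open ≤-Reasoning
    x²≤m : x * x ≤ m
    x²≤m = *-cancelˡ-≤ 2 (≤-trans (*-monoˡ-≤ (x * x) 2≤c) (≤-trans (≤-reflexive (*-comm c (x * x))) lo))
    X≤x : X ≤ x
    X≤x with ≤-<-connex X x
    ... | inj₁ q = q
    ... | inj₂ q = ⊥-elim (<⇒≱ hi (≤-trans (*-monoʳ-≤ c (*-mono-≤ q q)) (≤-trans m-large (m≤n*m m 2))))
    edges≤ : ∀ {G} → edgeCount G ≡ m → 2 * edgeCount G ≤ c * ((1 + x) * (1 + x))
    edges≤ e = ≤-trans (≤-reflexive (cong (2 *_) e)) (<⇒≤ hi)
    a-upper : N * (s ! * a) ≤ (N * ff r s + C) * x ^ s
    a-upper = subst (λ v → N * (s ! * v) ≤ (N * ff r s + C) * x ^ s) G-count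
      (proj₂ upper-F x (≤-trans (m≤m⊔n _ _) X≤x) G G-free (edges≤ {G} G-edges))
    b-upper : N * (s ! * b) ≤ (N * ff r s + C) * x ^ s
    b-upper = subst (λ v → N * (s ! * v) ≤ (N * ff r s + C) * x ^ s) G′-count
      (proj₂ upper-K x (≤-trans (m≤n⊔m _ _) X≤x) G′ G′-free (edges≤ {G′} G′-edges))
    -- Each maximum is at least the clique count of `T`, so the common upper bound exceeds
    -- `N * (s ! * v)` by at most `C * x ^ s`. Applied to both maxima, this bounds their difference.
    lower : ∀ v → cliqueCount s T ≤ v → (N * ff r s + C) * x ^ s ≤ N * (s ! * v) + C * x ^ s
    lower v p = begin
      (N * ff r s + C) * x ^ s        ≡⟨ lem N (ff r s) C (x ^ s) ⟩
      N * (x ^ s * ff r s) + C * x ^ s ≤⟨ +-monoˡ-≤ (C * x ^ s) (*-monoʳ-≤ N (≤-trans T-count (*-monoʳ-≤ (s !) p))) ⟩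
      N * (s ! * v) + C * x ^ s ∎
      where lem : ∀ n f c x → (n * f + c) * x ≡ n * (x * f) + c * x
            lem = solve-∀
    a-lower = lower a (a-max T (λ F⊆T → F-uncol (Colorable-⊆ {F} {T} F⊆T T-col)) T-edges)
    b-lower = lower b (b-max T (λ K⊆T → proj₂ (K-chromatic r) (Colorable-⊆ {K (suc r)} {T} K⊆T T-col)) T-edges)
    close : suc k * ∣ a - b ∣ ≤ x ^ s
    close = cancel C 0<C (begin
      C * (suc k * ∣ a - b ∣)
        ≡⟨ lem C (suc k) ∣ a - b ∣ ⟩
      N * ∣ a - b ∣
        ≤⟨ *-monoʳ-≤ N (m≤n*m ∣ a - b ∣ (s !) {{s !≢0}}) ⟩
      N * (s ! * ∣ a - b ∣)
        ≡⟨ trans (cong (N *_) (*-distribˡ-∣-∣ (s !) a b)) (*-distribˡ-∣-∣ N (s ! * a) (s ! * b)) ⟩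
      ∣ N * (s ! * a) - N * (s ! * b) ∣
        ≤⟨ ∣-∣-≤ _ _ _ (≤-trans a-upper b-lower) (≤-trans b-upper a-lower) ⟩
      C * x ^ s ∎)
      where lem : ∀ c k d → c * (k * d) ≡ k * c * d
            lem = solve-∀
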